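{- We have \[ \sum_{n=0}^{\infty}b_{19}(22n+2)q^{n}\equiv q^{4}\sum_{n=0}^{\infty}b_{19}(2n)q^{11n}\pmod 2 . \] Consequently, for every integer $k\not\equiv 4\pmod{11}$ and every $n\ge0$, \[ b_{19}(242n+22k+2)\equiv 0\pmod 2, \] and, by iteration, for all integers $d\ge1$, $k\ge1$ with $k\not\equiv 4\pmod{11}$ and all $n\ge 0$, \[ b_{19}\!\left(2\cdot 11^{2d}n+2\cdot 11^{2d-1}k+2\cdot 11^{2d-2}+90\cdot\frac{11^{2d-2}-1}{120}\right)\equiv 0\pmod 2 . \]
   Context: For an integer $t\ge 2$, $b_t(n)$ denotes the number of partitions of $n$ none of whose parts is divisible by $t$ (with $b_t(0)=1$); equivalently $\sum_{n\ge0}b_t(n)q^n=f_t/f_1$, where $f_k=\prod_{j\ge1}(1-q^{jk})$. Congruences of power series are coefficientwise. -}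

module Defs where

open import Data.Nat using (ℕ; zero; suc; _+_; _*_; _∸_; _≟_)
open import Data.Nat.Divisibility using (_∣_; _∣?_)
open import Data.Nat.DivMod using (_%_; _/_)
open import Data.List using (List; []; _∷_; length; filter; map; concatMap; replicate; _++_; upTo)
open import Data.List.Relation.Unary.All using (All; all?)
open import Data.Integer using (ℤ; +_; -[1+_])
open import Relation.Nullary using (¬_; ¬?; yes; no)

-- partitionsUpTo k n : all partitions of n (as non-increasing lists of
-- positive parts) whose parts are all ≤ k.  Built by choosing the
-- multiplicity j of the largest allowed part (suc k), j·(suc k) ≤ n.
partitionsUpTo : ℕ → ℕ → List (List ℕ)
partitionsUpTo zero    zero    = [] ∷ []
partitionsUpTo zero    (suc n) = []
partitionsUpTo (suc k) n =
  concatMap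
    (λ j → map (replicate j (suc k) ++_) (partitionsUpTo k (n ∸ j * suc k)))
    (filter (λ j → j * suc k Data.Nat.≤? n) (upTo (suc n)))

partitions : ℕ → List (List ℕ)
partitions n = partitionsUpTo n n

b : ℕ → ℕ → ℕ
b t n = length (filter (λ λs → all? (λ p → ¬? (t ∣? p)) λs) (partitions n))

bℤ : ℕ → ℤ → ℕ
bℤ t (+ n)     = b t n
bℤ t -[1+ n ]  = 0

-- coefficient of q^m in  q^4 Σ_{n≥0} b19(2n) q^{11n}
rhsCoeff : ℕ → ℕ
rhsCoeff m with m % 11 ≟ 4
... | yes _ = b 19 (2 * ((m ∸ 4) / 11))
... | no  _ = 0

{-# OPTIONS --safe #-}
-- Modulo 2 let f₁ = ∏ (1 + qʲ), so that f₁² = f₁(q²) and f₁ · Σ b₁₉(n) qⁿ = f₁(q¹⁹).  Multiplying by f₁ and taking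
-- even parts, Σ b₁₉(2n) qⁿ is E / f₁, where E(q²) is the even part of f₁(q) f₁(q¹⁹).  It turns out to be a theta
-- series Θ: its coefficient at n is the parity of the number of representations
--   9v² = 24n + 9,   57v² = 24n + 9,   u² + 152v² = 24n + 9 with 3 ∤ u   (u, v ≥ 0),
-- and since −152 is not a square modulo 11, a representation of a multiple of 11 is 11 times a representation;
-- this gives all three congruences.
--
-- With Euler's pentagonal number theorem, f₁ · Θ = E says that for M = 12N + 5 the number of
-- positive solutions of   u² + 9v² = 2M,   u² + 19v² = 4M,   u² + 57v² = 2M   is even in total.  The solutions are
-- matched in pairs.  Dividing by a common factor one may assume gcd(v, M) = 1; then u/v modulo M is a square root of
-- −9, −19 or −57, and by reduction of binary quadratic forms the solutions correspond exactly to the roots up to sign.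
-- If M = P n with P a power of a prime p ≠ 19, p ∤ n and n ∉ {1, 19}, a root is paired with the one that agrees with it
-- modulo P and is opposite to it modulo n.  Otherwise each equation has at most one solution.  For n = 1, −1 is a
-- square and 3 a nonsquare modulo p ≡ 5 (mod 12), so exactly one of −19, −57 is a square; for n = 19,
-- p ≡ 11 (mod 12), 3 is a square, so −19 and −57 are both squares or both nonsquares, and −9 is not a square modulo 19.
-- Hence none or exactly two of the equations are solvable.

module Submission where

-- In u² + 19 v² = 4 M the variables have equal parity. The odd solutions form the coefficient of E
-- at N. The even ones have 4 ∣ v and reduce to 2 u² + 152 w² = 2 M, a coefficient of f₁(q²) = f₁²
-- times the series of 152 w²; this is why the third part of Θ is f₁ times that series. The other
-- two equations come from f₁ times the series of 9 v² and of 57 v². A prime p ≠ 19 is always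
-- available because a number ≡ 2 (mod 3) has a prime factor ≡ 2 (mod 3). The cofactors 1 and 19 are
-- exceptional because a root equals its negative modulo n only if n ∣ 2 u v, and a divisor common
-- to m and u must divide the discriminant. Congruences exclude every reduced form except those
-- behind the three equations, so each root comes from a solution. The quadratic characters rest on
-- the same tools: reduction in determinants 1 and 3 shows that -1 and -3 are nonsquares in suitable
-- progressions, matching residues with their inverses shows that -1 is a square modulo p ≡ 5 (mod
-- 12), and a pigeonhole argument makes the product of two nonsquares a square.

module QuadraticForms where

  open import Data.Nat
  open import Data.Nat.Properties
  open import Data.Nat.DivMod
  open import Data.Nat.Divisibility
  open import Data.Nat.Coprimality using (Coprime; coprime-divisor)
  open import Data.Nat.Induction using (<-wellFounded)
  open import Data.Nat.ListAction using (product)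
  open import Data.Nat.Primality
  open import Data.Nat.Primality.Factorisation
  open import Data.Integer as ℤ using (ℤ; +_)
  import Data.Integer.Properties as ℤ
  import Data.Integer.Divisibility.Signed as ℤ
  open import Data.Bool using (Bool; false; not)
  open import Data.List using (List; []; _∷_; _++_; length)
  open import Data.List.Membership.DecPropositional _≟_ using (_∈?_)
  open import Data.List.Membership.Propositional using (_∈_)
  open import Data.List.Membership.Propositional.Properties using (∈-∃++; ∈-++⁺ˡ; ∈-++⁺ʳ; ∈-++⁻)
  open import Data.List.Relation.Unary.All as All using (All; []; _∷_)
  open import Data.List.Relation.Unary.AllPairs using (_∷_)
  open import Data.List.Relation.Unary.Any using (here; there)
  open import Data.List.Relation.Unary.Unique.Propositional using (Unique)
  open import Data.Empty
  open import Data.Product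
  open import Data.Sum as Sum using (_⊎_; inj₁; inj₂)
  open import Induction.WellFounded using (Acc; acc)
  open import Relation.Binary.PropositionalEquality
  open import Relation.Nullary using (¬_; Dec; yes; no; ¬?)
  open import Relation.Nullary.Decidable using (True; toWitness; _→-dec_; _⊎-dec_)
  import Data.Nat.Tactic.RingSolver as ℕR
  import Data.Integer.Tactic.RingSolver as ℤR

  -- Reduction of binary quadratic forms

  form : ℤ → ℤ → ℤ → ℤ → ℤ → ℤ
  form a b c x y = a ℤ.* (x ℤ.* x) ℤ.+ + 2 ℤ.* (b ℤ.* (x ℤ.* y)) ℤ.+ c ℤ.* (y ℤ.* y)

  -- The reducing substitution is discarded: later steps only need the minimum `A` and a vector at
  -- which the original form attains it.
  record ReducedValue (D a b c : ℕ) : Set where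
    constructor reducedValue
    field
      A B C : ℕ
      determinant : A * C ≡ B * B + D
      2B≤A : 2 * B ≤ A
      A≤C : A ≤ C
      x y : ℤ
      value : form (+ a) (+ b) (+ c) x y ≡ + A

  reduced-transport : ∀ {D a b c a′ b′ c′} (f g : ℤ → ℤ → ℤ) →
    (∀ x y → form (+ a) (+ b) (+ c) (f x y) (g x y) ≡ form (+ a′) (+ b′) (+ c′) x y) →
    ReducedValue D a′ b′ c′ → ReducedValue D a b c
  reduced-transport f g eq (reducedValue A B C d p q x y v) =
    reducedValue A B C d p q (f x y) (g x y) (trans (eq x y) v)

  form-swap : ∀ a b c x y → form a b c y x ≡ form c b a x y
  form-swap = expanded
    where
    expanded : ∀ a b c x y →
      a ℤ.* (y ℤ.* y) ℤ.+ + 2 ℤ.* (b ℤ.* (y ℤ.* x)) ℤ.+ c ℤ.* (x ℤ.* x)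
      ≡ c ℤ.* (x ℤ.* x) ℤ.+ + 2 ℤ.* (b ℤ.* (x ℤ.* y)) ℤ.+ a ℤ.* (y ℤ.* y)
    expanded = ℤR.solve-∀

  form-shift : ∀ a b c x y → form a (a ℤ.+ b) (b ℤ.+ b ℤ.+ a ℤ.+ c) (x ℤ.- y) y ≡ form a b c x y
  form-shift = expanded
    where
    expanded : ∀ a b c x y →
      a ℤ.* ((x ℤ.- y) ℤ.* (x ℤ.- y)) ℤ.+ + 2 ℤ.* ((a ℤ.+ b) ℤ.* ((x ℤ.- y) ℤ.* y)) ℤ.+ (b ℤ.+ b ℤ.+ a ℤ.+ c) ℤ.* (y ℤ.* y)
      ≡ a ℤ.* (x ℤ.* x) ℤ.+ + 2 ℤ.* (b ℤ.* (x ℤ.* y)) ℤ.+ c ℤ.* (y ℤ.* y)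
    expanded = ℤR.solve-∀

  -- If the middle coefficient lies between a / 2 and a, translation alone makes it nonpositive; the
  -- sign change of x restores b ≥ 0, so all coefficients remain natural numbers.
  form-shift-reflect : ∀ b c e x y →
    form (b ℤ.+ e ℤ.+ b) (b ℤ.+ e) (e ℤ.+ c) (ℤ.- x ℤ.- y) y ≡ form (b ℤ.+ e ℤ.+ b) b c x y
  form-shift-reflect = expanded
    where
    expanded : ∀ b c e x y →
      (b ℤ.+ e ℤ.+ b) ℤ.* ((ℤ.- x ℤ.- y) ℤ.* (ℤ.- x ℤ.- y)) ℤ.+ + 2 ℤ.* ((b ℤ.+ e) ℤ.* ((ℤ.- x ℤ.- y) ℤ.* y)) ℤ.+ (e ℤ.+ c) ℤ.* (y ℤ.* y)
      ≡ (b ℤ.+ e ℤ.+ b) ℤ.* (x ℤ.* x) ℤ.+ + 2 ℤ.* (b ℤ.* (x ℤ.* y)) ℤ.+ c ℤ.* (y ℤ.* y)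
    expanded = ℤR.solve-∀

  -- Gauss reduction of the form a x² + 2 b x y + c y² of determinant D, keeping b ≥ 0.
  -- The outer coefficient c drops at each translation step; n bounds a + c.
  reduce≤ : ∀ n D .{{_ : NonZero D}} a b c → a + c ≤ n → a * c ≡ b * b + D → a ≤ c → ReducedValue D a b c
  reduce : ∀ n D .{{_ : NonZero D}} a b c → a + c ≤ n → a * c ≡ b * b + D → ReducedValue D a b c

  reduce n D a b c s e with ≤-total a c
  ... | inj₁ a≤c = reduce≤ n D a b c s e a≤c
  ... | inj₂ c≤a = reduced-transport (λ x y → y) (λ x y → x) (λ x y → form-swap (+ a) (+ b) (+ c) x y)
                     (reduce≤ n D c b a (subst (_≤ n) (+-comm a c) s) (trans (*-comm c a) e) c≤a)

  reduce≤ n D a b c s e a≤c with 2 * b ≤? a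
  ... | yes 2b≤a = reducedValue a b c e 2b≤a a≤c (+ 1) (+ 0) (form-at-1-0 (+ a) (+ b) (+ c))
    where
    form-at-1-0 : ∀ a b c → a ℤ.* (+ 1 ℤ.* + 1) ℤ.+ + 2 ℤ.* (b ℤ.* (+ 1 ℤ.* + 0)) ℤ.+ c ℤ.* (+ 0 ℤ.* + 0) ≡ a
    form-at-1-0 = ℤR.solve-∀
  -- a = 0 would give b² + D = 0, contrary to D ≠ 0.
  reduce≤ zero D zero b c s e a≤c | no _ = ⊥-elim (≢-nonZero⁻¹ D (m+n≡0⇒n≡0 (b * b) (sym e)))
  reduce≤ (suc n) D zero b c s e a≤c | no _ = ⊥-elim (≢-nonZero⁻¹ D (m+n≡0⇒n≡0 (b * b) (sym e)))
  reduce≤ (suc n) D a@(suc _) b c s e a≤c | no a≱2b with ≤-total a b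
  ... | inj₁ a≤b with m≤n⇒∃[o]m+o≡n a≤b
  ... | b′ , refl = go (m≤n⇒∃[o]m+o≡n c≥)
    where
    open ≤-Reasoning
    expand : ∀ a b → b * b + a * (b + b + a) ≡ (a + b) * (a + b)
    expand = ℕR.solve-∀
    -- The new outer coefficient c - (2 b′ + a) must be natural: a c = (a + b′)² + D ≥ a (2 b′ + a).
    c≥ : b′ + b′ + a ≤ c
    c≥ = *-cancelˡ-≤ a (begin
      a * (b′ + b′ + a) ≤⟨ m≤n+m _ (b′ * b′) ⟩
      b′ * b′ + a * (b′ + b′ + a) ≡⟨ expand a b′ ⟩
      (a + b′) * (a + b′) ≤⟨ m≤m+n _ D ⟩
      (a + b′) * (a + b′) + D ≡⟨ e ⟨
      a * c ∎)
    go : (∃ λ o → b′ + b′ + a + o ≡ c) → ReducedValue D a (a + b′) c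
    go (c′ , refl) = reduced-transport (λ x y → x ℤ.- y) (λ x y → y) (λ x y → form-shift (+ a) (+ b′) (+ c′) x y)
      (reduce n D a b′ c′ size det)
      where
      size : a + c′ ≤ n
      size = ≤-pred (≤-trans (+-monoʳ-< a (begin-strict
        c′ <⟨ m<n+m c′ {a} z<s ⟩
        a + c′ ≤⟨ m≤n+m (a + c′) (b′ + b′) ⟩
        b′ + b′ + (a + c′) ≡⟨ +-assoc (b′ + b′) a c′ ⟨
        b′ + b′ + a + c′ ∎)) s)
      split : ∀ a b c → a * (b + b + a + c) ≡ a * c + a * (b + b + a)
      split = ℕR.solve-∀
      merge : ∀ a b D → (a + b) * (a + b) + D ≡ b * b + D + a * (b + b + a)
      merge = ℕR.solve-∀
      det : a * c′ ≡ b′ * b′ + D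
      det = +-cancelʳ-≡ _ _ _ (trans (sym (split a b′ c′)) (trans e (merge a b′ D)))
  reduce≤ (suc n) D a@(suc _) b c s e a≤c | no a≱2b | inj₂ b≤a with m≤n⇒∃[o]m+o≡n b≤a
  ... | b′ , b+b′≡a with m≤n⇒∃[o]m+o≡n b′≤b
    where
    b′≤b : b′ ≤ b
    b′≤b = +-cancelˡ-≤ b b′ b (begin
      b + b′ ≡⟨ b+b′≡a ⟩
      a ≤⟨ <⇒≤ (≰⇒> a≱2b) ⟩
      2 * b ≡⟨ cong (_+_ b) (+-identityʳ b) ⟩
      b + b ∎)
      where open ≤-Reasoning
  ... | e′ , refl = go b+b′≡a a≱2b s e (m≤n⇒∃[o]m+o≡n e′≤c)
    where
    e′≤c : e′ ≤ c
    e′≤c = ≤-trans (m≤n+m e′ b′) (≤-trans b≤a a≤c)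
    go : ∀ {a} → b′ + e′ + b′ ≡ a → 2 * (b′ + e′) ≰ a → a + c ≤ suc n → a * c ≡ (b′ + e′) * (b′ + e′) + D →
         (∃ λ o → e′ + o ≡ c) → ReducedValue D a (b′ + e′) c
    go refl a≱2b s e (c′ , refl) =
      reduced-transport {a′ = b′ + e′ + b′} (λ x y → ℤ.- x ℤ.- y) (λ x y → y)
        (λ x y → form-shift-reflect (+ b′) (+ c′) (+ e′) x y)
        (reduce n D _ b′ c′ size det)
      where
      double : ∀ b → 2 * (b + 0) ≡ b + 0 + b
      double = ℕR.solve-∀
      -- e′ = 2 b - a is positive because 2 b ≤ a has failed; c drops by exactly e′.
      0<e′ : 0 < e′
      0<e′ = n≢0⇒n>0 λ { refl → a≱2b (≤-reflexive (double b′)) }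
      size : b′ + e′ + b′ + c′ ≤ n
      size = ≤-pred (≤-trans (+-monoʳ-< (b′ + e′ + b′) (m<n+m c′ 0<e′)) s)
      split : ∀ b e c → (b + e + b) * (e + c) ≡ (b + e + b) * c + (b + e + b) * e
      split = ℕR.solve-∀
      merge : ∀ b e D → (b + e) * (b + e) + D ≡ b * b + D + (b + e + b) * e
      merge = ℕR.solve-∀
      det : (b′ + e′ + b′) * c′ ≡ b′ * b′ + D
      det = +-cancelʳ-≡ _ _ _ (trans (sym (split b′ e′ c′)) (trans e (merge b′ e′ D)))

  abs-square : ∀ i → + (ℤ.∣ i ∣ * ℤ.∣ i ∣) ≡ i ℤ.* i
  abs-square i with ℤ.+∣i∣≡i⊎+∣i∣≡-i i
  ... | inj₁ e = trans (ℤ.pos-* ℤ.∣ i ∣ ℤ.∣ i ∣) (cong₂ ℤ._*_ e e)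
  ... | inj₂ e = trans (ℤ.pos-* ℤ.∣ i ∣ ℤ.∣ i ∣) (trans (cong₂ ℤ._*_ e e) (neg-sq i))
    where
    neg-sq : ∀ i → ℤ.- i ℤ.* ℤ.- i ≡ i ℤ.* i
    neg-sq = ℤR.solve-∀

  quad-mod : ∀ n .{{_ : NonZero n}} D u v → (u * u + D * (v * v)) % n ≡ ((u % n) * (u % n) + D * ((v % n) * (v % n))) % n
  quad-mod n D u v = begin
    (u * u + D * (v * v)) % n
      ≡⟨ cong₂ (λ a b → (a * a + D * (b * b)) % n) (m≡m%n+[m/n]*n u n) (m≡m%n+[m/n]*n v n) ⟩
    ((u % n + u / n * n) * (u % n + u / n * n) + D * ((v % n + v / n * n) * (v % n + v / n * n))) % n
      ≡⟨ cong (_% n) (expand (u % n) (u / n) (v % n) (v / n) D n) ⟩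
    ((u % n) * (u % n) + D * ((v % n) * (v % n))
      + (2 * (u % n) * (u / n) + (u / n) * (u / n) * n + D * (2 * (v % n) * (v / n) + (v / n) * (v / n) * n)) * n) % n
      ≡⟨ [m+kn]%n≡m%n _ (2 * (u % n) * (u / n) + (u / n) * (u / n) * n + D * (2 * (v % n) * (v / n) + (v / n) * (v / n) * n)) n ⟩
    ((u % n) * (u % n) + D * ((v % n) * (v % n))) % n ∎
    where
    open ≡-Reasoning
    expand : ∀ r q s t D n → (r + q * n) * (r + q * n) + D * ((s + t * n) * (s + t * n))
      ≡ r * r + D * (s * s) + (2 * r * q + q * q * n + D * (2 * s * t + t * t * n)) * n
    expand = ℕR.solve-∀

  Unrepresented : (n : ℕ) .{{_ : NonZero n}} → ℕ → ℕ → Set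
  Unrepresented n D t = ∀ {r} → r < n → ∀ {s} → s < n → (r * r + D * (s * s)) % n ≢ t % n

  unrepresented? : ∀ n .{{_ : NonZero n}} D t → Dec (Unrepresented n D t)
  unrepresented? n D t = allUpTo? (λ r → allUpTo? (λ s → ¬? ((r * r + D * (s * s)) % n ≟ t % n)) n) n

  -- Since n ∣ A b, the value A m is constant modulo n along the progression, and a finite table
  -- over residues decides. The table is computed when the implicit `True` arguments are filled in.
  obstruction : ∀ n .{{_ : NonZero n}} D A a b {_ : True (unrepresented? n D (A * a))} {_ : True (n ∣? A * b)} →
    ∀ u v k {m} → u * u + D * (v * v) ≡ A * m → m ≡ a + k * b → ⊥
  obstruction n D A a b {w} {n∣} u v k e refl = go (toWitness n∣)
    where
    distribute : ∀ A a k b → A * (a + k * b) ≡ A * a + k * (A * b)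
    distribute = ℕR.solve-∀
    go : n ∣ A * b → ⊥
    go (divides q Ab≡) = toWitness w (m%n<n u n) (m%n<n v n) (trans (sym (quad-mod n D u v)) (trans (cong (_% n) (trans e (distribute A a k b)))
      (trans (cong (λ z → (A * a + z) % n) (trans (cong (k *_) Ab≡) (sym (*-assoc k q n)))) ([m+kn]%n≡m%n (A * a) (k * q) n))))

  record Represented (D m b : ℕ) : Set where
    constructor represented
    field
      A B C : ℕ
      determinant : A * C ≡ B * B + D
      2B≤A : 2 * B ≤ A
      A≤C : A ≤ C
      u v : ℕ
      value : u * u + D * (v * v) ≡ A * m
      residue : (+ m ℤ.∣ + u ℤ.- + b ℤ.* + v) ⊎ (+ m ℤ.∣ + u ℤ.+ + b ℤ.* + v)
      common-divisor : ∀ d → d ∣ m → d ∣ v → d ∣ A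

  -- m (m x² + 2 b x y + c y²) = (m x + b y)² + D y², so a vector of value A gives u = |m x + b y|
  -- and v = |y| with u ≡ ± b v modulo m. A common divisor of m and y divides every term of the
  -- form, hence A.
  represent : ∀ D .{{_ : NonZero D}} m b c → m * c ≡ b * b + D → Represented D m b
  represent D m b c e with reduce (m + c) D m b c ≤-refl e
  ... | reducedValue A B C det p q x y val = represented A B C det p q ℤ.∣ U ∣ ℤ.∣ y ∣ value′ residue′ common
    where
    U = + m ℤ.* x ℤ.+ + b ℤ.* y
    eℤ : + m ℤ.* + c ≡ + b ℤ.* + b ℤ.+ + D
    eℤ = trans (sym (ℤ.pos-* m c)) (trans (cong +_ e) (trans (ℤ.pos-+ (b * b) D) (cong (ℤ._+ + D) (ℤ.pos-* b b))))
    alg : ∀ m b c D x y → (m ℤ.* x ℤ.+ b ℤ.* y) ℤ.* (m ℤ.* x ℤ.+ b ℤ.* y) ℤ.+ D ℤ.* (y ℤ.* y)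
      ≡ (m ℤ.* x ℤ.* x) ℤ.* m ℤ.+ (+ 2 ℤ.* (b ℤ.* (x ℤ.* y))) ℤ.* m ℤ.+ (b ℤ.* b ℤ.+ D) ℤ.* (y ℤ.* y)
    alg = ℤR.solve-∀
    alg₂ : ∀ m b c x y → (m ℤ.* x ℤ.* x) ℤ.* m ℤ.+ (+ 2 ℤ.* (b ℤ.* (x ℤ.* y))) ℤ.* m ℤ.+ (m ℤ.* c) ℤ.* (y ℤ.* y)
      ≡ (m ℤ.* (x ℤ.* x) ℤ.+ + 2 ℤ.* (b ℤ.* (x ℤ.* y)) ℤ.+ c ℤ.* (y ℤ.* y)) ℤ.* m
    alg₂ = ℤR.solve-∀
    norm : ∀ m b c D x y → m ℤ.* c ≡ b ℤ.* b ℤ.+ D → (m ℤ.* x ℤ.+ b ℤ.* y) ℤ.* (m ℤ.* x ℤ.+ b ℤ.* y) ℤ.+ D ℤ.* (y ℤ.* y)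
      ≡ (m ℤ.* (x ℤ.* x) ℤ.+ + 2 ℤ.* (b ℤ.* (x ℤ.* y)) ℤ.+ c ℤ.* (y ℤ.* y)) ℤ.* m
    norm m b c D x y e = trans (alg m b c D x y)
      (trans (cong (λ z → (m ℤ.* x ℤ.* x) ℤ.* m ℤ.+ (+ 2 ℤ.* (b ℤ.* (x ℤ.* y))) ℤ.* m ℤ.+ z ℤ.* (y ℤ.* y)) (sym e)) (alg₂ m b c x y))
    valueℤ : U ℤ.* U ℤ.+ + D ℤ.* (y ℤ.* y) ≡ + (A * m)
    valueℤ = begin
      U ℤ.* U ℤ.+ + D ℤ.* (y ℤ.* y) ≡⟨ norm (+ m) (+ b) (+ c) (+ D) x y eℤ ⟩
      form (+ m) (+ b) (+ c) x y ℤ.* + m ≡⟨ cong (ℤ._* + m) val ⟩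
      + A ℤ.* + m ≡⟨ ℤ.pos-* A m ⟨
      + (A * m) ∎
      where open ≡-Reasoning
    value′ : ℤ.∣ U ∣ * ℤ.∣ U ∣ + D * (ℤ.∣ y ∣ * ℤ.∣ y ∣) ≡ A * m
    value′ = ℤ.+-injective (trans (trans (ℤ.pos-+ _ (D * _))
      (cong₂ ℤ._+_ (abs-square U) (trans (ℤ.pos-* D _) (cong (+ D ℤ.*_) (abs-square y))))) valueℤ)
    residue′ : (+ m ℤ.∣ + ℤ.∣ U ∣ ℤ.- + b ℤ.* + ℤ.∣ y ∣) ⊎ (+ m ℤ.∣ + ℤ.∣ U ∣ ℤ.+ + b ℤ.* + ℤ.∣ y ∣)
    residue′ with ℤ.+∣i∣≡i⊎+∣i∣≡-i U | ℤ.+∣i∣≡i⊎+∣i∣≡-i y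
    ... | inj₁ eU | inj₁ ey = inj₁ (subst₂ (λ p q → + m ℤ.∣ p ℤ.- + b ℤ.* q) (sym eU) (sym ey) (ℤ.divides x (s (+ m) (+ b) x y)))
      where
      s : ∀ m b x y → (m ℤ.* x ℤ.+ b ℤ.* y) ℤ.- b ℤ.* y ≡ x ℤ.* m
      s = ℤR.solve-∀
    ... | inj₁ eU | inj₂ ey = inj₂ (subst₂ (λ p q → + m ℤ.∣ p ℤ.+ + b ℤ.* q) (sym eU) (sym ey) (ℤ.divides x (s (+ m) (+ b) x y)))
      where
      s : ∀ m b x y → (m ℤ.* x ℤ.+ b ℤ.* y) ℤ.+ b ℤ.* (ℤ.- y) ≡ x ℤ.* m
      s = ℤR.solve-∀
    ... | inj₂ eU | inj₁ ey = inj₂ (subst₂ (λ p q → + m ℤ.∣ p ℤ.+ + b ℤ.* q) (sym eU) (sym ey) (ℤ.divides (ℤ.- x) (s (+ m) (+ b) x y)))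
      where
      s : ∀ m b x y → ℤ.- (m ℤ.* x ℤ.+ b ℤ.* y) ℤ.+ b ℤ.* y ≡ (ℤ.- x) ℤ.* m
      s = ℤR.solve-∀
    ... | inj₂ eU | inj₂ ey = inj₁ (subst₂ (λ p q → + m ℤ.∣ p ℤ.- + b ℤ.* q) (sym eU) (sym ey) (ℤ.divides (ℤ.- x) (s (+ m) (+ b) x y)))
      where
      s : ∀ m b x y → ℤ.- (m ℤ.* x ℤ.+ b ℤ.* y) ℤ.- b ℤ.* (ℤ.- y) ≡ (ℤ.- x) ℤ.* m
      s = ℤR.solve-∀
    common : ∀ d → d ∣ m → d ∣ ℤ.∣ y ∣ → d ∣ A
    common d d∣m d∣y = ℤ.∣⇒∣ᵤ {+ d} {+ A} (subst (+ d ℤ.∣_) val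
      (ℤ.∣m∣n⇒∣m+n (ℤ.∣m∣n⇒∣m+n (ℤ.∣m⇒∣m*n _ dm) (ℤ.∣n⇒∣m*n (+ 2) (ℤ.∣n⇒∣m*n (+ b) (ℤ.∣n⇒∣m*n x dy))))
        (ℤ.∣n⇒∣m*n (+ c) (ℤ.∣m⇒∣m*n y dy))))
      where
      dm : + d ℤ.∣ + m
      dm = ℤ.∣ᵤ⇒∣ d∣m
      dy : + d ℤ.∣ y
      dy = ℤ.∣ᵤ⇒∣ d∣y

  reduced-bound : ∀ {D A B C} → A * C ≡ B * B + D → 2 * B ≤ A → A ≤ C → 3 * (A * A) ≤ 4 * D
  reduced-bound {D} {A} {B} {C} e p q = +-cancelˡ-≤ (A * A) _ _ (begin
    4 * (A * A) ≤⟨ *-monoʳ-≤ 4 (*-monoʳ-≤ A q) ⟩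
    4 * (A * C) ≡⟨ cong (4 *_) e ⟩
    4 * (B * B + D) ≡⟨ split B D ⟩
    2 * B * (2 * B) + 4 * D ≤⟨ +-monoˡ-≤ (4 * D) (*-mono-≤ p p) ⟩
    A * A + 4 * D ∎)
    where
    open ≤-Reasoning
    split : ∀ B D → 4 * (B * B + D) ≡ 2 * B * (2 * B) + 4 * D
    split = ℕR.solve-∀

  -- `C` is eliminated: it exists when A ∣ B² + D, and A ≤ C becomes A² ≤ B² + D. For D ≤ 57 the
  -- bound 9 follows from 3 A² ≤ 4 D.
  Minima : ℕ → List ℕ → Set
  Minima D As = ∀ {A} → A < 9 → ∀ {B} → B < 9 → A ∣ B * B + D → 2 * B ≤ A → A * A ≤ B * B + D → A ∈ As

  minima? : ∀ D As → Dec (Minima D As)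
  minima? D As = allUpTo? (λ A → allUpTo? (λ B →
    (A ∣? B * B + D) →-dec ((2 * B ≤? A) →-dec ((A * A ≤? B * B + D) →-dec (A ∈? As)))) 9) 9

  minimum : ∀ D As {_ : True (minima? D As)} {_ : True (D ≤? 57)} → ∀ {m b} (r : Represented D m b) → Represented.A r ∈ As
  minimum D As {w} {s} (represented A B C det 2B≤A A≤C _ _ _ _ _) =
    toWitness w A<9 (≤-<-trans (≤-trans (m≤m+n B (B + 0)) 2B≤A) A<9) (divides C (trans (sym det) (*-comm A C))) 2B≤A
      (≤-trans (*-monoʳ-≤ A A≤C) (≤-reflexive det))
    where
    A<9 : A < 9
    A<9 = ≰⇒> λ 9≤A → <⇒≱ {4 * 57} {3 * (9 * 9)} (toWitness {a? = 4 * 57 <? 3 * (9 * 9)} _)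
      (≤-trans (*-monoʳ-≤ 3 (*-mono-≤ 9≤A 9≤A)) (≤-trans (reduced-bound {D} {A} {B} {C} det 2B≤A A≤C) (*-monoʳ-≤ 4 (toWitness s))))

  -- The equations u² + disc · v² = scale · m.  For m ≡ 5 (mod 12), scale is the minimum of the reduced form of determinant
  -- disc that represents m (for disc = 19 the minimum may also be 1, and the solution is then doubled).
  data Family : Set where
    d9 d19 d57 : Family

  disc scale : Family → ℕ
  disc d9 = 9
  disc d19 = 19
  disc d57 = 57
  scale d9 = 2
  scale d19 = 4
  scale d57 = 2

  -- Coprimality is asked of m and v, not of u and v: v has to be invertible modulo m, while the
  -- doubled solutions for `d19` have u and v both even.
  record Primitive (δ : Family) (m u v : ℕ) : Set where
    constructor prim
    field
      norm : u * u + disc δ * (v * v) ≡ scale δ * m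
      coprime : Coprime m v
  open Primitive public

  SameRoot : ℕ → ℕ → ℕ → ℕ → Set
  SameRoot m b u v = (+ m ℤ.∣ + u ℤ.- + b ℤ.* + v) ⊎ (+ m ℤ.∣ + u ℤ.+ + b ℤ.* + v)

  odd-∣4 : ∀ {m d} k → m ≡ 5 + k * 12 → d ∣ m → d ∣ 4 → d ≡ 1
  odd-∣4 {d = d} k e d∣m d∣4 = ∣1⇒≡1 (∣m+n∣m⇒∣n (subst (d ∣_) (trans e (split k)) d∣m) (∣m⇒∣m*n (1 + k * 3) d∣4))
    where
    split : ∀ k → 5 + k * 12 ≡ 4 * (1 + k * 3) + 1
    split = ℕR.solve-∀

  private
    RepresentedPrimitively : Family → ℕ → ℕ → Set
    RepresentedPrimitively δ m b = ∃₂ λ u v → Primitive δ m u v × SameRoot m b u v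

    -- As m ≡ 2 (mod 3), the minima 1 and 3 are impossible modulo 3 and 9. A common divisor of m and
    -- v divides the remaining minimum 2, so it is 1, m being odd.
    from-d9 : ∀ {m b} k → m ≡ 5 + k * 12 → (r : Represented 9 m b) → Represented.A r ∈ 1 ∷ 2 ∷ 3 ∷ [] → RepresentedPrimitively d9 m b
    from-d9 k e r (here refl) = ⊥-elim (obstruction 3 9 1 5 12 (Represented.u r) (Represented.v r) k (Represented.value r) e)
    from-d9 k e r (there (here refl)) = _ , _ , prim (Represented.value r)
      (λ (p , q) → odd-∣4 k e p (∣-trans (Represented.common-divisor r _ p q) (divides 2 refl))) , Represented.residue r
    from-d9 k e r (there (there (here refl))) = ⊥-elim (obstruction 9 9 3 5 12 (Represented.u r) (Represented.v r) k (Represented.value r) e)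

    -- 1 and 3 are excluded as for determinant 9; 6 m ≡ 6 (mod 8) is not of the form u² + v² modulo
    -- 8.
    from-d57 : ∀ {m b} k → m ≡ 5 + k * 12 → (r : Represented 57 m b) → Represented.A r ∈ 1 ∷ 2 ∷ 3 ∷ 6 ∷ [] → RepresentedPrimitively d57 m b
    from-d57 k e r (here refl) = ⊥-elim (obstruction 3 57 1 5 12 (Represented.u r) (Represented.v r) k (Represented.value r) e)
    from-d57 k e r (there (here refl)) = _ , _ , prim (Represented.value r)
      (λ (p , q) → odd-∣4 k e p (∣-trans (Represented.common-divisor r _ p q) (divides 2 refl))) , Represented.residue r
    from-d57 k e r (there (there (here refl))) = ⊥-elim (obstruction 9 57 3 5 12 (Represented.u r) (Represented.v r) k (Represented.value r) e)
    from-d57 k e r (there (there (there (here refl)))) = ⊥-elim (obstruction 8 57 6 5 12 (Represented.u r) (Represented.v r) k (Represented.value r) e)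

    -- The minimum 2 fails modulo 8. Both 1 and 4 do occur, and doubling the solutions of u² + 19 v²
    -- = m puts the two classes into one equation.
    from-d19 : ∀ {m b} k → m ≡ 5 + k * 12 → (r : Represented 19 m b) → Represented.A r ∈ 1 ∷ 2 ∷ 4 ∷ [] → RepresentedPrimitively d19 m b
    from-d19 k e r (there (here refl)) = ⊥-elim (obstruction 8 19 2 5 12 (Represented.u r) (Represented.v r) k (Represented.value r) e)
    from-d19 {m} k e r (there (there (here refl))) = _ , _ , prim (Represented.value r)
      (λ (p , q) → odd-∣4 k e p (Represented.common-divisor r _ p q)) , Represented.residue r
    from-d19 {m} {b} k e r (here A≡1) = 2 * u , 2 * v , prim (trans (s u v) (cong (4 *_) (trans value (trans (cong (_* m) A≡1) (*-identityˡ m)))))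
           (λ { {d} (p , q) → coprime-step p q }) , Sum.map double₋ double₊ residue
      where
      open Represented r using (u; v; value; residue; common-divisor)
      s : ∀ u v → 2 * u * (2 * u) + 19 * (2 * v * (2 * v)) ≡ 4 * (u * u + 19 * (v * v))
      s = ℕR.solve-∀
      coprime-step : ∀ {d} → d ∣ m → d ∣ 2 * v → d ≡ 1
      coprime-step {d} p q = ∣1⇒≡1 (subst (d ∣_) A≡1 (common-divisor d p (coprime-divisor {n = 2}
        (λ (h∣d , h∣2) → odd-∣4 k e (∣-trans h∣d p) (∣-trans h∣2 (divides 2 refl))) q)))
      double₋ : + m ℤ.∣ + u ℤ.- + b ℤ.* + v → + m ℤ.∣ + (2 * u) ℤ.- + b ℤ.* + (2 * v)
      double₋ d = subst (+ m ℤ.∣_) (trans (t (+ u) (+ b) (+ v)) (cong₂ (λ x y → x ℤ.- + b ℤ.* y) (sym (ℤ.pos-* 2 u)) (sym (ℤ.pos-* 2 v)))) (ℤ.∣n⇒∣m*n (+ 2) d)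
        where
        t : ∀ u b v → + 2 ℤ.* (u ℤ.- b ℤ.* v) ≡ + 2 ℤ.* u ℤ.- b ℤ.* (+ 2 ℤ.* v)
        t = ℤR.solve-∀
      double₊ : + m ℤ.∣ + u ℤ.+ + b ℤ.* + v → + m ℤ.∣ + (2 * u) ℤ.+ + b ℤ.* + (2 * v)
      double₊ d = subst (+ m ℤ.∣_) (trans (t (+ u) (+ b) (+ v)) (cong₂ (λ x y → x ℤ.+ + b ℤ.* y) (sym (ℤ.pos-* 2 u)) (sym (ℤ.pos-* 2 v)))) (ℤ.∣n⇒∣m*n (+ 2) d)
        where
        t : ∀ u b v → + 2 ℤ.* (u ℤ.+ b ℤ.* v) ≡ + 2 ℤ.* u ℤ.+ b ℤ.* (+ 2 ℤ.* v)
        t = ℤR.solve-∀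

  -- The surjective half of the correspondence between primitive solutions and roots up to sign;
  -- `same-root⇒≡` is the injective half.
  represent-primitive : ∀ δ m k → m ≡ 5 + k * 12 → ∀ b c → m * c ≡ b * b + disc δ → RepresentedPrimitively δ m b
  represent-primitive d9 m k e b c r = from-d9 k e (represent 9 m b c r) (minimum 9 (1 ∷ 2 ∷ 3 ∷ []) (represent 9 m b c r))
  represent-primitive d19 m k e b c r = from-d19 k e (represent 19 m b c r) (minimum 19 (1 ∷ 2 ∷ 4 ∷ []) (represent 19 m b c r))
  represent-primitive d57 m k e b c r = from-d57 k e (represent 57 m b c r) (minimum 57 (1 ∷ 2 ∷ 3 ∷ 6 ∷ []) (represent 57 m b c r))

  -- Perfect matchings

  odd : ℕ → Bool
  odd zero = false
  odd (suc n) = not (odd n)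

  odd-2+ : ∀ n → odd (2 + n) ≡ odd n
  odd-2+ zero = refl
  odd-2+ (suc n) = cong not (odd-2+ n)

  length-insert : ∀ {A : Set} (xs : List A) y ys → length (xs ++ y ∷ ys) ≡ suc (length (xs ++ ys))
  length-insert [] y ys = refl
  length-insert (x ∷ xs) y ys = cong suc (length-insert xs y ys)

  ∈-insert⁺ : ∀ {A : Set} xs y {ys : List A} {z} → z ∈ xs ++ ys → z ∈ xs ++ y ∷ ys
  ∈-insert⁺ xs y z∈ with ∈-++⁻ xs z∈
  ... | inj₁ p = ∈-++⁺ˡ p
  ... | inj₂ p = ∈-++⁺ʳ xs (there p)

  ∈-insert⁻ : ∀ {A : Set} xs y {ys : List A} {z} → z ∈ xs ++ y ∷ ys → z ≡ y ⊎ z ∈ xs ++ ys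
  ∈-insert⁻ xs y z∈ with ∈-++⁻ xs z∈
  ... | inj₁ p = inj₂ (∈-++⁺ˡ p)
  ... | inj₂ (here e) = inj₁ e
  ... | inj₂ (there p) = inj₂ (∈-++⁺ʳ xs p)

  Unique-remove : ∀ {A : Set} (xs : List A) {y ys} → Unique (xs ++ y ∷ ys) → Unique (xs ++ ys) × ¬ (y ∈ xs ++ ys)
  Unique-remove [] (y∉ ∷ u) = u , λ y∈ → All.lookup y∉ y∈ refl
  Unique-remove (x ∷ xs) {y} (x∉ ∷ u) with Unique-remove xs u
  ... | u′ , y∉ = All.tabulate (λ z∈ → All.lookup x∉ (∈-insert⁺ xs y z∈)) ∷ u′ , λ
    { (here y≡x) → All.lookup x∉ (∈-++⁺ʳ xs (here refl)) (sym y≡x)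
    ; (there p) → y∉ p }

  -- A relation instead of an involution: partners come from existence proofs, and uniqueness is a
  -- separate argument.
  record IsMatching {A : Set} (R : A → A → Set) (xs : List A) : Set where
    field
      symmetric : ∀ {x y} → x ∈ xs → y ∈ xs → R x y → R y x
      irreflexive : ∀ {x} → x ∈ xs → ¬ R x x
      functional : ∀ {x y z} → x ∈ xs → y ∈ xs → z ∈ xs → R x y → R x z → y ≡ z
      total : ∀ {x} → x ∈ xs → ∃ λ y → y ∈ xs × R x y

  -- Remove the head and its partner. The rest is still matched: an element related to a removed one
  -- would, by functionality, be the other removed one.
  matching-even : ∀ {A : Set} {R : A → A → Set} xs → Unique xs → IsMatching R xs → odd (length xs) ≡ false
  matching-even xs = go (length xs) xs ≤-refl
    where
    go : ∀ {A : Set} {R : A → A → Set} n xs → length xs ≤ n → Unique xs → IsMatching R xs → odd (length xs) ≡ false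
    go n [] _ _ _ = refl
    go (suc n) (x ∷ xs) l (x∉ ∷ u) M with IsMatching.total M (here refl)
    ... | .x , here refl , r = ⊥-elim (IsMatching.irreflexive M (here refl) r)
    ... | y , there y∈ , r with ∈-∃++ y∈
    ... | ys , zs , refl = begin
      not (odd (length (ys ++ y ∷ zs))) ≡⟨ cong (λ k → not (odd k)) (length-insert ys y zs) ⟩
      odd (2 + length (ys ++ zs)) ≡⟨ odd-2+ (length (ys ++ zs)) ⟩
      odd (length (ys ++ zs)) ≡⟨ go n (ys ++ zs) (<⇒≤ (subst (_≤ n) (length-insert ys y zs) (≤-pred l))) u′ M′ ⟩
      false ∎
      where
      open ≡-Reasoning
      open IsMatching M
      u′ = proj₁ (Unique-remove ys u)
      y∉ = proj₂ (Unique-remove ys u)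
      inc : ∀ {z} → z ∈ ys ++ zs → z ∈ x ∷ ys ++ y ∷ zs
      inc z∈ = there (∈-insert⁺ ys y z∈)
      total′ : ∀ {z} → z ∈ ys ++ zs → ∃ λ w → w ∈ ys ++ zs × _
      total′ {z} z∈ with total (inc z∈)
      ... | w , here refl , s = ⊥-elim (y∉ (subst (_∈ ys ++ zs)
              (functional (here refl) (inc z∈) (there y∈) (symmetric (inc z∈) (here refl) s) r) z∈))
      ... | w , there w∈ , s with ∈-insert⁻ ys y w∈
      ... | inj₂ p = w , p , s
      ... | inj₁ refl = ⊥-elim (All.lookup x∉ (∈-insert⁺ ys y z∈)
              (functional (there y∈) (here refl) (inc z∈) (symmetric (here refl) (there y∈) r) (symmetric (inc z∈) (there y∈) s)))
      M′ : IsMatching _ (ys ++ zs)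
      M′ = record
        { symmetric = λ p q → symmetric (inc p) (inc q)
        ; irreflexive = λ p → irreflexive (inc p)
        ; functional = λ p q s → functional (inc p) (inc q) (inc s)
        ; total = total′ }

  -- Prime factors of numbers ≡ 5 (mod 12)

  module _ (n : ℕ) .{{_ : NonZero n}} where

    -- Carries a finite check over residues to all numbers; statements in one variable use a dummy
    -- second one.
    residue-table : ∀ {P : ℕ → ℕ → Set} → (∀ {r} → r < n → ∀ {s} → s < n → P r s) → ∀ a b → P (a % n) (b % n)
    residue-table t a b = t (m%n<n a n) (m%n<n b n)

  -- A product of residues 0 and 1 modulo 3 is never 2.
  prime-2mod3-factor : ∀ as → All Prime as → product as % 3 ≡ 2 → ∃ λ p → Prime p × p ∣ product as × p % 3 ≡ 2
  prime-2mod3-factor [] [] ()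
  prime-2mod3-factor (p ∷ as) (pr ∷ prs) e with p % 3 ≟ 2
  ... | yes p≡2 = p , pr , m∣m*n (product as) , p≡2
  ... | no p≢2 with prime-2mod3-factor as prs
      (residue-table 3 (toWitness {a? = allUpTo? (λ r → allUpTo? (λ s → (r * s % 3 ≟ 2) →-dec (¬? (r ≟ 2) →-dec (s ≟ 2))) 3) 3} _)
        p (product as) (trans (sym (%-distribˡ-* p (product as) 3)) e) p≢2)
  ... | q , qr , q∣ , q≡2 = q , qr , ∣n⇒∣m*n p q∣ , q≡2

  maximal-power : ∀ {p} → Prime p → ∀ m → .{{NonZero m}} → ∃₂ λ k n → m ≡ p ^ k * n × ¬ p ∣ n
  maximal-power {p} pr m = go m (<-wellFounded m)
    where
    go : ∀ m → .{{NonZero m}} → Acc _<_ m → ∃₂ λ k n → m ≡ p ^ k * n × ¬ p ∣ n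
    go m (acc rec) with p ∣? m
    ... | no p∤m = 0 , m , sym (*-identityˡ m) , p∤m
    ... | yes (divides q refl) with go q {{q≢0}} (rec (m<m*n q p {{q≢0}} (nonTrivial⇒n>1 p {{prime⇒nonTrivial pr}})))
      where
      q≢0 : NonZero q
      q≢0 = m*n≢0⇒m≢0 q
    ... | k , n , refl , p∤n = suc k , n , trans (*-comm (p ^ k * n) p) (sym (*-assoc p (p ^ k) n)) , p∤n

  -- The class modulo 12 keeps p away from 19 ≡ 7, the prime dividing two of the discriminants, and
  -- separates the two prime power cases.
  record Split (m : ℕ) : Set where
    field
      p k n : ℕ
      isPrime : Prime p
      p%12 : p % 12 ≡ 5 ⊎ p % 12 ≡ 11
      m≡ : m ≡ p ^ suc k * n
      p∤n : ¬ p ∣ n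

  -- Several primes may qualify; a function of m guarantees that both ends of a matched pair use the
  -- same one.
  split : ∀ m → m % 12 ≡ 5 → Split m
  split zero ()
  split m@(suc _) e with factorise m
  ... | record { factors = as ; isFactorisation = m≡ ; factorsPrime = prs }
    with prime-2mod3-factor as prs (trans (cong (_% 3) (sym m≡)) m%3)
    where
    m%3 : m % 3 ≡ 2
    m%3 = trans (sym (m∣n⇒o%n%m≡o%m 3 12 m (divides 4 refl))) (cong (_% 3) e)
  ... | p , pr , p∣ , p%3 with maximal-power pr m
  ... | zero , n , q , p∤n = ⊥-elim (p∤n (subst (p ∣_) (trans (sym m≡) (trans q (*-identityˡ n))) p∣))
  ... | suc k , n , q , p∤n = record { p = p ; k = k ; n = n ; isPrime = pr ; m≡ = q ; p∤n = p∤n ; p%12 = cls }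
    where
    p∣m : p ∣ m
    p∣m = subst (p ∣_) (sym m≡) p∣
    c = quotient p∣m
    cls : p % 12 ≡ 5 ⊎ p % 12 ≡ 11
    cls = residue-table 12 {P = λ r s → r * s % 12 ≡ 5 → r % 3 ≡ 2 → r ≡ 5 ⊎ r ≡ 11}
      (toWitness {a? = allUpTo? (λ r → allUpTo? (λ s → (r * s % 12 ≟ 5) →-dec ((r % 3 ≟ 2) →-dec ((r ≟ 5) ⊎-dec (r ≟ 11)))) 12) 12} _)
      p c (trans (sym (%-distribˡ-* p c 12)) (trans (cong (_% 12) (sym (m∣n⇒n≡m*quotient p∣m))) e)) (trans (m∣n⇒o%n%m≡o%m 3 12 p (divides 4 refl)) p%3)

module Congruences where

  open import Data.Nat as ℕ using (ℕ; zero; suc; NonZero; s≤s; z≤n)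
  import Data.Nat.Properties as ℕ
  import Data.Nat.DivMod as ℕ
  import Data.Nat.Divisibility as ℕ
  import Data.Nat.Tactic.RingSolver as ℕR
  open import Data.Nat.Coprimality as Coprimality using (Coprime; coprime-divisor; coprime-Bézout)
  open import Data.Nat.GCD using (module Bézout)
  open import Data.Nat.Primality
  open import Data.Integer hiding (NonZero; suc)
  open import Data.Integer.Properties
    using (+-injective; *-comm; *-zeroˡ; *-cancelˡ-≡; +-identityʳ; +∣i∣≡i⊎+∣i∣≡-i; abs-*; i-j≡0⇒i≡j; i≡j⇒i-j≡0;
           pos-+; pos-*; ∣-i∣≡∣i∣; ∣i-j∣≤∣i∣+∣j∣; ∣i∣≡0⇒i≡0)
  open import Data.Integer.DivMod using (_%ℕ_; _/ℕ_; n%ℕd<d; a≡a%ℕn+[a/ℕn]*n)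
  open import Data.Integer.Divisibility.Signed
  open import Data.Integer.Tactic.RingSolver using (solve-∀)
  open import Data.Bool using (true; false; not)
  open import Data.Fin as Fin using (Fin; zero; suc; toℕ; fromℕ<; remQuot; combine)
  import Data.Fin.Properties as Fin
  open import Data.List using ([]; _∷_; map; upTo; length)
  open import Data.List.Properties using (length-map; length-upTo)
  open import Data.List.Membership.Propositional using (_∈_)
  open import Data.List.Membership.Propositional.Properties using (∈-map⁺; ∈-map⁻; ∈-upTo⁺; ∈-upTo⁻)
  open import Data.List.Relation.Unary.Any using (here; there)
  import Data.List.Relation.Unary.Unique.Propositional.Properties as Unique
  open import Data.Empty
  open import Data.Product hiding (map)
  open import Data.Sum as Sum using (_⊎_; inj₁; inj₂)
  open import Data.Unit using (⊤; tt)
  open import Relation.Binary.Definitions using (tri<; tri≈; tri>)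
  open import Relation.Binary.PropositionalEquality
  open import Relation.Nullary using (¬_; Dec; yes; no)
  open import Relation.Nullary.Decidable using (from-yes)
  open QuadraticForms

  -- Squares modulo m

  -- Congruences are divisibilities of differences; most are derived from an explicit linear
  -- combination whose identity the ring solver checks.
  ∣-linear : ∀ {k x y} a b {z} → k ∣ x → k ∣ y → z ≡ a * x + b * y → k ∣ z
  ∣-linear a b p q refl = ∣m∣n⇒∣m+n (∣n⇒∣m*n a p) (∣n⇒∣m*n b q)

  ∣-multiple : ∀ {k x} a {z} → k ∣ x → z ≡ a * x → k ∣ z
  ∣-multiple a p refl = ∣n⇒∣m*n a p

  inverse-ℕ : ∀ {m n} → Coprime m n → ∃ λ n′ → + m ∣ + n * n′ - + 1
  inverse-ℕ {m} {n} c with coprime-Bézout c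
  ... | Bézout.+- x y q = - + y , divides (- + x) (alg (+ m) (+ n) (+ x) (+ y)
      (trans (cong (_+_ (+ 1)) (sym (pos-* y n))) (trans (cong +_ q) (pos-* x m))))
    where
    id : ∀ m a x y → a * - y - + 1 ≡ - x * m + (x * m - (+ 1 + y * a))
    id = solve-∀
    alg : ∀ m a x y → + 1 + y * a ≡ x * m → a * - y - + 1 ≡ - x * m
    alg m a x y q = trans (id m a x y) (trans (cong (_+_ (- x * m)) (i≡j⇒i-j≡0 (sym q))) (+-identityʳ _))
  ... | Bézout.-+ x y q = + y , divides (+ x) (alg (+ m) (+ n) (+ x) (+ y)
      (trans (cong (_+_ (+ 1)) (sym (pos-* x m))) (trans (cong +_ q) (pos-* y n))))
    where
    id : ∀ m a x y → a * y - + 1 ≡ x * m + (y * a - (+ 1 + x * m))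
    id = solve-∀
    alg : ∀ m a x y → + 1 + x * m ≡ y * a → a * y - + 1 ≡ x * m
    alg m a x y q = trans (id m a x y) (trans (cong (_+_ (x * m)) (i≡j⇒i-j≡0 (sym q))) (+-identityʳ _))

  inverse : ∀ {m} a → Coprime m ∣ a ∣ → ∃ λ a′ → + m ∣ a * a′ - + 1
  inverse {m} a c with inverse-ℕ {m} {∣ a ∣} c | +∣i∣≡i⊎+∣i∣≡-i a
  ... | n′ , d | inj₁ e = n′ , subst (λ z → + m ∣ z * n′ - + 1) e d
  ... | n′ , d | inj₂ e = - n′ , subst (+ m ∣_) (id a n′) (subst (λ z → + m ∣ z * n′ - + 1) e d)
    where
    id : ∀ a n → - a * n - + 1 ≡ a * - n - + 1
    id = solve-∀

  euclid : ∀ {p} → Prime p → ∀ x y → + p ∣ x * y → (+ p ∣ x) ⊎ (+ p ∣ y)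
  euclid {p} pr x y d = Sum.map ∣ᵤ⇒∣ ∣ᵤ⇒∣ (euclidsLemma ∣ x ∣ ∣ y ∣ pr (subst (p ℕ.∣_) (abs-* x y) (∣⇒∣ᵤ d)))

  prime∤⇒coprime : ∀ {p n} → Prime p → ¬ p ℕ.∣ n → Coprime p n
  prime∤⇒coprime pr p∤n (d∣p , d∣n) with prime⇒irreducible pr d∣p
  ... | inj₁ d≡1 = d≡1
  ... | inj₂ refl = ⊥-elim (p∤n d∣n)

  ∣-small : ∀ {m} i → + m ∣ i → ∣ i ∣ ℕ.< m → i ≡ + 0
  ∣-small {m} i d l with ∣ i ∣ in e
  ... | zero = ∣i∣≡0⇒i≡0 e
  ... | suc n = ⊥-elim (ℕ.<⇒≱ l (ℕ.∣⇒≤ (subst (m ℕ.∣_) e (∣⇒∣ᵤ d))))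

  residue-of : ∀ m .{{_ : NonZero m}} z → + m ∣ z - + (z %ℕ m)
  residue-of m z = divides (z /ℕ m) (alg z (+ (z %ℕ m)) (z /ℕ m * + m) (a≡a%ℕn+[a/ℕn]*n z m))
    where
    alg : ∀ z r q → z ≡ r + q → z - r ≡ q
    alg z r q refl = id r q
      where
      id : ∀ r q → r + q - r ≡ q
      id = solve-∀

  -- 0 counts as a square, so a nonsquare modulo a prime is a unit.
  Square : ℕ → ℤ → Set
  Square m a = ∃ λ b → + m ∣ b * b - a

  Square-* : ∀ {m} a b → Square m a → Square m b → Square m (a * b)
  Square-* {m} a b (x , p) (y , q) = x * y , ∣-linear (y * y) a p q (id a b x y)
    where
    id : ∀ a b x y → (x * y) * (x * y) - a * b ≡ y * y * (x * x - a) + a * (y * y - b)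
    id = solve-∀

  Square? : ∀ m .{{_ : NonZero m}} a → Dec (Square m a)
  Square? m a with ℕ.anyUpTo? (λ r → + m ∣? + r * + r - a) m
  ... | yes (r , _ , d) = yes (+ r , d)
  ... | no ¬r = no λ { (x , d) → ¬r (x %ℕ m , n%ℕd<d x m , ∣-linear (+ 1) (- (x + + (x %ℕ m))) d (residue-of m x) (id a x (+ (x %ℕ m)))) }
    where
    id : ∀ a x r → r * r - a ≡ + 1 * (x * x - a) + - (x + r) * (x - r)
    id = solve-∀

  module _ {p} (pr : Prime p) where

    inverse-prime : ∀ a → ¬ + p ∣ a → ∃ λ a′ → + p ∣ a * a′ - + 1
    inverse-prime a p∤a = inverse a (prime∤⇒coprime pr (λ d → p∤a (∣ᵤ⇒∣ d)))

    nonsquare⇒unit : ∀ {a} → ¬ Square p a → ¬ + p ∣ a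
    nonsquare⇒unit {a} ns d = ns (+ 0 , ∣-multiple (- + 1) d (id a))
      where
      id : ∀ a → + 0 * + 0 - a ≡ - + 1 * a
      id = solve-∀

    square-quotient : ∀ a x j → ¬ + p ∣ j → + p ∣ x * x - a * (j * j) → Square p a
    square-quotient a x j p∤j d with inverse-prime j p∤j
    ... | j′ , e = x * j′ , ∣-linear (j′ * j′) (a * (j * j′ + + 1)) d e (id a x j j′)
      where
      id : ∀ a x j j′ → (x * j′) * (x * j′) - a ≡ j′ * j′ * (x * x - a * (j * j)) + a * (j * j′ + + 1) * (j * j′ - + 1)
      id = solve-∀

  module _ {p h} (pr : Prime p) (p≡ : p ≡ ℕ.suc (h ℕ.+ h)) where

    private instance
      p≢0 : NonZero p
      p≢0 = prime⇒nonZero pr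

    half-unit : ∀ x → 1 ℕ.≤ x → x ℕ.≤ h → ¬ + p ∣ + x
    half-unit (suc x) _ x≤h d = 0≢ (∣-small (+ suc x) d (subst (suc x ℕ.<_) (sym p≡) (s≤s (ℕ.≤-trans x≤h (ℕ.m≤m+n h h)))))
      where
      0≢ : + suc x ≡ + 0 → ⊥
      0≢ ()

    half-+ : ∀ x y → 1 ℕ.≤ x → x ℕ.≤ h → y ℕ.≤ h → ¬ + p ∣ + x + + y
    half-+ (suc x) y _ x≤h y≤h d = 0≢ (∣-small (+ suc x + + y) d (subst (suc x ℕ.+ y ℕ.<_) (sym p≡) (s≤s (ℕ.+-mono-≤ x≤h y≤h))))
      where
      0≢ : + (suc x ℕ.+ y) ≡ + 0 → ⊥
      0≢ ()

    half-- : ∀ x y → x ℕ.≤ h → y ℕ.≤ h → + p ∣ + x - + y → x ≡ y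
    half-- x y x≤h y≤h d = +-injective (i-j≡0⇒i≡j (+ x) (+ y) (∣-small (+ x - + y) d
      (subst (∣ + x - + y ∣ ℕ.<_) (sym p≡) (s≤s (ℕ.≤-trans (∣i-j∣≤∣i∣+∣j∣ (+ x) (+ y)) (ℕ.+-mono-≤ x≤h y≤h))))))

    -- If a, b and ab were all nonsquares, the classes of i², a i² and b i² with 1 ≤ i ≤ h would be 3h > p distinct residues.
    nonsquare-* : 2 ℕ.≤ h → ∀ a b → ¬ Square p a → ¬ Square p b → Square p (a * b)
    nonsquare-* 2≤h a b ¬a ¬b = go (Fin.pigeonhole p<3h f)
      where
      c : Fin 3 → ℤ
      c zero = + 1
      c (suc zero) = a
      c (suc (suc zero)) = b
      unit : ∀ t → ¬ + p ∣ c t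
      unit zero d = ℕ.<⇒≢ (ℕ.nonTrivial⇒n>1 p {{prime⇒nonTrivial pr}}) (sym (ℕ.∣1⇒≡1 (∣⇒∣ᵤ d)))
      unit (suc zero) = nonsquare⇒unit pr ¬a
      unit (suc (suc zero)) = nonsquare⇒unit pr ¬b
      root : Fin h → ℕ
      root i = suc (toℕ i)
      value : Fin 3 × Fin h → ℤ
      value (t , i) = c t * (+ root i * + root i)
      f : Fin (3 ℕ.* h) → Fin p
      f k = fromℕ< (n%ℕd<d (value (remQuot h k)) p)
      p<3h : p ℕ.< 3 ℕ.* h
      p<3h = subst (ℕ._< 3 ℕ.* h) (sym p≡) (ℕ.≤-trans (ℕ.+-monoˡ-≤ (h ℕ.+ h) 2≤h) (ℕ.≤-reflexive (e h)))
        where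
        e : ∀ h → h ℕ.+ (h ℕ.+ h) ≡ 3 ℕ.* h
        e = ℕR.solve-∀
      -- Inside one class a collision contradicts i, i′ ≤ h; one with the class of 1 makes a or b a
      -- square. What survives is a i² ≡ b j², and then (a i / j)² ≡ a b.
      collide : ∀ t i t′ i′ → + p ∣ value (t , i) - value (t′ , i′) → (t , i) ≢ (t′ , i′) → Square p (a * b)
      collide t i t′ i′ d ne with t Fin.≟ t′
      ... | yes refl = ⊥-elim (ne (cong (t ,_) (same (euclid pr (c t) _ (subst (+ p ∣_) (id (c t) (+ root i) (+ root i′)) d)))))
        where
        id : ∀ c x y → c * (x * x) - c * (y * y) ≡ c * ((x + y) * (x - y))
        id = solve-∀
        same : (+ p ∣ c t) ⊎ (+ p ∣ (+ root i + + root i′) * (+ root i - + root i′)) → i ≡ i′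
        same (inj₁ d) = ⊥-elim (unit t d)
        same (inj₂ d) with euclid pr (+ root i + + root i′) (+ root i - + root i′) d
        ... | inj₁ d = ⊥-elim (half-+ (root i) (root i′) (s≤s z≤n) (Fin.toℕ<n i) (Fin.toℕ<n i′) d)
        ... | inj₂ d = Fin.toℕ-injective (ℕ.suc-injective (half-- (root i) (root i′) (Fin.toℕ<n i) (Fin.toℕ<n i′) d))
      ... | no t≢t′ = cross t t′ t≢t′ d
        where
        x = + root i
        y = + root i′
        x-unit : ¬ + p ∣ x
        x-unit = half-unit (root i) (s≤s z≤n) (Fin.toℕ<n i)
        y-unit : ¬ + p ∣ y
        y-unit = half-unit (root i′) (s≤s z≤n) (Fin.toℕ<n i′)
        id₁ : ∀ a x y → x * x - a * (y * y) ≡ + 1 * (+ 1 * (x * x) - a * (y * y))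
        id₁ = solve-∀
        id₂ : ∀ a x y → y * y - a * (x * x) ≡ - + 1 * (a * (x * x) - + 1 * (y * y))
        id₂ = solve-∀
        id₃ : ∀ a b x y → (a * x) * (a * x) - a * b * (y * y) ≡ a * (a * (x * x) - b * (y * y))
        id₃ = solve-∀
        id₄ : ∀ a b x y → (a * y) * (a * y) - a * b * (x * x) ≡ - a * (b * (x * x) - a * (y * y))
        id₄ = solve-∀
        cross : ∀ t t′ → t ≢ t′ → + p ∣ c t * (x * x) - c t′ * (y * y) → Square p (a * b)
        cross zero zero ne d = ⊥-elim (ne refl)
        cross (suc zero) (suc zero) ne d = ⊥-elim (ne refl)
        cross (suc (suc zero)) (suc (suc zero)) ne d = ⊥-elim (ne refl)
        cross zero (suc zero) _ d = ⊥-elim (¬a (square-quotient pr a x y y-unit (∣-multiple (+ 1) d (id₁ a x y))))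
        cross zero (suc (suc zero)) _ d = ⊥-elim (¬b (square-quotient pr b x y y-unit (∣-multiple (+ 1) d (id₁ b x y))))
        cross (suc zero) zero _ d = ⊥-elim (¬a (square-quotient pr a y x x-unit (∣-multiple (- + 1) d (id₂ a x y))))
        cross (suc (suc zero)) zero _ d = ⊥-elim (¬b (square-quotient pr b y x x-unit (∣-multiple (- + 1) d (id₂ b x y))))
        cross (suc zero) (suc (suc zero)) _ d = square-quotient pr (a * b) (a * x) y y-unit (∣-multiple a d (id₃ a b x y))
        cross (suc (suc zero)) (suc zero) _ d = square-quotient pr (a * b) (a * y) x x-unit (∣-multiple (- a) d (id₄ a b x y))
      go : (∃₂ λ k l → k Fin.< l × f k ≡ f l) → Square p (a * b)
      go (k , l , k<l , fk≡fl) = collide (proj₁ (remQuot h k)) (proj₂ (remQuot h k)) (proj₁ (remQuot h l)) (proj₂ (remQuot h l)) (∣-linear (+ 1) (- + 1) (residue-of p u) (residue-of p v) (id u v (+ (u %ℕ p)) (+ (v %ℕ p)) (cong +_ r)))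
        (λ e → ℕ.<⇒≢ k<l (cong toℕ (trans (sym (Fin.combine-remQuot {3} h k)) (trans (cong (uncurry combine) e) (Fin.combine-remQuot {3} h l)))))
        where
        u = value (remQuot h k)
        v = value (remQuot h l)
        r : u %ℕ p ≡ v %ℕ p
        r = trans (sym (Fin.toℕ-fromℕ< _)) (trans (cong toℕ fk≡fl) (Fin.toℕ-fromℕ< _))
        id : ∀ u v r s → r ≡ s → u - v ≡ + 1 * (u - r) + - + 1 * (v - s)
        id u v r .r refl = e u v r
          where
          e : ∀ u v r → u - v ≡ + 1 * (u - r) + - + 1 * (v - r)
          e = solve-∀

    half-residue : ∀ z → ∃ λ y → y ℕ.≤ h × ((+ p ∣ z - + y) ⊎ (+ p ∣ z + + y))
    half-residue z with (z %ℕ p) ℕ.≤? h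
    ... | yes r≤h = z %ℕ p , r≤h , inj₁ (residue-of p z)
    ... | no r≰h with ℕ.m≤n⇒∃[o]m+o≡n (ℕ.<⇒≤ (n%ℕd<d z p))
    ... | y , r+y≡p = y , y≤h , inj₂ (∣-linear (+ 1) (+ 1) (residue-of p z) ∣-refl (id z (+ (z %ℕ p)) (+ y) (+ p) (cong +_ (sym r+y≡p))))
      where
      y≤h : y ℕ.≤ h
      y≤h = ℕ.+-cancelˡ-≤ (suc h) y h (ℕ.≤-trans (ℕ.+-monoˡ-≤ y (ℕ.≰⇒> r≰h)) (ℕ.≤-reflexive (trans r+y≡p p≡)))
      id : ∀ z r y p → p ≡ r + y → z + y ≡ + 1 * (z - r) + + 1 * p
      id z r y .(r + y) refl = e z r y
        where
        e : ∀ z r y → z + y ≡ + 1 * (z - r) + + 1 * (r + y)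
        e = solve-∀

    -- Otherwise the relation x y ≡ ±1 is a perfect matching of {2, …, h}, a set of odd size.
    -1-square : ∀ k → h ≡ 2 ℕ.+ (k ℕ.+ k) → Square p (- + 1)
    -1-square k h≡ with Square? p (- + 1)
    ... | yes s = s
    ... | no ¬s = ⊥-elim (contra (trans (sym (odd-2k+1 k)) (trans (cong odd (sym len)) (matching-even xs unique matching))))
      where
      contra : true ≡ false → ⊥
      contra ()
      odd-2k+1 : ∀ k → odd (suc (k ℕ.+ k)) ≡ true
      odd-2k+1 zero = refl
      odd-2k+1 (suc k) = trans (cong (λ n → odd (suc (suc n))) (ℕ.+-suc k k)) (trans (odd-2+ (suc (k ℕ.+ k))) (odd-2k+1 k))
      xs = map (λ i → suc (suc i)) (upTo (suc (k ℕ.+ k)))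
      len : length xs ≡ suc (k ℕ.+ k)
      len = trans (length-map _ (upTo (suc (k ℕ.+ k)))) (length-upTo _)
      unique = Unique.map⁺ (λ e → ℕ.suc-injective (ℕ.suc-injective e)) (Unique.upTo⁺ (suc (k ℕ.+ k)))
      bounds : ∀ {x} → x ∈ xs → 2 ℕ.≤ x × x ℕ.≤ h
      bounds x∈ with ∈-map⁻ _ x∈
      ... | i , i∈ , refl = s≤s (s≤s z≤n) , subst (suc (suc i) ℕ.≤_) (sym h≡) (s≤s (∈-upTo⁻ i∈))
      member : ∀ x → 2 ℕ.≤ x → x ℕ.≤ h → x ∈ xs
      member (suc (suc i)) _ x≤h = ∈-map⁺ _ (∈-upTo⁺ (ℕ.≤-pred (subst (suc (suc i) ℕ.≤_) h≡ x≤h)))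
      member (suc zero) (s≤s ()) _
      _~_ : ℕ → ℕ → Set
      x ~ y = (+ p ∣ + x * + y - + 1) ⊎ (+ p ∣ + x * + y + + 1)
      ±-unique : ∀ y z → 2 ℕ.≤ y → y ℕ.≤ h → z ℕ.≤ h → (+ p ∣ + y - + z) ⊎ (+ p ∣ + y + + z) → y ≡ z
      ±-unique y z 2≤y y≤h z≤h (inj₁ d) = half-- y z y≤h z≤h d
      ±-unique y z 2≤y y≤h z≤h (inj₂ d) = ⊥-elim (half-+ y z (ℕ.<⇒≤ 2≤y) y≤h z≤h d)
      x≢±1 : ∀ x → 2 ℕ.≤ x → x ℕ.≤ h → ¬ ((+ p ∣ + x - + 1) ⊎ (+ p ∣ + x + + 1))
      x≢±1 x 2≤x x≤h d = ℕ.<⇒≢ 2≤x (sym (±-unique x 1 2≤x x≤h (ℕ.≤-trans (ℕ.<⇒≤ 2≤x) x≤h) d))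
      ~-functional : ∀ x y z → x ~ y → x ~ z → (+ p ∣ + y - + z) ⊎ (+ p ∣ + y + + z)
      ~-functional x y z (inj₁ d) (inj₁ e) = inj₁ (∣-linear (+ z) (- + y) d e (id (+ x) (+ y) (+ z)))
        where
        id : ∀ x y z → y - z ≡ z * (x * y - + 1) + - y * (x * z - + 1)
        id = solve-∀
      ~-functional x y z (inj₂ d) (inj₂ e) = inj₁ (∣-linear (- + z) (+ y) d e (id (+ x) (+ y) (+ z)))
        where
        id : ∀ x y z → y - z ≡ - z * (x * y + + 1) + y * (x * z + + 1)
        id = solve-∀
      ~-functional x y z (inj₁ d) (inj₂ e) = inj₂ (∣-linear (- + z) (+ y) d e (id (+ x) (+ y) (+ z)))
        where
        id : ∀ x y z → y + z ≡ - z * (x * y - + 1) + y * (x * z + + 1)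
        id = solve-∀
      ~-functional x y z (inj₂ d) (inj₁ e) = inj₂ (∣-linear (+ z) (- + y) d e (id (+ x) (+ y) (+ z)))
        where
        id : ∀ x y z → y + z ≡ z * (x * y + + 1) + - y * (x * z - + 1)
        id = solve-∀
      -- x² ≡ -1 is excluded by assumption, and x² ≡ 1 forces x ≡ ±1; this is why the matched set
      -- starts at 2.
      ~-irreflexive : ∀ x → 2 ℕ.≤ x → x ℕ.≤ h → ¬ x ~ x
      ~-irreflexive x 2≤x x≤h (inj₂ d) = ¬s (+ x , d)
      ~-irreflexive x 2≤x x≤h (inj₁ d) = x≢±1 x 2≤x x≤h (euclid pr (+ x - + 1) (+ x + + 1) (subst (+ p ∣_) (id (+ x)) d))
        where
        id : ∀ x → x * x - + 1 ≡ (x - + 1) * (x + + 1)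
        id = solve-∀
      partner : ∀ x x′ y → + p ∣ + x * x′ - + 1 → (+ p ∣ x′ - + y) ⊎ (+ p ∣ x′ + + y) → x ~ y
      partner x x′ y d (inj₁ e) = inj₁ (∣-linear (+ 1) (- + x) d e (id (+ x) x′ (+ y)))
        where
        id : ∀ x x′ y → x * y - + 1 ≡ + 1 * (x * x′ - + 1) + - x * (x′ - y)
        id = solve-∀
      partner x x′ y d (inj₂ e) = inj₂ (∣-linear (- + 1) (+ x) d e (id (+ x) x′ (+ y)))
        where
        id : ∀ x x′ y → x * y + + 1 ≡ - + 1 * (x * x′ - + 1) + x * (x′ + y)
        id = solve-∀
      partner≥2 : ∀ x y → 2 ℕ.≤ x → x ℕ.≤ h → x ~ y → 2 ℕ.≤ y
      partner≥2 x 0 2≤x x≤h r = ⊥-elim (half-unit 1 ℕ.≤-refl (ℕ.≤-trans (ℕ.<⇒≤ 2≤x) x≤h)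
        (Sum.[ (λ d → ∣-multiple (- + 1) d (id₁ (+ x))) , (λ d → ∣-multiple (+ 1) d (id₂ (+ x))) ] r))
        where
        id₁ : ∀ x → + 1 ≡ - + 1 * (x * + 0 - + 1)
        id₁ = solve-∀
        id₂ : ∀ x → + 1 ≡ + 1 * (x * + 0 + + 1)
        id₂ = solve-∀
      partner≥2 x 1 2≤x x≤h r = ⊥-elim (x≢±1 x 2≤x x≤h (Sum.map (subst (λ z → + p ∣ z - + 1) (id (+ x))) (subst (λ z → + p ∣ z + + 1) (id (+ x))) r))
        where
        id : ∀ x → x * + 1 ≡ x
        id = solve-∀
      partner≥2 x (suc (suc y)) _ _ _ = s≤s (s≤s z≤n)
      ~-total : ∀ x → 2 ℕ.≤ x → x ℕ.≤ h → ∃ λ y → y ∈ xs × x ~ y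
      ~-total x 2≤x x≤h with inverse-prime pr (+ x) (half-unit x (ℕ.<⇒≤ 2≤x) x≤h)
      ... | x′ , d with half-residue x′
      ... | y , y≤h , e = y , member y (partner≥2 x y 2≤x x≤h r) y≤h , r
        where r = partner x x′ y d e
      matching : IsMatching _~_ xs
      matching = record
        { symmetric = λ {x} {y} _ _ → Sum.map (subst (λ z → + p ∣ z - + 1) (*-comm (+ x) (+ y))) (subst (λ z → + p ∣ z + + 1) (*-comm (+ x) (+ y)))
        ; irreflexive = λ {x} x∈ → ~-irreflexive x (proj₁ (bounds x∈)) (proj₂ (bounds x∈))
        ; functional = λ {x} {y} {z} x∈ y∈ z∈ r s →
            ±-unique y z (proj₁ (bounds y∈)) (proj₂ (bounds y∈)) (proj₂ (bounds z∈)) (~-functional x y z r s)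
        ; total = λ {x} x∈ → ~-total x (proj₁ (bounds x∈)) (proj₂ (bounds x∈)) }

  square-root-ℕ : ∀ {m} D → Square m (- + D) → ∃₂ λ b c → m ℕ.* c ≡ b ℕ.* b ℕ.+ D
  square-root-ℕ {m} D (x , divides q e) = ∣ x ∣ , ∣ q ∣ , +-injective (trans (pos-* m ∣ q ∣) (trans (*-comm (+ m) (+ ∣ q ∣)) e′))
    where
    id : ∀ x D → x * x - - D ≡ x * x + D
    id = solve-∀
    posE : + (∣ x ∣ ℕ.* ∣ x ∣ ℕ.+ D) ≡ q * + m
    posE = trans (cong (_+ + D) (abs-square x)) (trans (sym (id x (+ D))) e)
    e′ : + ∣ q ∣ * + m ≡ + (∣ x ∣ ℕ.* ∣ x ∣ ℕ.+ D)
    e′ = trans (sym (pos-* ∣ q ∣ m)) (trans (cong +_ (sym (trans (cong ∣_∣ posE) (abs-* q (+ m))))) refl)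

  private
    from-1 : ∀ {m b} j → m ≡ 3 ℕ.+ j ℕ.* 4 → (r : Represented 1 m b) → Represented.A r ∈ 1 ∷ [] → ⊥
    from-1 j m≡ r (here refl) = obstruction 4 1 1 3 4 (Represented.u r) (Represented.v r) j (Represented.value r) m≡

    from-3 : ∀ {m b} j → m ≡ 5 ℕ.+ j ℕ.* 6 → (r : Represented 3 m b) → Represented.A r ∈ 1 ∷ 2 ∷ [] → ⊥
    from-3 j m≡ r (here refl) = obstruction 3 3 1 5 6 (Represented.u r) (Represented.v r) j (Represented.value r) m≡
    from-3 j m≡ r (there (here refl)) = obstruction 4 3 2 5 6 (Represented.u r) (Represented.v r) j (Represented.value r) m≡

    unrepresented-1 : ∀ m j → m ≡ 3 ℕ.+ j ℕ.* 4 → ∀ b c → m ℕ.* c ≡ b ℕ.* b ℕ.+ 1 → ⊥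
    unrepresented-1 m j m≡ b c e = from-1 j m≡ (represent 1 m b c e) (minimum 1 (1 ∷ []) (represent 1 m b c e))

    unrepresented-3 : ∀ m j → m ≡ 5 ℕ.+ j ℕ.* 6 → ∀ b c → m ℕ.* c ≡ b ℕ.* b ℕ.+ 3 → ⊥
    unrepresented-3 m j m≡ b c e = from-3 j m≡ (represent 3 m b c e) (minimum 3 (1 ∷ 2 ∷ []) (represent 3 m b c e))

  -- A root of -1 is a form of determinant 1, whose reduced minimum is 1; so u² + v² = m, impossible
  -- modulo 4.
  -1-nonsquare : ∀ {m} j → m ≡ 3 ℕ.+ j ℕ.* 4 → ¬ Square m (- + 1)
  -1-nonsquare {m} j m≡ s with square-root-ℕ 1 s
  ... | b , c , e = unrepresented-1 m j m≡ b c e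

  -- In determinant 3 the reduced minima are 1 and 2: u² + 3 v² = m fails modulo 3 and u² + 3 v² = 2
  -- m fails modulo 4.
  -3-nonsquare : ∀ {m} j → m ≡ 5 ℕ.+ j ℕ.* 6 → ¬ Square m (- + 3)
  -3-nonsquare {m} j m≡ s with square-root-ℕ 3 s
  ... | b , c , e = unrepresented-3 m j m≡ b c e

  -- Lifting to prime powers, and quadratic characters for p ≡ 5 and 11 modulo 12

  module _ {p} (pr : Prime p) (p∤2 : ¬ + p ∣ + 2) where

    -- Newton's step b - (b² - a) / (2 b): here b² - a = t P and c is an inverse of 2 b modulo p,
    -- which exists because b is a unit together with a.
    square-lift : ∀ {a} k → ¬ + p ∣ a → Square p a → Square (p ℕ.^ suc k) a
    square-lift {a} zero p∤a s = subst (λ m → Square m a) (sym (ℕ.*-identityʳ p)) s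
    square-lift {a} (suc k) p∤a s with square-lift k p∤a s
    ... | b , divides t e with inverse-prime pr (+ 2 * b) (λ d → Sum.[ p∤2 , p∤b ] (euclid pr (+ 2) b d))
      where
      id : ∀ b a t P Q → b * b - a ≡ t * (P * Q) → a ≡ b * b + - (t * Q) * P
      id b a t P Q e = trans (w b a) (trans (cong (λ z → b * b - z) e) (w′ b t P Q))
        where
        w : ∀ b a → a ≡ b * b - (b * b - a)
        w = solve-∀
        w′ : ∀ b t P Q → b * b - t * (P * Q) ≡ b * b + - (t * Q) * P
        w′ = solve-∀
      p∤b : ¬ + p ∣ b
      p∤b d = p∤a (∣-linear b (- (t * + (p ℕ.^ k))) d ∣-refl (id b a t (+ p) (+ (p ℕ.^ k)) (trans e (cong (t *_) (pos-* p (p ℕ.^ k))))))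
    ... | c , divides u f = b - t * c * P , divides (t * - u + t * t * c * c * + (p ℕ.^ k)) (trans
        (id a b t c (+ p) u (+ (p ℕ.^ k)) P (pos-* p (p ℕ.^ k)) e f)
        (cong ((t * - u + t * t * c * c * + (p ℕ.^ k)) *_) (sym (pos-* p (p ℕ.^ suc k)))))
      where
      P = + (p ℕ.^ suc k)
      id : ∀ a b t c p u Q P → P ≡ p * Q → b * b - a ≡ t * P → + 2 * b * c - + 1 ≡ u * p →
        (b - t * c * P) * (b - t * c * P) - a ≡ (t * - u + t * t * c * c * Q) * (p * P)
      id a b t c p u Q .(p * Q) refl e f = trans (w₁ a b t c (p * Q)) (trans (cong₂ (λ x y → x - t * (p * Q) * (y + + 1) + t * t * c * c * (p * Q) * (p * Q)) e f) (w₂ t c p u Q))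
        where
        w₁ : ∀ a b t c P → (b - t * c * P) * (b - t * c * P) - a ≡ (b * b - a) - t * P * ((+ 2 * b * c - + 1) + + 1) + t * t * c * c * P * P
        w₁ = solve-∀
        w₂ : ∀ t c p u Q → t * (p * Q) - t * (p * Q) * (u * p + + 1) + t * t * c * c * (p * Q) * (p * Q) ≡ (t * - u + t * t * c * c * Q) * (p * (p * Q))
        w₂ = solve-∀

  module Prime5mod12 {p} (pr : Prime p) j (p≡ : p ≡ 5 ℕ.+ j ℕ.* 12) (p∤19 : ¬ + p ∣ + 19) where

    private
      h = 2 ℕ.+ (j ℕ.* 3 ℕ.+ j ℕ.* 3)
      p≡2h+1 : p ≡ ℕ.suc (h ℕ.+ h)
      p≡2h+1 = trans p≡ (id j)
        where
        id : ∀ j → 5 ℕ.+ j ℕ.* 12 ≡ 1 ℕ.+ (2 ℕ.+ (j ℕ.* 3 ℕ.+ j ℕ.* 3) ℕ.+ (2 ℕ.+ (j ℕ.* 3 ℕ.+ j ℕ.* 3)))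
        id = ℕR.solve-∀

    square[-1] : Square p (- + 1)
    square[-1] = -1-square pr p≡2h+1 (j ℕ.* 3) refl

    -- -1 is a square here, so a root of 3 would give one of -3.
    nonsquare[3] : ¬ Square p (+ 3)
    nonsquare[3] s = -3-nonsquare (j ℕ.* 2) (trans p≡ (id j)) (Square-* (- + 1) (+ 3) square[-1] s)
      where
      id : ∀ j → 5 ℕ.+ j ℕ.* 12 ≡ 5 ℕ.+ j ℕ.* 2 ℕ.* 6
      id = ℕR.solve-∀

    square[-9] : Square p (- + 9)
    square[-9] = Square-* (- + 1) (+ 9) square[-1] (+ 3 , divides (+ 0) refl)

    square[-19]⊎square[-57] : Square p (- + 19) ⊎ Square p (- + 57)
    square[-19]⊎square[-57] with Square? p {{prime⇒nonZero pr}} (- + 19)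
    ... | yes s = inj₁ s
    ... | no ¬s = inj₂ (nonsquare-* pr p≡2h+1 (ℕ.m≤m+n 2 _) (+ 3) (- + 19) nonsquare[3] ¬s)

    -- (-19)(-57) = 3 · 19², and 19 is a unit modulo p.
    ¬square[-19]×square[-57] : Square p (- + 19) → Square p (- + 57) → ⊥
    ¬square[-19]×square[-57] s t with Square-* (- + 19) (- + 57) s t
    ... | x , d = nonsquare[3] (square-quotient pr (+ 3) x (+ 19) p∤19 d)

  module Prime11mod12 {p} (pr : Prime p) j (p≡ : p ≡ 11 ℕ.+ j ℕ.* 12) (p∤3 : ¬ + p ∣ + 3) where

    private
      h = 5 ℕ.+ j ℕ.* 6
      p≡2h+1 : p ≡ ℕ.suc (h ℕ.+ h)
      p≡2h+1 = trans p≡ (id j)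
        where
        id : ∀ j → 11 ℕ.+ j ℕ.* 12 ≡ 1 ℕ.+ (5 ℕ.+ j ℕ.* 6 ℕ.+ (5 ℕ.+ j ℕ.* 6))
        id = ℕR.solve-∀

    -- 3 = (-1)(-3) is a product of two nonsquares, as p ≡ 3 (mod 4) and p ≡ 5 (mod 6).
    square[3] : Square p (+ 3)
    square[3] = nonsquare-* pr p≡2h+1 (ℕ.m≤m+n 2 (3 ℕ.+ j ℕ.* 6)) (- + 1) (- + 3)
      (-1-nonsquare (2 ℕ.+ j ℕ.* 3) (trans p≡ (id₁ j))) (-3-nonsquare (1 ℕ.+ j ℕ.* 2) (trans p≡ (id₂ j)))
      where
      id₁ : ∀ j → 11 ℕ.+ j ℕ.* 12 ≡ 3 ℕ.+ (2 ℕ.+ j ℕ.* 3) ℕ.* 4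
      id₁ = ℕR.solve-∀
      id₂ : ∀ j → 11 ℕ.+ j ℕ.* 12 ≡ 5 ℕ.+ (1 ℕ.+ j ℕ.* 2) ℕ.* 6
      id₂ = ℕR.solve-∀

    square[-19]⇒square[-57] : Square p (- + 19) → Square p (- + 57)
    square[-19]⇒square[-57] s = Square-* (+ 3) (- + 19) square[3] s

    square[-57]⇒square[-19] : Square p (- + 57) → Square p (- + 19)
    square[-57]⇒square[-19] s = descend (Square-* (+ 3) (- + 57) square[3] s)
      where
      descend : Square p (+ 3 * - + 57) → Square p (- + 19)
      descend (x , d) = square-quotient pr (- + 19) x (+ 3) p∤3 d

  -- Primitive solutions and their roots

  coprime-cancel : ∀ {m v} y → Coprime m v → + m ∣ + v * y → + m ∣ y
  coprime-cancel {m} {v} y c d = ∣ᵤ⇒∣ (coprime-divisor c (subst (m ℕ.∣_) (abs-* (+ v) y) (∣⇒∣ᵤ d)))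

  coprime-*-∣ : ∀ {a b} z → Coprime a b → + a ∣ z → + b ∣ z → + (a ℕ.* b) ∣ z
  coprime-*-∣ {a} {b} z c d e = ∣ᵤ⇒∣ (go (∣⇒∣ᵤ d) (∣⇒∣ᵤ e))
    where
    go : ∀ {n} → a ℕ.∣ n → b ℕ.∣ n → a ℕ.* b ℕ.∣ n
    go a∣ (ℕ.divides q refl) = ℕ.*-monoˡ-∣ b (coprime-divisor c (subst (a ℕ.∣_) (ℕ.*-comm q b) a∣))

  norm-ℤ : ∀ {δ m u v} → Primitive δ m u v → + u * + u + + disc δ * (+ v * + v) ≡ + scale δ * + m
  norm-ℤ {δ} {m} {u} {v} (prim e _) = trans (sym (trans (pos-+ (u ℕ.* u) (disc δ ℕ.* (v ℕ.* v)))
    (cong₂ _+_ (pos-* u u) (trans (pos-* (disc δ) (v ℕ.* v)) (cong (+ disc δ *_) (pos-* v v))))))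
    (trans (cong +_ e) (pos-* (scale δ) m))

  -- The numerators of u/v ∓ u′/v′. Their divisibility expresses that two roots are equal or
  -- opposite without inverting v and v′.
  X₋ X₊ : ℕ → ℕ → ℕ → ℕ → ℤ
  X₋ u v u′ v′ = + u * + v′ - + u′ * + v
  X₊ u v u′ v′ = + u * + v′ + + u′ * + v

  private
    disc>scale² : ∀ δ → scale δ ℕ.* scale δ ℕ.< disc δ
    disc>scale² d9 = ℕ.m≤m+n 5 4
    disc>scale² d19 = ℕ.m≤m+n 17 2
    disc>scale² d57 = ℕ.m≤m+n 5 52

    small-norm : ∀ δ x y → y * y + + disc δ * (x * x) ≡ + scale δ * + scale δ → x ≡ + 0
    small-norm δ x y e = ∣0∣ ∣ x ∣ refl
      where
      eℕ : ∣ y ∣ ℕ.* ∣ y ∣ ℕ.+ disc δ ℕ.* (∣ x ∣ ℕ.* ∣ x ∣) ≡ scale δ ℕ.* scale δ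
      eℕ = +-injective (trans (pos-+ _ (disc δ ℕ.* (∣ x ∣ ℕ.* ∣ x ∣))) (trans (cong₂ _+_ (abs-square y)
        (trans (pos-* (disc δ) _) (cong (+ disc δ *_) (abs-square x)))) (trans e (sym (pos-* (scale δ) (scale δ))))))
      ∣0∣ : ∀ k → ∣ x ∣ ≡ k → x ≡ + 0
      ∣0∣ zero q = ∣i∣≡0⇒i≡0 q
      ∣0∣ (suc k) q = ⊥-elim (ℕ.<⇒≱ (disc>scale² δ) (begin
        disc δ ≤⟨ ℕ.m≤m*n (disc δ) (suc k ℕ.* suc k) ⟩
        disc δ ℕ.* (suc k ℕ.* suc k) ≡⟨ cong (λ k → disc δ ℕ.* (k ℕ.* k)) q ⟨
        disc δ ℕ.* (∣ x ∣ ℕ.* ∣ x ∣) ≤⟨ ℕ.m≤n+m _ (∣ y ∣ ℕ.* ∣ y ∣) ⟩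
        ∣ y ∣ ℕ.* ∣ y ∣ ℕ.+ disc δ ℕ.* (∣ x ∣ ℕ.* ∣ x ∣) ≡⟨ eℕ ⟩
        scale δ ℕ.* scale δ ∎))
        where open ℕ.≤-Reasoning

  module _ {δ : Family} {m : ℕ} .{{_ : NonZero m}} where

    -- Brahmagupta: Y² + D X² = (scale · m)², so m ∣ X, Y leaves y² + D x² = scale² < D.
    brahmagupta : ∀ X Y → Y * Y + + disc δ * (X * X) ≡ (+ scale δ * + m) * (+ scale δ * + m) → + m ∣ X → + m ∣ Y → X ≡ + 0
    brahmagupta X Y e (divides x refl) (divides y refl) = trans (cong (_* + m) (small-norm δ x y
      (*-cancelˡ-≡ (+ m) _ _ (*-cancelˡ-≡ (+ m) _ _ (trans (id₁ (+ m) x y (+ disc δ)) (trans e (id₂ (+ m) (+ scale δ)))))))) (*-zeroˡ (+ m))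
      where
      id₁ : ∀ m x y D → m * (m * (y * y + D * (x * x))) ≡ (y * m) * (y * m) + D * ((x * m) * (x * m))
      id₁ = solve-∀
      id₂ : ∀ m c → (c * m) * (c * m) ≡ m * (m * (c * c))
      id₂ = solve-∀

    private
      v≢0 : ∀ {u v} → m ≢ 1 → Primitive δ m u v → NonZero v
      v≢0 {v = zero} m≢1 (prim _ c) = ⊥-elim (m≢1 (c (ℕ.∣-refl , m ℕ.∣0)))
      v≢0 {v = suc _} _ _ = _

    -- By homogeneity, equal ratios and equal norms N give N v² = N v′². If v were 0, coprimality
    -- with m would force m = 1.
    proportional⇒≡ : ∀ {u v u′ v′} → m ≢ 1 → Primitive δ m u v → Primitive δ m u′ v′ → u ℕ.* v′ ≡ u′ ℕ.* v → u ≡ u′ × v ≡ v′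
    proportional⇒≡ {u} {v} {u′} {v′} m≢1 p p′ e = ℕ.*-cancelʳ-≡ u u′ v {{v≢0 m≢1 p}} (trans (cong (u ℕ.*_) v≡v′) e) , v≡v′
      where
      D = disc δ
      N = scale δ ℕ.* m
      instance
        N≢0 : NonZero N
        N≢0 = ℕ.m*n≢0 (scale δ) m {{scale≢0 δ}}
          where
          scale≢0 : ∀ δ → NonZero (scale δ)
          scale≢0 d9 = _
          scale≢0 d19 = _
          scale≢0 d57 = _
      id : ∀ u v D v′ → (u ℕ.* u ℕ.+ D ℕ.* (v ℕ.* v)) ℕ.* (v′ ℕ.* v′) ≡ (u ℕ.* v′) ℕ.* (u ℕ.* v′) ℕ.+ D ℕ.* (v ℕ.* v) ℕ.* (v′ ℕ.* v′)
      id = ℕR.solve-∀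
      comm : ∀ D v v′ → D ℕ.* (v ℕ.* v) ℕ.* (v′ ℕ.* v′) ≡ D ℕ.* (v′ ℕ.* v′) ℕ.* (v ℕ.* v)
      comm = ℕR.solve-∀
      squares : v ℕ.* v ≡ v′ ℕ.* v′
      squares = ℕ.*-cancelˡ-≡ _ _ N (begin
        N ℕ.* (v ℕ.* v) ≡⟨ cong (ℕ._* (v ℕ.* v)) (norm p′) ⟨
        (u′ ℕ.* u′ ℕ.+ D ℕ.* (v′ ℕ.* v′)) ℕ.* (v ℕ.* v) ≡⟨ id u′ v′ D v ⟩
        (u′ ℕ.* v) ℕ.* (u′ ℕ.* v) ℕ.+ D ℕ.* (v′ ℕ.* v′) ℕ.* (v ℕ.* v) ≡⟨ cong₂ (λ a b → a ℕ.* a ℕ.+ b) e (comm D v v′) ⟨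
        (u ℕ.* v′) ℕ.* (u ℕ.* v′) ℕ.+ D ℕ.* (v ℕ.* v) ℕ.* (v′ ℕ.* v′) ≡⟨ id u v D v′ ⟨
        (u ℕ.* u ℕ.+ D ℕ.* (v ℕ.* v)) ℕ.* (v′ ℕ.* v′) ≡⟨ cong (ℕ._* (v′ ℕ.* v′)) (norm p) ⟩
        N ℕ.* (v′ ℕ.* v′) ∎)
        where open ≡-Reasoning
      v≡v′ : v ≡ v′
      v≡v′ = square-injective v v′ squares
        where
        square-injective : ∀ a b → a ℕ.* a ≡ b ℕ.* b → a ≡ b
        square-injective a b e with ℕ.<-cmp a b
        ... | tri< a<b _ _ = ⊥-elim (ℕ.<⇒≢ (ℕ.*-mono-< a<b a<b) e)
        ... | tri≈ _ q _ = q
        ... | tri> _ _ b<a = ⊥-elim (ℕ.<⇒≢ (ℕ.*-mono-< b<a b<a) (sym e))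

    private
      -- v Y = v′ (scale · m) - u X, so m ∣ X carries over to Y = u u′ + D v v′ and `brahmagupta`
      -- applies. Integer arguments let opposite roots be treated by replacing u′ with -u′.
      root-collision : ∀ {v} u u′ v′ → Coprime m v → u * u + + disc δ * (+ v * + v) ≡ + scale δ * + m → u′ * u′ + + disc δ * (v′ * v′) ≡ + scale δ * + m →
        + m ∣ u * v′ - u′ * + v → u * v′ - u′ * + v ≡ + 0
      root-collision {v} u u′ v′ c e e′ d = brahmagupta (u * v′ - u′ * + v) Y (norm-product u (+ v) u′ v′ (+ disc δ) e e′) d
          (coprime-cancel Y c (∣-linear (v′ * + scale δ) (- u) ∣-refl d (root-multiple u (+ v) u′ v′ (+ disc δ) (+ scale δ) (+ m) e)))
        where
        Y = u * u′ + + disc δ * (+ v * v′)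
        norm-product : ∀ u v u′ v′ D {N N′} → u * u + D * (v * v) ≡ N → u′ * u′ + D * (v′ * v′) ≡ N′ →
          (u * u′ + D * (v * v′)) * (u * u′ + D * (v * v′)) + D * ((u * v′ - u′ * v) * (u * v′ - u′ * v)) ≡ N * N′
        norm-product u v u′ v′ D refl refl = id u v u′ v′ D
          where
          id : ∀ u v u′ v′ D →
            (u * u′ + D * (v * v′)) * (u * u′ + D * (v * v′)) + D * ((u * v′ - u′ * v) * (u * v′ - u′ * v)) ≡ (u * u + D * (v * v)) * (u′ * u′ + D * (v′ * v′))
          id = solve-∀
        root-multiple : ∀ u v u′ v′ D c m → u * u + D * (v * v) ≡ c * m → v * (u * u′ + D * (v * v′)) ≡ (v′ * c) * m + - u * (u * v′ - u′ * v)
        root-multiple u v u′ v′ D c m e = trans (id u v u′ v′ D) (trans (cong (λ z → v′ * z + - u * (u * v′ - u′ * v)) e) (cong (_+ - u * (u * v′ - u′ * v)) (id′ v′ c m)))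
          where
          id : ∀ u v u′ v′ D → v * (u * u′ + D * (v * v′)) ≡ v′ * (u * u + D * (v * v)) + - u * (u * v′ - u′ * v)
          id = solve-∀
          id′ : ∀ v c m → v * (c * m) ≡ (v * c) * m
          id′ = solve-∀

    same-root⇒≡ : ∀ {u v u′ v′} → m ≢ 1 → Primitive δ m u v → Primitive δ m u′ v′ →
      (+ m ∣ X₋ u v u′ v′) ⊎ (+ m ∣ X₊ u v u′ v′) → u ≡ u′ × v ≡ v′
    same-root⇒≡ {u} {v} {u′} {v′} m≢1 p p′ (inj₁ d) = proportional⇒≡ m≢1 p p′
      (+-injective (trans (pos-* u v′) (trans (i-j≡0⇒i≡j (+ u * + v′) (+ u′ * + v)
        (root-collision (+ u) (+ u′) (+ v′) (coprime p) (norm-ℤ p) (norm-ℤ p′) d)) (sym (pos-* u′ v)))))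
    -- Here the vanishing X is a sum of natural numbers, so u v′ = 0 = u′ v and the ratios agree
    -- again.
    same-root⇒≡ {u} {v} {u′} {v′} m≢1 p p′ (inj₂ d) = proportional⇒≡ m≢1 p p′
      (trans (ℕ.m+n≡0⇒m≡0 (u ℕ.* v′) X≡0) (sym (ℕ.m+n≡0⇒n≡0 (u ℕ.* v′) X≡0)))
      where
      minus-minus : ∀ u v u′ v′ → u * v′ - (- u′) * v ≡ u * v′ + u′ * v
      minus-minus = solve-∀
      minus-square : ∀ u z → - u * - u + z ≡ u * u + z
      minus-square = solve-∀
      X≡0 : u ℕ.* v′ ℕ.+ u′ ℕ.* v ≡ 0
      X≡0 = +-injective (trans (pos-+ (u ℕ.* v′) (u′ ℕ.* v)) (trans (cong₂ _+_ (pos-* u v′) (pos-* u′ v)) (trans (sym (minus-minus (+ u) (+ v) (+ u′) (+ v′)))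
        (root-collision (+ u) (- + u′) (+ v′) (coprime p) (norm-ℤ p) (trans (minus-square (+ u′) (+ disc δ * (+ v′ * + v′))) (norm-ℤ p′))
          (subst (+ m ∣_) (sym (minus-minus (+ u) (+ v) (+ u′) (+ v′))) d)))))

  prime[19] : Prime 19
  prime[19] = from-yes (prime? 19)

  5mod12 : ∀ {m} → m ℕ.% 12 ≡ 5 → m ≡ 5 ℕ.+ m ℕ./ 12 ℕ.* 12
  5mod12 {m} e = trans (ℕ.m≡m%n+[m/n]*n m 12) (cong (ℕ._+ m ℕ./ 12 ℕ.* 12) e)

  coprime-12 : ∀ {m} → m ℕ.% 12 ≡ 5 → Coprime m 12
  coprime-12 {m} e {d} (d∣m , d∣12) = ℕ.∣1⇒≡1 (ℕ.∣m+n∣m⇒∣n {m = 4} d∣5 (ℕ.∣m⇒∣m*n 2 d∣2))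
    where
    d∣5 : d ℕ.∣ 5
    d∣5 = ℕ.∣m+n∣m⇒∣n (subst (d ℕ.∣_) (trans (5mod12 e) (ℕ.+-comm 5 _)) d∣m) (ℕ.∣n⇒∣m*n (m ℕ./ 12) d∣12)
    d∣2 : d ℕ.∣ 2
    d∣2 = ℕ.∣m+n∣m⇒∣n {m = 10} d∣12 (ℕ.∣m⇒∣m*n 2 d∣5)

  coprime-∣ˡ : ∀ {d m n} → d ℕ.∣ m → Coprime m n → Coprime d n
  coprime-∣ˡ d∣m c (p , q) = c (ℕ.∣-trans p d∣m , q)

  coprime-∣ʳ : ∀ {d m n} → d ℕ.∣ n → Coprime m n → Coprime m d
  coprime-∣ʳ d∣n c (p , q) = c (p , ℕ.∣-trans q d∣n)

  ∣19⇒ : ∀ {d} → d ℕ.∣ 19 → d ≡ 1 ⊎ d ≡ 19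
  ∣19⇒ = prime⇒irreducible prime[19]

  ∣disc⇒ : ∀ δ {d} → Coprime d 12 → d ℕ.∣ disc δ → d ≡ 1 ⊎ d ≡ 19
  ∣disc⇒ d9 c d∣ = inj₁ (ℕ.∣1⇒≡1 (coprime-divisor c3 (coprime-divisor {n = 3} c3 d∣)))
    where c3 = coprime-∣ʳ (ℕ.divides 4 refl) c
  ∣disc⇒ d19 c d∣ = ∣19⇒ d∣
  ∣disc⇒ d57 c d∣ = ∣19⇒ (coprime-divisor {n = 3} (coprime-∣ʳ (ℕ.divides 4 refl) c) d∣)

  module _ {m} (m%12 : m ℕ.% 12 ≡ 5) where

    m≢1 : m ≢ 1
    m≢1 refl = contra m%12
      where
      contra : 1 ≡ 5 → ⊥
      contra ()

    m≢0 : NonZero m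
    m≢0 = ℕ.≢-nonZero λ { refl → contra m%12 }
      where
      contra : 0 ≡ 5 → ⊥
      contra ()

    ∣u⇒ : ∀ {δ u v d} → Primitive δ m u v → d ℕ.∣ m → d ℕ.∣ u → d ≡ 1 ⊎ d ≡ 19
    ∣u⇒ {δ} {u} {v} {d} p d∣m d∣u = ∣disc⇒ δ (coprime-∣ˡ d∣m (coprime-12 m%12))
      (coprime-divisor cv (subst (d ℕ.∣_) (ℕ.*-comm (disc δ) v) (coprime-divisor cv (subst (d ℕ.∣_) (id (disc δ) v)
        (ℕ.∣m+n∣m⇒∣n (subst (d ℕ.∣_) (sym (norm p)) (ℕ.∣n⇒∣m*n (scale δ) d∣m)) (ℕ.∣m⇒∣m*n u d∣u))))))
      where
      cv = coprime-∣ˡ d∣m (coprime p)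
      id : ∀ D v → D ℕ.* (v ℕ.* v) ≡ v ℕ.* (D ℕ.* v)
      id = ℕR.solve-∀

    -- A root can agree with its negative modulo d only if d divides such a product. This is the
    -- source of the exceptional factors 1 and 19.
    ∣2uv⇒ : ∀ {δ u v v′ d} → Primitive δ m u v → Coprime m v′ → d ℕ.∣ m → + d ∣ + 2 * (+ u * + v′) → d ≡ 1 ⊎ d ≡ 19
    ∣2uv⇒ {δ} {u} {v} {v′} {d} p c d∣m d∣ = ∣u⇒ p d∣m (coprime-divisor (coprime-∣ˡ d∣m c) (subst (d ℕ.∣_) (ℕ.*-comm u v′)
      (∣⇒∣ᵤ (subst (+ d ∣_) (sym (pos-* u v′)) (coprime-cancel {d} {2} (+ u * + v′) (coprime-∣ʳ (ℕ.divides 6 refl) (coprime-∣ˡ d∣m (coprime-12 m%12))) d∣)))))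

    represent-root : ∀ δ b → + m ∣ b * b + + disc δ → ∃₂ λ u v → Primitive δ m u v × ((+ m ∣ + u - b * + v) ⊎ (+ m ∣ + u + b * + v))
    represent-root δ b d = go (∣⇒∣ᵤ (subst (+ m ∣_) (sym e) d))
      where
      e : + (∣ b ∣ ℕ.* ∣ b ∣ ℕ.+ disc δ) ≡ b * b + + disc δ
      e = trans (pos-+ (∣ b ∣ ℕ.* ∣ b ∣) (disc δ)) (cong (_+ + disc δ) (abs-square b))
      flip : ∀ u v → (+ ∣ b ∣ ≡ b) ⊎ (+ ∣ b ∣ ≡ - b) → SameRoot m ∣ b ∣ u v → (+ m ∣ + u - b * + v) ⊎ (+ m ∣ + u + b * + v)
      flip u v (inj₁ q) = Sum.map (subst (λ z → + m ∣ + u - z * + v) q) (subst (λ z → + m ∣ + u + z * + v) q)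
      flip u v (inj₂ q) r = Sum.swap (Sum.map (λ d → subst (+ m ∣_) (id₁ (+ u) b (+ v)) (subst (λ z → + m ∣ + u - z * + v) q d))
                                              (λ d → subst (+ m ∣_) (id₂ (+ u) b (+ v)) (subst (λ z → + m ∣ + u + z * + v) q d)) r)
        where
        id₁ : ∀ u b v → u - - b * v ≡ u + b * v
        id₁ = solve-∀
        id₂ : ∀ u b v → u + - b * v ≡ u - b * v
        id₂ = solve-∀
      finish : (∃₂ λ u v → Primitive δ m u v × SameRoot m ∣ b ∣ u v) → ∃₂ λ u v → Primitive δ m u v × ((+ m ∣ + u - b * + v) ⊎ (+ m ∣ + u + b * + v))
      finish (u , v , p , r) = u , v , p , flip u v (+∣i∣≡i⊎+∣i∣≡-i b) r
      go : m ℕ.∣ ∣ b ∣ ℕ.* ∣ b ∣ ℕ.+ disc δ → _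
      go (ℕ.divides c q) = finish (represent-primitive δ m (m ℕ./ 12) (5mod12 m%12) ∣ b ∣ c (trans (ℕ.*-comm m c) (sym q)))

    primitive⇒square : ∀ {δ u v} → Primitive δ m u v → Square m (- + disc δ)
    primitive⇒square {δ} {u} {v} p = go (inverse-ℕ (coprime p))
      where
      id : ∀ u v w D c m → u * u + D * (v * v) ≡ c * m → (u * w) * (u * w) - - D ≡ (w * w * c) * m + - D * (v * w + + 1) * (v * w - + 1)
      id u v w D c m e = trans (id₁ u v w D) (trans (cong (λ z → w * w * z + - D * (v * w + + 1) * (v * w - + 1)) e)
        (cong (_+ - D * (v * w + + 1) * (v * w - + 1)) (id₂ w c m)))
        where
        id₁ : ∀ u v w D → (u * w) * (u * w) - - D ≡ w * w * (u * u + D * (v * v)) + - D * (v * w + + 1) * (v * w - + 1)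
        id₁ = solve-∀
        id₂ : ∀ w c m → w * w * (c * m) ≡ (w * w * c) * m
        id₂ = solve-∀
      go : (∃ λ w → + m ∣ + v * w - + 1) → Square m (- + disc δ)
      go (w , d) = + u * w , ∣-linear (w * w * + scale δ) (- + disc δ * (+ v * w + + 1)) ∣-refl d (id (+ u) (+ v) w (+ disc δ) (+ scale δ) (+ m) (norm-ℤ p))

    -- Pairing roots through a coprime factorisation m = P n

    module Composite {P n} (m≡ : m ≡ P ℕ.* n) (c : Coprime P n) where

      private
        P∣m : P ℕ.∣ m
        P∣m = subst (P ℕ.∣_) (sym m≡) (ℕ.m∣m*n n)
        n∣m : n ℕ.∣ m
        n∣m = subst (n ℕ.∣_) (sym m≡) (ℕ.n∣m*n P)
        P∣ : ∀ {z} → + m ∣ z → + P ∣ z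
        P∣ = ∣-trans (∣ᵤ⇒∣ P∣m)
        n∣ : ∀ {z} → + m ∣ z → + n ∣ z
        n∣ = ∣-trans (∣ᵤ⇒∣ n∣m)
        m∣ : ∀ z → + P ∣ z → + n ∣ z → + m ∣ z
        m∣ z p q = subst (λ m → + m ∣ z) (sym m≡) (coprime-*-∣ z c p q)

      -- (u′ , v′) belongs to the same root modulo P and to the opposite root modulo n, up to the sign of u′.
      Opposite : ℕ → ℕ → ℕ → ℕ → Set
      Opposite u v u′ v′ = ((+ P ∣ X₋ u v u′ v′) × (+ n ∣ X₊ u v u′ v′)) ⊎ ((+ P ∣ X₊ u v u′ v′) × (+ n ∣ X₋ u v u′ v′))

      opposite-sym : ∀ u v u′ v′ → Opposite u v u′ v′ → Opposite u′ v′ u v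
      opposite-sym u v u′ v′ = Sum.map (λ (a , b) → minus a , plus b) (λ (a , b) → plus a , minus b)
        where
        id₁ : ∀ u v u′ v′ → u′ * v - u * v′ ≡ - + 1 * (u * v′ - u′ * v)
        id₁ = solve-∀
        id₂ : ∀ u v u′ v′ → u′ * v + u * v′ ≡ + 1 * (u * v′ + u′ * v)
        id₂ = solve-∀
        minus : ∀ {k} → k ∣ X₋ u v u′ v′ → k ∣ X₋ u′ v′ u v
        minus d = ∣-multiple (- + 1) d (id₁ (+ u) (+ v) (+ u′) (+ v′))
        plus : ∀ {k} → k ∣ X₊ u v u′ v′ → k ∣ X₊ u′ v′ u v
        plus d = ∣-multiple (+ 1) d (id₂ (+ u) (+ v) (+ u′) (+ v′))

      opposite-irreflexive : ¬ (P ≡ 1 ⊎ P ≡ 19) → ¬ (n ≡ 1 ⊎ n ≡ 19) → ∀ {δ u v} → Primitive δ m u v → ¬ Opposite u v u v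
      opposite-irreflexive P≢ n≢ {δ} {u} {v} p = Sum.[ (λ (_ , d) → n≢ (∣2uv⇒ p (coprime p) n∣m (double d))) , (λ (d , _) → P≢ (∣2uv⇒ p (coprime p) P∣m (double d))) ]
        where
        id : ∀ u v → + 2 * (u * v) ≡ + 1 * (u * v + u * v)
        id = solve-∀
        double : ∀ {k} → k ∣ X₊ u v u v → k ∣ + 2 * (+ u * + v)
        double d = ∣-multiple (+ 1) d (id (+ u) (+ v))

      -- Eliminating (u, v) shows that the two partners have equal roots modulo both P and n, or
      -- opposite roots modulo both, according to whether the alternatives in `Opposite` agree. So
      -- they share a root up to sign modulo m.
      opposite-functional : ∀ {δ u v u′ v′ u″ v″} → Primitive δ m u v → Primitive δ m u′ v′ → Primitive δ m u″ v″ →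
        Opposite u v u′ v′ → Opposite u v u″ v″ → u′ ≡ u″ × v′ ≡ v″
      opposite-functional {δ} {u} {v} {u′} {v′} {u″} {v″} p p′ p″ r s = same-root⇒≡ {{m≢0}} m≢1 p′ p″ (go r s)
        where
        U = + u; V = + v; U′ = + u′; V′ = + v′; U″ = + u″; V″ = + v″
        id₁ : ∀ u v u′ v′ u″ v″ → v * (u′ * v″ - u″ * v′) ≡ - v″ * (u * v′ - u′ * v) + v′ * (u * v″ - u″ * v)
        id₁ = solve-∀
        id₂ : ∀ u v u′ v′ u″ v″ → v * (u′ * v″ - u″ * v′) ≡ v″ * (u * v′ + u′ * v) + - v′ * (u * v″ + u″ * v)
        id₂ = solve-∀
        id₃ : ∀ u v u′ v′ u″ v″ → v * (u′ * v″ + u″ * v′) ≡ - v″ * (u * v′ - u′ * v) + v′ * (u * v″ + u″ * v)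
        id₃ = solve-∀
        id₄ : ∀ u v u′ v′ u″ v″ → v * (u′ * v″ + u″ * v′) ≡ v″ * (u * v′ + u′ * v) + - v′ * (u * v″ - u″ * v)
        id₄ = solve-∀
        mm : ∀ {k} → k ∣ X₋ u v u′ v′ → k ∣ X₋ u v u″ v″ → k ∣ V * X₋ u′ v′ u″ v″
        mm d e = ∣-linear (- V″) V′ d e (id₁ U V U′ V′ U″ V″)
        pp : ∀ {k} → k ∣ X₊ u v u′ v′ → k ∣ X₊ u v u″ v″ → k ∣ V * X₋ u′ v′ u″ v″
        pp d e = ∣-linear V″ (- V′) d e (id₂ U V U′ V′ U″ V″)
        mp : ∀ {k} → k ∣ X₋ u v u′ v′ → k ∣ X₊ u v u″ v″ → k ∣ V * X₊ u′ v′ u″ v″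
        mp d e = ∣-linear (- V″) V′ d e (id₃ U V U′ V′ U″ V″)
        pm : ∀ {k} → k ∣ X₊ u v u′ v′ → k ∣ X₋ u v u″ v″ → k ∣ V * X₊ u′ v′ u″ v″
        pm d e = ∣-linear V″ (- V′) d e (id₄ U V U′ V′ U″ V″)
        cancel₋ = λ d e → coprime-cancel {m} {v} (X₋ u′ v′ u″ v″) (coprime p) (m∣ _ d e)
        cancel₊ = λ d e → coprime-cancel {m} {v} (X₊ u′ v′ u″ v″) (coprime p) (m∣ _ d e)
        go : Opposite u v u′ v′ → Opposite u v u″ v″ → (+ m ∣ X₋ u′ v′ u″ v″) ⊎ (+ m ∣ X₊ u′ v′ u″ v″)
        go (inj₁ (a , b)) (inj₁ (a′ , b′)) = inj₁ (cancel₋ (mm a a′) (pp b b′))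
        go (inj₂ (a , b)) (inj₂ (a′ , b′)) = inj₁ (cancel₋ (pp a a′) (mm b b′))
        go (inj₁ (a , b)) (inj₂ (a′ , b′)) = inj₂ (cancel₊ (mp a a′) (pm b b′))
        go (inj₂ (a , b)) (inj₁ (a′ , b′)) = inj₂ (cancel₊ (pm a a′) (mp b b′))

      opposite-total : ∀ {δ u v} → Primitive δ m u v → ∃₂ λ u′ v′ → Primitive δ m u′ v′ × Opposite u v u′ v′
      opposite-total {δ} {u} {v} p = go (inverse-ℕ (coprime p)) (inverse-ℕ {n} {P} (Coprimality.sym c))
        where
        U = + u
        V = + v
        go : (∃ λ w → + m ∣ V * w - + 1) → (∃ λ t → + n ∣ + P * t - + 1) → _
        go (w , dw) (t , dt) = finish (represent-root δ b m∣b²+D)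
          where
          -- As P t ≡ 1 modulo n, e is 1 modulo P and -1 modulo n. Hence e² ≡ 1 modulo m, and b,
          -- which is e times u/v, is again a root.
          e = + 1 - + 2 * (+ P * t)
          b = e * U * w
          id₁ : ∀ P t → (+ 1 - + 2 * (P * t)) - + 1 ≡ (- + 2 * t) * P
          id₁ = solve-∀
          P∣e-1 : + P ∣ e - + 1
          P∣e-1 = divides (- + 2 * t) (id₁ (+ P) t)
          id₂ : ∀ P t → (+ 1 - + 2 * (P * t)) + + 1 ≡ - + 2 * (P * t - + 1)
          id₂ = solve-∀
          n∣e+1 : + n ∣ e + + 1
          n∣e+1 = ∣-multiple (- + 2) dt (id₂ (+ P) t)
          m∣e²-1 : + m ∣ (e - + 1) * (e + + 1)
          m∣e²-1 = m∣ _ (∣m⇒∣m*n (e + + 1) P∣e-1) (∣n⇒∣m*n (e - + 1) n∣e+1)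
          id₃ : ∀ e u v w D → (e * u * w) * (e * u * w) + D ≡ + 1 * (w * w * (u * u + D * (v * v)) + - D * (v * w + + 1) * (v * w - + 1)) + u * u * w * w * ((e - + 1) * (e + + 1))
          id₃ = solve-∀
          m∣b²+D : + m ∣ b * b + + disc δ
          m∣b²+D = ∣-linear (+ 1) (U * U * w * w) (∣m∣n⇒∣m+n (∣n⇒∣m*n (w * w) (divides (+ scale δ) (norm-ℤ p)))
            (∣n⇒∣m*n (- + disc δ * (V * w + + 1)) dw)) m∣e²-1 (id₃ e U V w (+ disc δ))
          evw-1 : + P ∣ e * (V * w) - + 1
          evw-1 = ∣-linear e (+ 1) (P∣ dw) P∣e-1 (id e (V * w))
            where
            id : ∀ e z → e * z - + 1 ≡ e * (z - + 1) + + 1 * (e - + 1)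
            id = solve-∀
          evw+1 : + n ∣ e * (V * w) + + 1
          evw+1 = ∣-linear e (+ 1) (n∣ dw) n∣e+1 (id e (V * w))
            where
            id : ∀ e z → e * z + + 1 ≡ e * (z - + 1) + + 1 * (e + + 1)
            id = solve-∀
          module _ (u′ v′ : ℕ) where
            U′ = + u′
            V′ = + v′
            case₁ : + m ∣ U′ - b * V′ → Opposite u v u′ v′
            case₁ d = inj₁ (∣-linear (- V) (- U * V′) (P∣ d) evw-1 (i₁ U V U′ V′ e w) , ∣-linear V (U * V′) (n∣ d) evw+1 (i₂ U V U′ V′ e w))
              where
              i₁ : ∀ u v u′ v′ e w → u * v′ - u′ * v ≡ - v * (u′ - (e * u * w) * v′) + - u * v′ * (e * (v * w) - + 1)
              i₁ = solve-∀
              i₂ : ∀ u v u′ v′ e w → u * v′ + u′ * v ≡ v * (u′ - (e * u * w) * v′) + u * v′ * (e * (v * w) + + 1)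
              i₂ = solve-∀
            case₂ : + m ∣ U′ + b * V′ → Opposite u v u′ v′
            case₂ d = inj₂ (∣-linear V (- U * V′) (P∣ d) evw-1 (i₁ U V U′ V′ e w) , ∣-linear (- V) (U * V′) (n∣ d) evw+1 (i₂ U V U′ V′ e w))
              where
              i₁ : ∀ u v u′ v′ e w → u * v′ + u′ * v ≡ v * (u′ + (e * u * w) * v′) + - u * v′ * (e * (v * w) - + 1)
              i₁ = solve-∀
              i₂ : ∀ u v u′ v′ e w → u * v′ - u′ * v ≡ - v * (u′ + (e * u * w) * v′) + u * v′ * (e * (v * w) + + 1)
              i₂ = solve-∀
          finish : (∃₂ λ u′ v′ → Primitive δ m u′ v′ × ((+ m ∣ + u′ - b * + v′) ⊎ (+ m ∣ + u′ + b * + v′))) → _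
          finish (u′ , v′ , p′ , r) = u′ , v′ , p′ , Sum.[ case₁ u′ v′ , case₂ u′ v′ ] r

  -- Prime powers, possibly times 19

  coprime-* : ∀ {a b c} → Coprime a c → Coprime b c → Coprime (a ℕ.* b) c
  coprime-* ca cb (d∣ab , d∣c) = cb (coprime-divisor (λ (p , q) → ca (q , ℕ.∣-trans p d∣c)) d∣ab , d∣c)

  coprime-^ : ∀ {a c} k → Coprime a c → Coprime (a ℕ.^ k) c
  coprime-^ zero _ (p , _) = ℕ.∣1⇒≡1 p
  coprime-^ (suc k) c = coprime-* c (coprime-^ k c)

  power-residue : ∀ p r → (r ≡ 5 ⊎ r ≡ 11) → p ℕ.% 12 ≡ r → ∀ k → (p ℕ.^ k) ℕ.% 12 ≡ 1 ⊎ (p ℕ.^ k) ℕ.% 12 ≡ r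
  power-residue p r r≡ e zero = inj₁ refl
  power-residue p r r≡ e (suc k) with power-residue p r r≡ e k
  ... | inj₁ q = inj₂ (trans (ℕ.%-distribˡ-* p (p ℕ.^ k) 12) (trans (cong₂ (λ a b → a ℕ.* b ℕ.% 12) e q) (table r≡)))
    where
    table : ∀ {r} → (r ≡ 5 ⊎ r ≡ 11) → r ℕ.* 1 ℕ.% 12 ≡ r
    table (inj₁ refl) = refl
    table (inj₂ refl) = refl
  ... | inj₂ q = inj₁ (trans (ℕ.%-distribˡ-* p (p ℕ.^ k) 12) (trans (cong₂ (λ a b → a ℕ.* b ℕ.% 12) e q) (table r≡)))
    where
    table : ∀ {r} → (r ≡ 5 ⊎ r ≡ 11) → r ℕ.* r ℕ.% 12 ≡ 1
    table (inj₁ refl) = refl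
    table (inj₂ refl) = refl

  Square-∣ : ∀ {m d a} → d ℕ.∣ m → Square m a → Square d a
  Square-∣ d∣m (x , e) = x , ∣-trans (∣ᵤ⇒∣ d∣m) e

  -- -9 = -1 · 3², and -1 is a nonsquare modulo 19 = 3 + 4 · 4.
  no-d9 : ∀ {m u v} → m ℕ.% 12 ≡ 5 → 19 ℕ.∣ m → ¬ Primitive d9 m u v
  no-d9 {m} m%12 19∣m p = go (Square-∣ {a = - + 9} 19∣m (primitive⇒square m%12 p))
    where
    19∤3 : ¬ + 19 ∣ + 3
    19∤3 d = ℕ.<⇒≱ (ℕ.m≤m+n 4 15) (ℕ.∣⇒≤ (∣⇒∣ᵤ d))
    go : Square 19 (- + 9) → ⊥
    go (x , d) = -1-nonsquare 4 refl (square-quotient prime[19] (- + 1) x (+ 3) 19∤3 d)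

  19∣disc : Family → Set
  19∣disc d9 = ⊥
  19∣disc d19 = ⊤
  19∣disc d57 = ⊤

  19∣disc-quotient : ∀ δ → 19∣disc δ → ∃ λ q → disc δ ≡ q ℕ.* 19
  19∣disc-quotient d19 _ = 1 , refl
  19∣disc-quotient d57 _ = 3 , refl

  -- 19 divides disc and m, hence u: modulo 19 every solution has the root 0, which is its own
  -- negative.
  19∣X : ∀ {δ m u v u′ v′} → 19∣disc δ → 19 ℕ.∣ m → Primitive δ m u v → Primitive δ m u′ v′ →
    (+ 19 ∣ X₋ u v u′ v′) × (+ 19 ∣ X₊ u v u′ v′)
  19∣X {δ} {m} {u} {v} {u′} {v′} h 19∣m p p′ = ∣m∣n⇒∣m-n a b , ∣m∣n⇒∣m+n a b
    where
    19∣u : ∀ {u v} → Primitive δ m u v → + 19 ∣ + u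
    19∣u {u} {v} p = ∣ᵤ⇒∣ (Sum.[ (λ x → x) , (λ x → x) ] (euclidsLemma u u prime[19]
      (ℕ.∣m+n∣m⇒∣n (subst (19 ℕ.∣_) (trans (sym (norm p)) (ℕ.+-comm (u ℕ.* u) _)) (ℕ.∣n⇒∣m*n (scale δ) 19∣m))
        (ℕ.∣m⇒∣m*n (v ℕ.* v) (ℕ.divides (proj₁ (19∣disc-quotient δ h)) (proj₂ (19∣disc-quotient δ h)))))))
    a : + 19 ∣ + u * + v′
    a = ∣m⇒∣m*n (+ v′) (19∣u p)
    b : + 19 ∣ + u′ * + v
    b = ∣m⇒∣m*n (+ v) (19∣u p′)

  class⇒≢ : ∀ {p} → p ≡ 1 ⊎ p ≡ 19 → ¬ (p ℕ.% 12 ≡ 5 ⊎ p ℕ.% 12 ≡ 11)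
  class⇒≢ (inj₁ refl) (inj₁ ())
  class⇒≢ (inj₁ refl) (inj₂ ())
  class⇒≢ (inj₂ refl) (inj₁ ())
  class⇒≢ (inj₂ refl) (inj₂ ())

  module PrimePower {m p k n} (m%12 : m ℕ.% 12 ≡ 5) (pr : Prime p) (p%12 : p ℕ.% 12 ≡ 5 ⊎ p ℕ.% 12 ≡ 11)
                    (m≡ : m ≡ p ℕ.^ suc k ℕ.* n) (n≡ : n ≡ 1 ⊎ n ≡ 19) where

    P = p ℕ.^ suc k

    P∣m : P ℕ.∣ m
    P∣m = subst (P ℕ.∣_) (sym m≡) (ℕ.m∣m*n n)

    p∣P : p ℕ.∣ P
    p∣P = ℕ.m∣m*n (p ℕ.^ k)

    p∣m : p ℕ.∣ m
    p∣m = ℕ.∣-trans p∣P P∣m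

    p≢ : ¬ (p ≡ 1 ⊎ p ≡ 19)
    p≢ e = class⇒≢ e p%12

    p∤12 : ¬ p ℕ.∣ 12
    p∤12 d = p≢ (inj₁ (coprime-12 m%12 (p∣m , d)))

    p∤2 : ¬ + p ∣ + 2
    p∤2 d = p∤12 (ℕ.∣-trans (∣⇒∣ᵤ d) (ℕ.divides 6 refl))

    p∤3 : ¬ + p ∣ + 3
    p∤3 d = p∤12 (ℕ.∣-trans (∣⇒∣ᵤ d) (ℕ.divides 4 refl))

    p∤19 : ¬ + p ∣ + 19
    p∤19 d = p≢ (∣19⇒ (∣⇒∣ᵤ d))

    p∤disc : ∀ δ → ¬ + p ∣ - + disc δ
    p∤disc δ d = p≢ (∣disc⇒ δ (coprime-∣ˡ p∣m (coprime-12 m%12)) (subst (p ℕ.∣_) (∣-i∣≡∣i∣ (+ disc δ)) (∣⇒∣ᵤ d)))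

    coprime-P : ∀ {c} → ¬ p ℕ.∣ c → Coprime P c
    coprime-P p∤c = coprime-^ (suc k) (prime∤⇒coprime pr p∤c)

    coprime-P-19 : Coprime P 19
    coprime-P-19 = coprime-P (λ d → p∤19 (∣ᵤ⇒∣ d))

    -- A unit has at most two square roots modulo an odd prime power: X₋ X₊ is a multiple of P, and
    -- p cannot divide both factors because their sum is 2 u v′.
    P∣X : ∀ {δ u v u′ v′} → Primitive δ m u v → Primitive δ m u′ v′ → (+ P ∣ X₋ u v u′ v′) ⊎ (+ P ∣ X₊ u v u′ v′)
    P∣X {δ} {u} {v} {u′} {v′} q q′ = go (+ p ∣? X₋ u v u′ v′)
      where
      id : ∀ u v u′ v′ D c m → u * u + D * (v * v) ≡ c * m → u′ * u′ + D * (v′ * v′) ≡ c * m →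
        (u * v′ - u′ * v) * (u * v′ + u′ * v) ≡ (c * (v′ * v′ - v * v)) * m
      id u v u′ v′ D c m e f = trans (i₁ u v u′ v′ D) (trans (cong₂ (λ a b → v′ * v′ * a - v * v * b) e f) (i₂ v v′ c m))
        where
        i₁ : ∀ u v u′ v′ D → (u * v′ - u′ * v) * (u * v′ + u′ * v) ≡ v′ * v′ * (u * u + D * (v * v)) - v * v * (u′ * u′ + D * (v′ * v′))
        i₁ = solve-∀
        i₂ : ∀ v v′ c m → v′ * v′ * (c * m) - v * v * (c * m) ≡ (c * (v′ * v′ - v * v)) * m
        i₂ = solve-∀
      P∣XX : + P ∣ X₋ u v u′ v′ * X₊ u v u′ v′
      P∣XX = ∣-trans (∣ᵤ⇒∣ P∣m) (divides (+ scale δ * (+ v′ * + v′ - + v * + v)) (id (+ u) (+ v) (+ u′) (+ v′) (+ disc δ) (+ scale δ) (+ m) (norm-ℤ q) (norm-ℤ q′)))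
      cancel : ∀ x y → ¬ + p ∣ x → + P ∣ x * y → + P ∣ y
      cancel x y p∤x d = ∣ᵤ⇒∣ (coprime-divisor (coprime-P (λ e → p∤x (∣ᵤ⇒∣ e))) (subst (P ℕ.∣_) (abs-* x y) (∣⇒∣ᵤ d)))
      go : Dec (+ p ∣ X₋ u v u′ v′) → (+ P ∣ X₋ u v u′ v′) ⊎ (+ P ∣ X₊ u v u′ v′)
      go (no p∤) = inj₂ (cancel (X₋ u v u′ v′) (X₊ u v u′ v′) p∤ P∣XX)
      go (yes p∣X₋) = inj₁ (cancel (X₊ u v u′ v′) (X₋ u v u′ v′) p∤X₊
          (subst (+ P ∣_) (*-comm (X₋ u v u′ v′) (X₊ u v u′ v′)) P∣XX))
        where
        p∤X₊ : ¬ + p ∣ X₊ u v u′ v′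
        p∤X₊ d = p≢ (∣2uv⇒ m%12 q (coprime q′) p∣m (∣-linear (+ 1) (+ 1) p∣X₋ d (i (+ u) (+ v) (+ u′) (+ v′))))
          where
          i : ∀ u v u′ v′ → + 2 * (u * v′) ≡ + 1 * (u * v′ - u′ * v) + + 1 * (u * v′ + u′ * v)
          i = solve-∀

    at-most-one : ∀ {δ u v u′ v′} → Primitive δ m u v → Primitive δ m u′ v′ → u ≡ u′ × v ≡ v′
    at-most-one {δ} {u} {v} {u′} {v′} q q′ = same-root⇒≡ {{m≢0 m%12}} (m≢1 m%12) q q′ (go n≡ δ refl (P∣X q q′))
      where
      go : (n ≡ 1 ⊎ n ≡ 19) → ∀ ε → ε ≡ δ → (+ P ∣ X₋ u v u′ v′) ⊎ (+ P ∣ X₊ u v u′ v′) → (+ m ∣ X₋ u v u′ v′) ⊎ (+ m ∣ X₊ u v u′ v′)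
      19∣m : n ≡ 19 → 19 ℕ.∣ m
      19∣m refl = subst (19 ℕ.∣_) (sym m≡) (ℕ.n∣m*n P)
      with-19 : n ≡ 19 → 19∣disc δ → (+ P ∣ X₋ u v u′ v′) ⊎ (+ P ∣ X₊ u v u′ v′) → (+ m ∣ X₋ u v u′ v′) ⊎ (+ m ∣ X₊ u v u′ v′)
      with-19 refl h = Sum.map (λ d → subst (λ m → + m ∣ X₋ u v u′ v′) (sym m≡) (coprime-*-∣ _ coprime-P-19 d (proj₁ X)))
                               (λ d → subst (λ m → + m ∣ X₊ u v u′ v′) (sym m≡) (coprime-*-∣ _ coprime-P-19 d (proj₂ X)))
        where X = 19∣X {δ} {m} {u} {v} {u′} {v′} h (19∣m refl) q q′
      go (inj₁ refl) _ _ = Sum.map (subst (λ m → + m ∣ X₋ u v u′ v′) P≡m) (subst (λ m → + m ∣ X₊ u v u′ v′) P≡m)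
        where
        P≡m : P ≡ m
        P≡m = trans (sym (ℕ.*-identityʳ P)) (sym m≡)
      go (inj₂ e) d9 refl = λ _ → ⊥-elim (no-d9 m%12 (19∣m e) q)
      go (inj₂ e) d19 refl = with-19 e tt
      go (inj₂ e) d57 refl = with-19 e tt

    square-p : ∀ {δ u v} → Primitive δ m u v → Square p (- + disc δ)
    square-p {δ} q = Square-∣ {a = - + disc δ} p∣m (primitive⇒square m%12 q)

    -- The root modulo p is lifted to P and, when n = 19, glued with the root 0 modulo 19.
    realise : ∀ δ → (n ≡ 1) ⊎ (n ≡ 19) × 19∣disc δ → Square p (- + disc δ) → ∃₂ λ u v → Primitive δ m u v
    realise δ h s = finish (root h (square-lift pr p∤2 k (p∤disc δ) s))
      where
      finish : (∃ λ b → + m ∣ b * b + + disc δ) → ∃₂ λ u v → Primitive δ m u v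
      finish (b , d) = forget (represent-root m%12 δ b d)
        where
        forget : (∃₂ λ u v → Primitive δ m u v × ((+ m ∣ + u - b * + v) ⊎ (+ m ∣ + u + b * + v))) → ∃₂ λ u v → Primitive δ m u v
        forget (u , v , q , _) = u , v , q
      minus-neg : ∀ b D → b * b - - D ≡ b * b + D
      minus-neg = solve-∀
      root : (n ≡ 1) ⊎ (n ≡ 19) × 19∣disc δ → Square P (- + disc δ) → ∃ λ b → + m ∣ b * b + + disc δ
      root (inj₁ refl) (b , d) = b , subst₂ (λ m z → + m ∣ z) (trans (sym (ℕ.*-identityʳ P)) (sym m≡)) (minus-neg b (+ disc δ)) d
      root (inj₂ (refl , h)) (b , d) = crt (inverse-ℕ {P} {19} coprime-P-19) (19∣disc-quotient δ h)
        where
        crt : (∃ λ t → + P ∣ + 19 * t - + 1) → (∃ λ q → disc δ ≡ q ℕ.* 19) → ∃ λ b → + m ∣ b * b + + disc δ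
        crt (t , e) (q , D≡) = b′ , subst (λ m → + m ∣ b′ * b′ + + disc δ) (sym m≡) (coprime-*-∣ (b′ * b′ + + disc δ) coprime-P-19
            (∣-linear (+ 1) (b * b * (+ 19 * t + + 1)) d e (i₁ b t (+ disc δ)))
            (divides (b * b * + 19 * t * t + + q) (i₂ b t (+ disc δ) (+ q) (trans (cong +_ D≡) (pos-* q 19)))))
          where
          -- 19 t is 1 modulo P and 0 modulo 19.
          b′ = b * (+ 19 * t)
          i₁ : ∀ b t D → b * (+ 19 * t) * (b * (+ 19 * t)) + D ≡ + 1 * (b * b - - D) + b * b * (+ 19 * t + + 1) * (+ 19 * t - + 1)
          i₁ = solve-∀
          i₂ : ∀ b t D q → D ≡ q * + 19 → b * (+ 19 * t) * (b * (+ 19 * t)) + D ≡ (b * b * + 19 * t * t + q) * + 19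
          i₂ b t D q refl = i b t q
            where
            i : ∀ b t q → b * (+ 19 * t) * (b * (+ 19 * t)) + q * + 19 ≡ (b * b * + 19 * t * t + q) * + 19
            i = solve-∀

    private
      1≢5 : 1 ≢ 5
      1≢5 ()
      11≢5 : 11 ≢ 5
      11≢5 ()
      7≢5 : 7 ≢ 5
      7≢5 ()

      -- P = m ≡ 5 (mod 12), whereas powers of a p ≡ 11 are 1 or 11.
      n≡1⇒ : n ≡ 1 → p ℕ.% 12 ≡ 5
      n≡1⇒ refl = Sum.[ (λ e → e) , (λ e → ⊥-elim (bad (power-residue p 11 (inj₂ refl) e (suc k)))) ] p%12
        where
        P%12 : P ℕ.% 12 ≡ 5
        P%12 = trans (cong (ℕ._% 12) (trans (sym (ℕ.*-identityʳ P)) (sym m≡))) m%12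
        bad : ¬ (P ℕ.% 12 ≡ 1 ⊎ P ℕ.% 12 ≡ 11)
        bad (inj₁ e) = 1≢5 (trans (sym e) P%12)
        bad (inj₂ e) = 11≢5 (trans (sym e) P%12)

      -- 7 P ≡ 5 (mod 12) means P ≡ 11, whereas powers of a p ≡ 5 are 1 or 5.
      n≡19⇒ : n ≡ 19 → p ℕ.% 12 ≡ 11
      n≡19⇒ refl = Sum.[ (λ e → ⊥-elim (bad (power-residue p 5 (inj₁ refl) e (suc k)))) , (λ e → e) ] p%12
        where
        19P%12 : (P ℕ.% 12) ℕ.* 7 ℕ.% 12 ≡ 5
        19P%12 = trans (sym (ℕ.%-distribˡ-* P 19 12)) (trans (cong (ℕ._% 12) (sym m≡)) m%12)
        bad : ¬ (P ℕ.% 12 ≡ 1 ⊎ P ℕ.% 12 ≡ 5)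
        bad (inj₁ e) = 7≢5 (trans (cong (λ r → r ℕ.* 7 ℕ.% 12) (sym e)) 19P%12)
        bad (inj₂ e) = 11≢5 (trans (cong (λ r → r ℕ.* 7 ℕ.% 12) (sym e)) 19P%12)

      p≡5 : n ≡ 1 → p ≡ 5 ℕ.+ p ℕ./ 12 ℕ.* 12
      p≡5 e = trans (ℕ.m≡m%n+[m/n]*n p 12) (cong (ℕ._+ p ℕ./ 12 ℕ.* 12) (n≡1⇒ e))

      p≡11 : n ≡ 19 → p ≡ 11 ℕ.+ p ℕ./ 12 ℕ.* 12
      p≡11 e = trans (ℕ.m≡m%n+[m/n]*n p 12) (cong (ℕ._+ p ℕ./ 12 ℕ.* 12) (n≡19⇒ e))

      19∣m : n ≡ 19 → 19 ℕ.∣ m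
      19∣m refl = subst (19 ℕ.∣_) (sym m≡) (ℕ.n∣m*n P)

    other-family : ∀ {δ u v} → Primitive δ m u v → ∃ λ δ′ → δ ≢ δ′ × ∃₂ λ u′ v′ → Primitive δ′ m u′ v′
    other-family {δ} q = go n≡ δ q
      where
      go : (n ≡ 1 ⊎ n ≡ 19) → ∀ δ {u v} → Primitive δ m u v → ∃ λ δ′ → δ ≢ δ′ × ∃₂ λ u′ v′ → Primitive δ′ m u′ v′
      go (inj₁ e) d9 q = Sum.[ (λ s → d19 , (λ ()) , realise d19 (inj₁ e) s) , (λ s → d57 , (λ ()) , realise d57 (inj₁ e) s) ]
        (Prime5mod12.square[-19]⊎square[-57] pr (p ℕ./ 12) (p≡5 e) p∤19)
      go (inj₁ e) d19 q = d9 , (λ ()) , realise d9 (inj₁ e) (Prime5mod12.square[-9] pr (p ℕ./ 12) (p≡5 e) p∤19)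
      go (inj₁ e) d57 q = d9 , (λ ()) , realise d9 (inj₁ e) (Prime5mod12.square[-9] pr (p ℕ./ 12) (p≡5 e) p∤19)
      go (inj₂ e) d9 q = ⊥-elim (no-d9 m%12 (19∣m e) q)
      go (inj₂ e) d19 q = d57 , (λ ()) , realise d57 (inj₂ (e , tt)) (Prime11mod12.square[-19]⇒square[-57] pr (p ℕ./ 12) (p≡11 e) p∤3 (square-p q))
      go (inj₂ e) d57 q = d19 , (λ ()) , realise d19 (inj₂ (e , tt)) (Prime11mod12.square[-57]⇒square[-19] pr (p ℕ./ 12) (p≡11 e) p∤3 (square-p q))

    not-all-families : ∀ {u v u′ v′ u″ v″} → Primitive d9 m u v → Primitive d19 m u′ v′ → Primitive d57 m u″ v″ → ⊥
    not-all-families q q′ q″ = go n≡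
      where
      go : (n ≡ 1 ⊎ n ≡ 19) → ⊥
      go (inj₁ e) = Prime5mod12.¬square[-19]×square[-57] pr (p ℕ./ 12) (p≡5 e) p∤19 (square-p q′) (square-p q″)
      go (inj₂ e) = no-d9 m%12 (19∣m e) q

    -- Two different partners would make all three equations solvable at once.
    other-family-unique : ∀ {δ δ′ δ″ u v u′ v′ u″ v″} → Primitive δ m u v → Primitive δ′ m u′ v′ → Primitive δ″ m u″ v″ →
      δ ≢ δ′ → δ ≢ δ″ → δ′ ≡ δ″
    other-family-unique {d9} {d9} _ _ _ ne _ = ⊥-elim (ne refl)
    other-family-unique {d19} {d19} _ _ _ ne _ = ⊥-elim (ne refl)
    other-family-unique {d57} {d57} _ _ _ ne _ = ⊥-elim (ne refl)
    other-family-unique {d9} {_} {d9} _ _ _ _ ne = ⊥-elim (ne refl)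
    other-family-unique {d19} {_} {d19} _ _ _ _ ne = ⊥-elim (ne refl)
    other-family-unique {d57} {_} {d57} _ _ _ _ ne = ⊥-elim (ne refl)
    other-family-unique {d9} {d19} {d19} _ _ _ _ _ = refl
    other-family-unique {d9} {d57} {d57} _ _ _ _ _ = refl
    other-family-unique {d19} {d9} {d9} _ _ _ _ _ = refl
    other-family-unique {d19} {d57} {d57} _ _ _ _ _ = refl
    other-family-unique {d57} {d9} {d9} _ _ _ _ _ = refl
    other-family-unique {d57} {d19} {d19} _ _ _ _ _ = refl
    other-family-unique {d9} {d19} {d57} a b c _ _ = ⊥-elim (not-all-families a b c)
    other-family-unique {d9} {d57} {d19} a b c _ _ = ⊥-elim (not-all-families a c b)
    other-family-unique {d19} {d9} {d57} a b c _ _ = ⊥-elim (not-all-families b a c)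
    other-family-unique {d19} {d57} {d9} a b c _ _ = ⊥-elim (not-all-families c a b)
    other-family-unique {d57} {d9} {d19} a b c _ _ = ⊥-elim (not-all-families b c a)
    other-family-unique {d57} {d19} {d9} a b c _ _ = ⊥-elim (not-all-families c b a)

open import Defs
open import Algebra.Bundles using (CommutativeRing)
open import Data.Bool using (Bool; true; false; _xor_; _∧_; not; if_then_else_; T)
open import Data.Bool.Properties
  using (xor-assoc; xor-comm; xor-same; xor-identityʳ; xor-∧-commutativeRing;
         ∧-assoc; ∧-comm; ∧-idem; ∧-zeroʳ; ∧-distribˡ-xor; ∧-distribʳ-xor)
open import Algebra.Properties.CommutativeSemigroup (CommutativeRing.+-commutativeSemigroup xor-∧-commutativeRing)
  using () renaming (interchange to xor-interchange)
open import Data.Nat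
open import Data.Nat.Properties
open import Data.Nat.DivMod
open import Data.Nat.Divisibility
open import Data.Nat.GCD
open import Data.Nat.Coprimality as Coprimality using (Coprime; coprime-divisor)
open import Data.Nat.ListAction using (product)
open import Data.Nat.Primality
open import Data.Nat.Primality.Factorisation
open import Data.Nat.Tactic.RingSolver using (solve-∀)
open import Data.Integer using (ℤ; -[1+_]; +_) renaming (_+_ to _+ℤ_; _*_ to _*ℤ_; _-_ to _-ℤ_; -_ to -ℤ_)
open import Data.Integer.Divisibility using () renaming (_∣_ to _∣ℤ_)
import Data.Integer.Divisibility.Signed as Signed
import Data.Integer.Properties as ℤ
import Data.Integer.Tactic.RingSolver as ℤR
open import Data.List using (List; []; _∷_; length; filter; map; concatMap; replicate; _++_; upTo; applyUpTo; cartesianProduct)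
open import Data.List.Properties using (filter-++; length-++)
open import Data.List.Membership.Propositional using (_∈_)
open import Data.List.Membership.Propositional.Properties using (∈-cartesianProduct⁺; ∈-upTo⁺; ∈-filter⁺; ∈-filter⁻)
open import Data.List.Relation.Unary.All using (All; []; _∷_; all?)
import Data.List.Relation.Unary.All.Properties as All
open import Data.List.Relation.Unary.AllPairs using ([]; _∷_)
open import Data.List.Relation.Unary.Any using (here; there)
open import Data.List.Relation.Unary.Unique.Propositional using (Unique)
import Data.List.Relation.Unary.Unique.Propositional.Properties as Unique
open import Data.Empty
open import Data.Product using (_,_; proj₁; proj₂; _×_; ∃; ∃₂)
open import Data.Sum as Sum using (_⊎_; inj₁; inj₂)
open import Function using (_∘_)
open import Relation.Binary.PropositionalEquality
open import Relation.Nullary using (¬_; Dec; yes; no; ¬?; does)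
open import Relation.Nullary.Decidable using (toWitness; dec-true; dec-false; _→-dec_; _×-dec_; _⊎-dec_)
open import Relation.Unary using (Decidable)
open QuadraticForms
open Congruences hiding (inverse)

-- The matching of the solutions

n≤n² : ∀ n → n ≤ n * n
n≤n² zero = z≤n
n≤n² (suc n) = m≤m*n (suc n) (suc n)

Point : Set
Point = Family × ℕ × ℕ

OnNorm : ℕ → Point → Set
OnNorm M (δ , u , v) = u * u + disc δ * (v * v) ≡ scale δ * M

PrimitivePoint : ℕ → Point → Set
PrimitivePoint m (δ , u , v) = Primitive δ m u v

module _ {m} (m%12 : m % 12 ≡ 5) (s : Split m) where

  open Split s renaming (isPrime to pr)

  private
    P = p ^ suc k

    p≢ : ¬ (p ≡ 1 ⊎ p ≡ 19)
    p≢ e = class⇒≢ e p%12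

    P≢ : ¬ (P ≡ 1 ⊎ P ≡ 19)
    P≢ (inj₁ e) = p≢ (inj₁ (∣1⇒≡1 (subst (p ∣_) e (m∣m*n (p ^ k)))))
    P≢ (inj₂ e) = p≢ (∣19⇒ (subst (p ∣_) e (m∣m*n (p ^ k))))

    P⊥n : Coprime P n
    P⊥n = coprime-^ (suc k) (prime∤⇒coprime pr p∤n)

    module C = Composite m%12 m≡ P⊥n
    module PP = PrimePower {k = k} m%12 pr p%12 m≡

  -- For n = 1 or 19 solutions of different equations are paired, otherwise solutions of the same
  -- one. The decision is an argument so that proofs can split on it.
  PartnerBy : Dec (n ≡ 1 ⊎ n ≡ 19) → Point → Point → Set
  PartnerBy (yes _) (δ , _) (δ′ , _) = δ ≢ δ′
  PartnerBy (no _) (δ , u , v) (δ′ , u′ , v′) = δ ≡ δ′ × C.Opposite u v u′ v′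

  Partner : Point → Point → Set
  Partner = PartnerBy ((n ≟ 1) ⊎-dec (n ≟ 19))

  partner-sym : ∀ x y → Partner x y → Partner y x
  partner-sym x y = go ((n ≟ 1) ⊎-dec (n ≟ 19)) x y
    where
    go : ∀ d x y → PartnerBy d x y → PartnerBy d y x
    go (yes _) _ _ ne e = ne (sym e)
    go (no _) (_ , u , v) (_ , u′ , v′) (e , o) = sym e , C.opposite-sym u v u′ v′ o

  partner-irreflexive : ∀ x → PrimitivePoint m x → ¬ Partner x x
  partner-irreflexive x q = go ((n ≟ 1) ⊎-dec (n ≟ 19))
    where
    go : ∀ d → ¬ PartnerBy d x x
    go (yes _) ne = ne refl
    go (no n≢) (_ , o) = C.opposite-irreflexive P≢ n≢ q o

  partner-functional : ∀ x y z → PrimitivePoint m x → PrimitivePoint m y → PrimitivePoint m z → Partner x y → Partner x z → y ≡ z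
  partner-functional x@(δ , u , v) y@(δ′ , u′ , v′) z@(δ″ , u″ , v″) qx qy qz = go ((n ≟ 1) ⊎-dec (n ≟ 19))
    where
    pack : ∀ {δ : Family} {u u′ v v′ : ℕ} → u ≡ u′ × v ≡ v′ → (δ , u , v) ≡ (δ , u′ , v′)
    pack (refl , refl) = refl
    go : ∀ d → PartnerBy d x y → PartnerBy d x z → y ≡ z
    go (yes n≡) ne ne′ = same (PP.other-family-unique n≡ qx qy qz ne ne′) qz
      where
      same : ∀ {δ″} → δ′ ≡ δ″ → Primitive δ″ m u″ v″ → y ≡ (δ″ , u″ , v″)
      same refl qz = pack (PP.at-most-one n≡ qy qz)
    go (no _) (refl , o) (refl , o′) = pack (C.opposite-functional qx qy qz o o′)

  partner-total : ∀ x → PrimitivePoint m x → ∃ λ y → PrimitivePoint m y × Partner x y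
  partner-total x@(δ , u , v) q = go ((n ≟ 1) ⊎-dec (n ≟ 19))
    where
    go : ∀ d → ∃ λ y → PrimitivePoint m y × PartnerBy d x y
    go (yes n≡) = pack (PP.other-family n≡ q)
      where
      pack : (∃ λ δ′ → δ ≢ δ′ × ∃₂ λ u′ v′ → Primitive δ′ m u′ v′) → ∃ λ y → PrimitivePoint m y × (δ ≢ proj₁ y)
      pack (δ′ , ne , u′ , v′ , q′) = (δ′ , u′ , v′) , q′ , ne
    go (no n≢) = pack (C.opposite-total q)
      where
      pack : (∃₂ λ u′ v′ → Primitive δ m u′ v′ × C.Opposite u v u′ v′) → ∃ λ y → PrimitivePoint m y × PartnerBy (no n≢) x y
      pack (u′ , v′ , q′ , o) = (δ , u′ , v′) , q′ , refl , o

-- Reduction to primitive solutions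

record Scaled (g m : ℕ) (x : Point) : Set where
  constructor scaled
  field
    y : Point
    x≡ : x ≡ (proj₁ y , g * proj₁ (proj₂ y) , g * proj₂ (proj₂ y))
    isPrimitive : PrimitivePoint m y
open Scaled

prime-factor : ∀ d → .{{NonZero d}} → d ≢ 1 → ∃ λ q → Prime q × q ∣ d
prime-factor d d≢1 with factorise d
... | record { factors = [] ; isFactorisation = e } = ⊥-elim (d≢1 e)
... | record { factors = q ∷ qs ; isFactorisation = e ; factorsPrime = pr ∷ _ } = q , pr , subst (q ∣_) (sym e) (m∣m*n (product qs))

module _ {M} (M%12 : M % 12 ≡ 5) where

  private
    instance
      M≢0 : NonZero M
      M≢0 = m≢0 M%12

    -- g is prime to 12, so g² ≡ 1 (mod 12).
    square-cofactor : ∀ g m → M ≡ g * g * m → m % 12 ≡ 5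
    square-cofactor g m e = residue-table 12 {P = λ r s → ((r * r % 12) * s) % 12 ≡ 5 → s ≡ 5}
      (toWitness {a? = allUpTo? (λ r → allUpTo? (λ s → (((r * r % 12) * s) % 12 ≟ 5) →-dec (s ≟ 5)) 12) 12} _)
      g m (trans (sym (trans (%-distribˡ-* (g * g) m 12) (cong (λ z → z * (m % 12) % 12) (%-distribˡ-* g g 12)))) (trans (cong (_% 12) (sym e)) M%12))

    scale-∣12 : ∀ δ → scale δ ∣ 12
    scale-∣12 d9 = divides 6 refl
    scale-∣12 d19 = divides 3 refl
    scale-∣12 d57 = divides 6 refl

  -- The scale is determined by x, so a point is matched at one level only. M enters the gcd to
  -- discard a common factor 2 of u and v, which primitivity permits.
  scaled-g : ∀ {g m x} → M ≡ g * g * m → Scaled g m x → g ≡ gcd (gcd (proj₁ (proj₂ x)) (proj₂ (proj₂ x))) M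
  scaled-g {g} {m} M≡ (scaled (δ , u , v) refl q) = sym (begin
    gcd (gcd (g * u) (g * v)) M ≡⟨ cong₂ gcd (sym (c*gcd[m,n]≡gcd[cm,cn] g u v)) (trans M≡ (*-assoc g g m)) ⟩
    gcd (g * gcd u v) (g * (g * m)) ≡⟨ c*gcd[m,n]≡gcd[cm,cn] g (gcd u v) (g * m) ⟨
    g * gcd (gcd u v) (g * m) ≡⟨ cong (g *_) (Coprimality.coprime⇒gcd≡1 coprime-gm) ⟩
    g * 1 ≡⟨ *-identityʳ g ⟩
    g ∎)
    where
    open ≡-Reasoning
    coprime-gm : Coprime (gcd u v) (g * m)
    coprime-gm {h} (h∣uv , h∣gm) = coprime-12 M%12 (h∣M , ∣-trans h∣scale (scale-∣12 δ))
      where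
      h∣u : h ∣ u
      h∣u = ∣-trans h∣uv (gcd[m,n]∣m u v)
      h∣v : h ∣ v
      h∣v = ∣-trans h∣uv (gcd[m,n]∣n u v)
      h⊥m : Coprime h m
      h⊥m (a , b) = coprime q (b , ∣-trans a h∣v)
      h∣g : h ∣ g
      h∣g = coprime-divisor h⊥m (subst (h ∣_) (*-comm g m) h∣gm)
      h∣M : h ∣ M
      h∣M = subst (h ∣_) (sym (trans M≡ (*-assoc g g m))) (∣m⇒∣m*n (g * m) h∣g)
      h∣scale : h ∣ scale δ
      h∣scale = coprime-divisor h⊥m (subst (h ∣_) (trans (norm q) (*-comm (scale δ) m))
        (∣m∣n⇒∣m+n (∣m⇒∣m*n u h∣u) (∣n⇒∣m*n (disc δ) (∣m⇒∣m*n v h∣v))))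

  -- With g = gcd(u, v, M), a prime q dividing both m and v / g divides u / g by the norm equation,
  -- so g q would divide u, v and M. That g² ∣ M holds because g is prime to the scale.
  decompose : ∀ x → OnNorm M x → ∃₂ λ g m → M ≡ g * g * m × Scaled g m x
  decompose (δ , u , v) e = go (gcd[m,n]∣m (gcd u v) M) refl
    where
    g = gcd (gcd u v) M
    go : g ∣ gcd u v → g ≡ gcd (gcd u v) M → _
    go g∣ _ = build (∣-trans g∣ (gcd[m,n]∣m u v)) (∣-trans g∣ (gcd[m,n]∣n u v)) (gcd[m,n]∣n (gcd u v) M)
      where
      g≢0 : g ≢ 0
      g≢0 z = ≢-nonZero⁻¹ M (gcd[m,n]≡0⇒n≡0 (gcd u v) z)
      build : g ∣ u → g ∣ v → g ∣ M → ∃₂ λ g m → M ≡ g * g * m × Scaled g m (δ , u , v)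
      build (divides u₁ u≡) (divides v₁ v≡) g∣M = finish g²∣M
        where
        instance
          gg≢0 : NonZero (g * g)
          gg≢0 = m*n≢0 g g {{≢-nonZero g≢0}} {{≢-nonZero g≢0}}
        factor : ∀ a b D g → a * g * (a * g) + D * (b * g * (b * g)) ≡ (g * g) * (a * a + D * (b * b))
        factor = solve-∀
        e₁ : (g * g) * (u₁ * u₁ + disc δ * (v₁ * v₁)) ≡ scale δ * M
        e₁ = trans (sym (factor u₁ v₁ (disc δ) g)) (trans (sym (cong₂ (λ a b → a * a + disc δ * (b * b)) u≡ v≡)) e)
        g⊥12 : Coprime g 12
        g⊥12 = coprime-∣ˡ g∣M (coprime-12 M%12)
        g²∣M : g * g ∣ M
        g²∣M = coprime-divisor (coprime-∣ʳ (scale-∣12 δ) (coprime-* g⊥12 g⊥12)) (subst (g * g ∣_) e₁ (m∣m*n _))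
        finish : g * g ∣ M → ∃₂ λ g m → M ≡ g * g * m × Scaled g m (δ , u , v)
        finish (divides m M≡) = g , m , M≡′ , scaled (δ , u₁ , v₁) (cong₂ (λ a b → δ , a , b) (trans u≡ (*-comm u₁ g)) (trans v≡ (*-comm v₁ g)))
            (prim norm₁ coprime₁)
          where
          M≡′ : M ≡ g * g * m
          M≡′ = trans M≡ (*-comm m (g * g))
          shuffle : ∀ c G m → c * (G * m) ≡ G * (c * m)
          shuffle = solve-∀
          norm₁ : u₁ * u₁ + disc δ * (v₁ * v₁) ≡ scale δ * m
          norm₁ = *-cancelˡ-≡ _ _ (g * g) (trans e₁ (trans (cong (scale δ *_) M≡′) (shuffle (scale δ) (g * g) m)))
          coprime₁ : Coprime m v₁
          coprime₁ {d} (d∣m , d∣v) with d ≟ 1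
          ... | yes d≡1 = d≡1
          ... | no d≢1 = ⊥-elim (contra (prime-factor d {{≢-nonZero d≢0}} d≢1))
            where
            d≢0 : d ≢ 0
            d≢0 refl = ≢-nonZero⁻¹ M (trans M≡ (cong (_* (g * g)) (0∣⇒≡0 d∣m)))
            contra : ¬ (∃ λ q → Prime q × q ∣ d)
            contra (q , qr , q∣d) = nonTrivial⇒≢1 {{prime⇒nonTrivial qr}} (∣1⇒≡1 (*-cancelˡ-∣ g {{≢-nonZero g≢0}} (subst (g * q ∣_) (sym (*-identityʳ g)) gq∣g)))
              where
              q∣m = ∣-trans q∣d d∣m
              q∣v = ∣-trans q∣d d∣v
              q∣u : q ∣ u₁
              q∣u = Sum.[ (λ z → z) , (λ z → z) ] (euclidsLemma u₁ u₁ qr (∣m+n∣m⇒∣n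
                (subst (q ∣_) (trans (sym norm₁) (+-comm (u₁ * u₁) _)) (∣n⇒∣m*n (scale δ) q∣m)) (∣n⇒∣m*n (disc δ) (∣m⇒∣m*n v₁ q∣v))))
              gq∣g : g * q ∣ g
              gq∣g = gcd-greatest (gcd-greatest (subst (g * q ∣_) (trans (*-comm g u₁) (sym u≡)) (*-monoʳ-∣ g q∣u))
                                                (subst (g * q ∣_) (trans (*-comm g v₁) (sym v≡)) (*-monoʳ-∣ g q∣v)))
                                  (subst (g * q ∣_) (sym (trans M≡′ (*-assoc g g m))) (*-monoʳ-∣ g (∣n⇒∣m*n g q∣m)))

  record _~_ (x y : Point) : Set where
    constructor matched
    field
      g m : ℕ
      M≡ : M ≡ g * g * m
      m%12 : m % 12 ≡ 5
      sx : Scaled g m x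
      sy : Scaled g m y
      partners : Partner m%12 (split m m%12) (Scaled.y sx) (Scaled.y sy)

  private
    scale-up : ∀ {g m} → M ≡ g * g * m → ∀ y → PrimitivePoint m y → OnNorm M (proj₁ y , g * proj₁ (proj₂ y) , g * proj₂ (proj₂ y))
    scale-up {g} {m} M≡ (δ , u , v) q = trans (id u v (disc δ) g) (trans (cong (g * g *_) (norm q)) (trans (id₂ g (scale δ) m) (cong (scale δ *_) (sym M≡))))
      where
      id : ∀ u v D g → g * u * (g * u) + D * (g * v * (g * v)) ≡ g * g * (u * u + D * (v * v))
      id = solve-∀
      id₂ : ∀ g c m → g * g * (c * m) ≡ c * (g * g * m)
      id₂ = solve-∀

    g≢0 : ∀ {g m} → M ≡ g * g * m → NonZero g
    g≢0 {zero} e = ⊥-elim (≢-nonZero⁻¹ M e)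
    g≢0 {suc _} _ = _

    scaled-injective : ∀ {g m x} → M ≡ g * g * m → (s t : Scaled g m x) → Scaled.y s ≡ Scaled.y t
    scaled-injective {g} M≡ (scaled (δ , u , v) refl _) (scaled (δ′ , u′ , v′) e _) = pack (cong proj₁ e)
      (*-cancelˡ-≡ u u′ g {{g≢0 M≡}} (cong (λ z → proj₁ (proj₂ z)) e)) (*-cancelˡ-≡ v v′ g {{g≢0 M≡}} (cong (λ z → proj₂ (proj₂ z)) e))
      where
      pack : δ ≡ δ′ → u ≡ u′ → v ≡ v′ → (δ , u , v) ≡ (δ′ , u′ , v′)
      pack refl refl refl = refl

  ~-sym : ∀ {x y} → x ~ y → y ~ x
  ~-sym (matched g m M≡ e sx sy p) = matched g m M≡ e sy sx (partner-sym e (split m e) (y sx) (y sy) p)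

  ~-irreflexive : ∀ {x} → ¬ x ~ x
  ~-irreflexive (matched g m M≡ e sx sy p) = partner-irreflexive e (split m e) (y sx) (isPrimitive sx)
    (subst (Partner e (split m e) (y sx)) (sym (scaled-injective M≡ sx sy)) p)

  ~-functional : ∀ {x y z} → x ~ y → x ~ z → y ≡ z
  ~-functional {x} (matched g m M≡ e sx sy p) (matched g′ m′ M≡′ e′ sx′ sz p′) = go g′ m′ M≡′ e′ sx′ sz p′ (trans (scaled-g M≡′ sx′) (sym (scaled-g M≡ sx)))
    where
    go : ∀ {z} g′ m′ (M≡′ : M ≡ g′ * g′ * m′) (e′ : m′ % 12 ≡ 5) (sx′ : Scaled g′ m′ x) (sz : Scaled g′ m′ z) →
      Partner e′ (split m′ e′) (y sx′) (y sz) → g′ ≡ g → _ ≡ z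
    go g′ m′ M≡′ e′ sx′ sz p′ refl = go′ m′ e′ sx′ sz p′ (*-cancelˡ-≡ m′ m (g * g) {{m*n≢0 g g {{g≢0 M≡}} {{g≢0 M≡}}}} (trans (sym M≡′) M≡))
      where
      go′ : ∀ {z} m′ (e′ : m′ % 12 ≡ 5) (sx′ : Scaled g m′ x) (sz : Scaled g m′ z) →
        Partner e′ (split m′ e′) (y sx′) (y sz) → m′ ≡ m → _ ≡ z
      -- `split` depends on the proof of m ≡ 5 (mod 12); as the two proofs are equal, both pairings
      -- use the same prime.
      go′ m′ e′ sx′ sz p′ refl = go″ (≡-irrelevant e′ e) p′
        where
        go″ : e′ ≡ e → Partner e′ (split m e′) (y sx′) (y sz) → _
        go″ refl p′ = trans (x≡ sy) (trans (cong (λ w → proj₁ w , g * proj₁ (proj₂ w) , g * proj₂ (proj₂ w))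
          (partner-functional e (split m e) (y sx) (y sy) (y sz) (isPrimitive sx) (isPrimitive sy) (isPrimitive sz) p
            (subst (λ w → Partner e (split m e) w (y sz)) (sym (scaled-injective M≡ sx sx′)) p′))) (sym (x≡ sz)))

  ~-total : ∀ x → OnNorm M x → ∃ λ y → OnNorm M y × x ~ y
  ~-total x e = go (decompose x e)
    where
    go : (∃₂ λ g m → M ≡ g * g * m × Scaled g m x) → ∃ λ y → OnNorm M y × x ~ y
    go (g , m , M≡ , sx) = go′ (partner-total m%12 (split m m%12) (y sx) (isPrimitive sx))
      where
      m%12 = square-cofactor g m M≡
      go′ : (∃ λ w → PrimitivePoint m w × Partner m%12 (split m m%12) (y sx) w) → ∃ λ y → OnNorm M y × x ~ y
      go′ (w , q , p) = (proj₁ w , g * proj₁ (proj₂ w) , g * proj₂ (proj₂ w)) , scale-up {g} {m} M≡ w q ,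
        matched g m M≡ m%12 sx (scaled w refl q) p

  onNorm? : ∀ x → Dec (OnNorm M x)
  onNorm? (δ , u , v) = u * u + disc δ * (v * v) ≟ scale δ * M

  box : ℕ → List Point
  box K = cartesianProduct (d9 ∷ d19 ∷ d57 ∷ []) (cartesianProduct (upTo K) (upTo K))

  box-unique : ∀ K → Unique (box K)
  box-unique K = Unique.cartesianProduct⁺ (((λ ()) ∷ (λ ()) ∷ []) ∷ ((λ ()) ∷ []) ∷ [] ∷ []) (Unique.cartesianProduct⁺ (Unique.upTo⁺ K) (Unique.upTo⁺ K))

  box-complete : ∀ K → 4 * M < K → ∀ x → OnNorm M x → x ∈ box K
  box-complete K 4M<K (δ , u , v) e = ∈-cartesianProduct⁺ (family∈ δ) (∈-cartesianProduct⁺ (∈-upTo⁺ (≤-<-trans u≤ 4M<K)) (∈-upTo⁺ (≤-<-trans v≤ 4M<K)))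
    where
    family∈ : ∀ δ → δ ∈ d9 ∷ d19 ∷ d57 ∷ []
    family∈ d9 = here refl
    family∈ d19 = there (here refl)
    family∈ d57 = there (there (here refl))
    scale≤4 : ∀ δ → scale δ ≤ 4
    scale≤4 d9 = m≤m+n 2 2
    scale≤4 d19 = ≤-refl
    scale≤4 d57 = m≤m+n 2 2
    N≤ : u * u + disc δ * (v * v) ≤ 4 * M
    N≤ = ≤-trans (≤-reflexive e) (*-monoˡ-≤ M (scale≤4 δ))
    disc≢0 : ∀ δ → NonZero (disc δ)
    disc≢0 d9 = _
    disc≢0 d19 = _
    disc≢0 d57 = _
    u≤ : u ≤ 4 * M
    u≤ = ≤-trans (n≤n² u) (≤-trans (m≤m+n (u * u) _) N≤)
    v≤ : v ≤ 4 * M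
    v≤ = ≤-trans (n≤n² v) (≤-trans (m≤n*m (v * v) (disc δ) {{disc≢0 δ}}) (≤-trans (m≤n+m _ (u * u)) N≤))

  points-even : ∀ K → 4 * M < K → odd (length (filter onNorm? (box K))) ≡ false
  points-even K 4M<K = matching-even (filter onNorm? (box K)) (Unique.filter⁺ onNorm? (box-unique K)) (record
    { symmetric = λ _ _ → ~-sym
    ; irreflexive = λ _ → ~-irreflexive
    ; functional = λ _ _ _ → ~-functional
    ; total = λ {x} x∈ → total x (proj₂ (∈-filter⁻ onNorm? {xs = box K} x∈)) })
    where
    total : ∀ x → OnNorm M x → ∃ λ y → y ∈ filter onNorm? (box K) × x ~ y
    total x e = go (~-total x e)
      where
      go : (∃ λ y → OnNorm M y × x ~ y) → ∃ λ y → y ∈ filter onNorm? (box K) × x ~ y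
      go (y , e′ , r) = y , ∈-filter⁺ onNorm? (box-complete K 4M<K y e′) e′ , r

-- Power series over 𝔽₂

⇔⇒≡ : ∀ {a b} → (a ≡ true → b ≡ true) → (b ≡ true → a ≡ true) → a ≡ b
⇔⇒≡ {true} f g = sym (f refl)
⇔⇒≡ {false} {true} f g = g refl
⇔⇒≡ {false} {false} f g = refl

≡ᵇ-true : ∀ {m n} → m ≡ n → (m ≡ᵇ n) ≡ true
≡ᵇ-true {zero} refl = refl
≡ᵇ-true {suc m} refl = ≡ᵇ-true {m} refl

true-≡ᵇ : ∀ m n → (m ≡ᵇ n) ≡ true → m ≡ n
true-≡ᵇ m n e = ≡ᵇ⇒≡ m n (subst T (sym e) _)

≡ᵇ-false : ∀ {m n} → m ≢ n → (m ≡ᵇ n) ≡ false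
≡ᵇ-false {m} {n} ne with m ≡ᵇ n in e
... | false = refl
... | true = ⊥-elim (ne (true-≡ᵇ m n e))

≡ᵇ-cong : ∀ {m n m′ n′} → (m ≡ n → m′ ≡ n′) → (m′ ≡ n′ → m ≡ n) → (m ≡ᵇ n) ≡ (m′ ≡ᵇ n′)
≡ᵇ-cong {m} {n} {m′} {n′} f g = ⇔⇒≡ (λ e → ≡ᵇ-true (f (true-≡ᵇ m n e))) (λ e → ≡ᵇ-true (g (true-≡ᵇ m′ n′ e)))

∧-true : ∀ {a b} → a ∧ b ≡ true → a ≡ true × b ≡ true
∧-true {true} {true} _ = refl , refl

∧-falseʳ : ∀ a {b} → b ≡ false → a ∧ b ≡ false
∧-falseʳ false _ = refl
∧-falseʳ true e = e

∑ : ℕ → (ℕ → Bool) → Bool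
∑ zero f = false
∑ (suc n) f = f 0 xor ∑ n (f ∘ suc)

∑-cong : ∀ n {f g} → (∀ i → i < n → f i ≡ g i) → ∑ n f ≡ ∑ n g
∑-cong zero e = refl
∑-cong (suc n) e = cong₂ _xor_ (e 0 z<s) (∑-cong n λ i i<n → e (suc i) (s<s i<n))

∑-false : ∀ n {f} → (∀ i → i < n → f i ≡ false) → ∑ n f ≡ false
∑-false zero e = refl
∑-false (suc n) e = cong₂ _xor_ (e 0 z<s) (∑-false n λ i i<n → e (suc i) (s<s i<n))

∑-xor : ∀ n f g → ∑ n (λ i → f i xor g i) ≡ ∑ n f xor ∑ n g
∑-xor zero f g = refl
∑-xor (suc n) f g = trans (cong (_xor_ (f 0 xor g 0)) (∑-xor n (f ∘ suc) (g ∘ suc))) (xor-interchange (f 0) (g 0) _ _)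

∑-∧ˡ : ∀ n c f → c ∧ ∑ n f ≡ ∑ n (λ i → c ∧ f i)
∑-∧ˡ n true f = refl
∑-∧ˡ n false f = sym (∑-false n λ _ _ → refl)

∑-∧ʳ : ∀ n c f → ∑ n f ∧ c ≡ ∑ n (λ i → f i ∧ c)
∑-∧ʳ n c f = trans (∧-comm (∑ n f) c) (trans (∑-∧ˡ n c f) (∑-cong n λ i _ → ∧-comm c (f i)))

∑-swap : ∀ m n (f : ℕ → ℕ → Bool) → ∑ m (λ i → ∑ n (f i)) ≡ ∑ n (λ j → ∑ m (λ i → f i j))
∑-swap zero n f = sym (∑-false n λ _ _ → refl)
∑-swap (suc m) n f = trans (cong (_xor_ (∑ n (f 0))) (∑-swap m n (f ∘ suc))) (sym (∑-xor n (f 0) _))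

∑-+ : ∀ m n f → ∑ (m + n) f ≡ ∑ m f xor ∑ n (λ i → f (m + i))
∑-+ zero n f = refl
∑-+ (suc m) n f = trans (cong (_xor_ (f 0)) (∑-+ m n (f ∘ suc))) (sym (xor-assoc (f 0) _ _))

∑-last : ∀ n f → ∑ (suc n) f ≡ ∑ n f xor f n
∑-last zero f = xor-identityʳ (f 0)
∑-last (suc n) f = trans (cong (_xor_ (f 0)) (∑-last n (f ∘ suc))) (sym (xor-assoc (f 0) _ _))

∑-extend : ∀ {m n f} → m ≤ n → (∀ i → m ≤ i → f i ≡ false) → ∑ n f ≡ ∑ m f
∑-extend {m} {n} {f} m≤n e with m≤n⇒∃[o]m+o≡n m≤n
... | o , refl = trans (∑-+ m o f) (trans (cong (_xor_ (∑ m f)) (∑-false o λ i _ → e (m + i) (m≤m+n m i))) (xor-identityʳ _))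

∑-bound : ∀ m n {f} → (∀ i → m ≤ i → f i ≡ false) → (∀ i → n ≤ i → f i ≡ false) → ∑ m f ≡ ∑ n f
∑-bound m n e e′ with ≤-total m n
... | inj₁ m≤n = sym (∑-extend m≤n e)
... | inj₂ n≤m = ∑-extend n≤m e′

∑-single : ∀ n k f → k < n → (∀ i → i ≢ k → f i ≡ false) → ∑ n f ≡ f k
∑-single (suc n) zero f _ e = trans (cong (_xor_ (f 0)) (∑-false n λ i _ → e (suc i) λ ())) (xor-identityʳ (f 0))
∑-single (suc n) (suc k) f (s<s k<n) e = trans (cong (_xor ∑ n (f ∘ suc)) (e 0 λ ())) (∑-single n k (f ∘ suc) k<n λ i ne → e (suc i) (ne ∘ suc-injective))

∑-blocks : ∀ k n f → ∑ (n * k) f ≡ ∑ n (λ i → ∑ k (λ r → f (i * k + r)))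
∑-blocks k zero f = refl
∑-blocks k (suc n) f = trans (∑-+ k (n * k) f) (cong (_xor_ (∑ k f)) (trans (∑-blocks k n (λ j → f (k + j)))
  (∑-cong n λ i _ → ∑-cong k λ r _ → cong f (sym (+-assoc k (i * k) r)))))

Series : Set
Series = ℕ → Bool

infixl 6 _⊕_
_⊕_ : Series → Series → Series
(f ⊕ g) n = f n xor g n

one : Series
one n = n ≡ᵇ 0

shift : ℕ → Series → Series
shift zero f n = f n
shift (suc k) f zero = false
shift (suc k) f (suc n) = shift k f n

-- Multiplication by 1 + q^k, the Euler factor modulo 2; `shift k` is multiplication by q^k.
mul : ℕ → Series → Series
mul k f = f ⊕ shift k f

-- The Cauchy product, with the constant term of f split off so that proofs are inductions without
-- subtraction of indices.
conv : Series → Series → Series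
conv f g zero = f 0 ∧ g 0
conv f g (suc n) = (f 0 ∧ g (suc n)) xor conv (f ∘ suc) g n

shift-cong : ∀ k {f g} → (∀ n → f n ≡ g n) → ∀ n → shift k f n ≡ shift k g n
shift-cong zero e n = e n
shift-cong (suc k) e zero = refl
shift-cong (suc k) e (suc n) = shift-cong k e n

shift-⊕ : ∀ k f g n → shift k (f ⊕ g) n ≡ shift k f n xor shift k g n
shift-⊕ zero f g n = refl
shift-⊕ (suc k) f g zero = refl
shift-⊕ (suc k) f g (suc n) = shift-⊕ k f g n

shift-+ : ∀ a b f n → shift a (shift b f) n ≡ shift (a + b) f n
shift-+ zero b f n = refl
shift-+ (suc a) b f zero = refl
shift-+ (suc a) b f (suc n) = shift-+ a b f n

shift-< : ∀ k f n → n < k → shift k f n ≡ false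
shift-< (suc k) f zero _ = refl
shift-< (suc k) f (suc n) (s<s n<k) = shift-< k f n n<k

shift-at : ∀ k f n → shift k f (k + n) ≡ f n
shift-at zero f n = refl
shift-at (suc k) f n = shift-at k f n

shift-one : ∀ k n → shift k one n ≡ (n ≡ᵇ k)
shift-one zero n = refl
shift-one (suc k) zero = refl
shift-one (suc k) (suc n) = shift-one k n

shift-comm : ∀ a b f n → shift a (shift b f) n ≡ shift b (shift a f) n
shift-comm a b f n = trans (shift-+ a b f n) (trans (cong (λ k → shift k f n) (+-comm a b)) (sym (shift-+ b a f n)))

mul-cong : ∀ k {f g} → (∀ n → f n ≡ g n) → ∀ n → mul k f n ≡ mul k g n
mul-cong k e n = cong₂ _xor_ (e n) (shift-cong k e n)

shift-mul : ∀ a b f n → shift a (mul b f) n ≡ mul b (shift a f) n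
shift-mul a b f n = trans (shift-⊕ a f (shift b f) n) (cong (_xor_ (shift a f n)) (shift-comm a b f n))

mul-comm : ∀ a b f n → mul a (mul b f) n ≡ mul b (mul a f) n
mul-comm a b f n = begin
  (f n xor shift b f n) xor shift a (mul b f) n ≡⟨ cong (_xor_ (f n xor shift b f n)) (shift-mul a b f n) ⟩
  (f n xor shift b f n) xor (shift a f n xor shift b (shift a f) n) ≡⟨ xor-interchange (f n) _ _ _ ⟩
  (f n xor shift a f n) xor (shift b f n xor shift b (shift a f) n) ≡⟨ cong (_xor_ (f n xor shift a f n)) (shift-⊕ b f (shift a f) n) ⟨
  (f n xor shift a f n) xor shift b (mul a f) n ∎
  where open ≡-Reasoning

conv-cong≤ : ∀ n {f f′ g g′} → (∀ i → i ≤ n → f i ≡ f′ i) → (∀ i → i ≤ n → g i ≡ g′ i) → conv f g n ≡ conv f′ g′ n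
conv-cong≤ zero e e′ = cong₂ _∧_ (e 0 z≤n) (e′ 0 z≤n)
conv-cong≤ (suc n) e e′ = cong₂ _xor_ (cong₂ _∧_ (e 0 z≤n) (e′ (suc n) ≤-refl)) (conv-cong≤ n (λ i i≤n → e (suc i) (s≤s i≤n)) (λ i i≤n → e′ i (m≤n⇒m≤1+n i≤n)))

conv-cong : ∀ {f f′ g g′} → (∀ i → f i ≡ f′ i) → (∀ i → g i ≡ g′ i) → ∀ n → conv f g n ≡ conv f′ g′ n
conv-cong e e′ n = conv-cong≤ n (λ i _ → e i) (λ i _ → e′ i)

conv-falseˡ : ∀ g n → conv (λ _ → false) g n ≡ false
conv-falseˡ g zero = refl
conv-falseˡ g (suc n) = conv-falseˡ g n

conv-one : ∀ g n → conv one g n ≡ g n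
conv-one g zero = refl
conv-one g (suc n) = trans (cong (_xor_ (g (suc n))) (conv-falseˡ g n)) (xor-identityʳ _)

conv-⊕ˡ : ∀ f f′ g n → conv (f ⊕ f′) g n ≡ conv f g n xor conv f′ g n
conv-⊕ˡ f f′ g zero = ∧-distribʳ-xor (g 0) (f 0) (f′ 0)
conv-⊕ˡ f f′ g (suc n) = trans (cong₂ _xor_ (∧-distribʳ-xor (g (suc n)) (f 0) (f′ 0)) (conv-⊕ˡ (f ∘ suc) (f′ ∘ suc) g n)) (xor-interchange (f 0 ∧ g (suc n)) _ _ _)

conv-⊕ʳ : ∀ f g g′ n → conv f (g ⊕ g′) n ≡ conv f g n xor conv f g′ n
conv-⊕ʳ f g g′ zero = ∧-distribˡ-xor (f 0) (g 0) (g′ 0)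
conv-⊕ʳ f g g′ (suc n) = trans (cong₂ _xor_ (∧-distribˡ-xor (f 0) (g (suc n)) (g′ (suc n))) (conv-⊕ʳ (f ∘ suc) g g′ n)) (xor-interchange (f 0 ∧ g (suc n)) _ _ _)

conv-∧ˡ : ∀ c f g n → conv (λ i → c ∧ f i) g n ≡ c ∧ conv f g n
conv-∧ˡ true f g n = refl
conv-∧ˡ false f g n = conv-falseˡ g n

conv-shiftˡ : ∀ k f g n → conv (shift k f) g n ≡ shift k (conv f g) n
conv-shiftˡ zero f g n = refl
conv-shiftˡ (suc k) f g zero = refl
conv-shiftˡ (suc k) f g (suc n) = conv-shiftˡ k f g n

conv-mulˡ : ∀ k f g n → conv (mul k f) g n ≡ mul k (conv f g) n
conv-mulˡ k f g n = trans (conv-⊕ˡ f (shift k f) g n) (cong (_xor_ (conv f g n)) (conv-shiftˡ k f g n))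

conv-assoc : ∀ f g h n → conv (conv f g) h n ≡ conv f (conv g h) n
conv-assoc f g h zero = ∧-assoc (f 0) (g 0) (h 0)
conv-assoc f g h (suc n) = begin
  (f 0 ∧ g 0) ∧ h (suc n) xor conv ((λ m → f 0 ∧ g (suc m)) ⊕ conv (f ∘ suc) g) h n
    ≡⟨ cong₂ _xor_ (∧-assoc (f 0) (g 0) (h (suc n))) (conv-⊕ˡ (λ m → f 0 ∧ g (suc m)) (conv (f ∘ suc) g) h n) ⟩
  f 0 ∧ (g 0 ∧ h (suc n)) xor (conv (λ m → f 0 ∧ g (suc m)) h n xor conv (conv (f ∘ suc) g) h n)
    ≡⟨ cong (_xor_ (f 0 ∧ (g 0 ∧ h (suc n)))) (cong₂ _xor_ (conv-∧ˡ (f 0) (g ∘ suc) h n) (conv-assoc (f ∘ suc) g h n)) ⟩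
  f 0 ∧ (g 0 ∧ h (suc n)) xor (f 0 ∧ conv (g ∘ suc) h n xor conv (f ∘ suc) (conv g h) n)
    ≡⟨ xor-assoc (f 0 ∧ (g 0 ∧ h (suc n))) _ _ ⟨
  (f 0 ∧ (g 0 ∧ h (suc n)) xor f 0 ∧ conv (g ∘ suc) h n) xor conv (f ∘ suc) (conv g h) n
    ≡⟨ cong (_xor conv (f ∘ suc) (conv g h) n) (∧-distribˡ-xor (f 0) (g 0 ∧ h (suc n)) (conv (g ∘ suc) h n)) ⟨
  f 0 ∧ conv g h (suc n) xor conv (f ∘ suc) (conv g h) n ∎
  where open ≡-Reasoning

conv-last : ∀ f g n → conv f g (suc n) ≡ conv f (g ∘ suc) n xor (f (suc n) ∧ g 0)
conv-last f g zero = refl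
conv-last f g (suc n) = trans (cong (_xor_ (f 0 ∧ g (2 + n))) (conv-last (f ∘ suc) g n)) (sym (xor-assoc (f 0 ∧ g (2 + n)) _ _))

conv-∑ : ∀ f g n → conv f g n ≡ ∑ (suc n) (λ i → f i ∧ g (n ∸ i))
conv-∑ f g zero = sym (xor-identityʳ _)
conv-∑ f g (suc n) = cong (_xor_ (f 0 ∧ g (suc n))) (conv-∑ (f ∘ suc) g n)

dilate₂ : Series → Series
dilate₂ f zero = f 0
dilate₂ f (suc zero) = false
dilate₂ f (suc (suc n)) = dilate₂ (f ∘ suc) n

-- Frobenius in characteristic 2: the outermost terms f 0 · f (n + 2) and f (n + 2) · f 0 cancel.
conv-square : ∀ f n → conv f f n ≡ dilate₂ f n
conv-square f zero = ∧-idem (f 0)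
conv-square f (suc zero) = trans (cong (_xor_ (f 0 ∧ f 1)) (∧-comm (f 1) (f 0))) (xor-same (f 0 ∧ f 1))
conv-square f (suc (suc n)) = begin
  a xor conv (f ∘ suc) f (suc n) ≡⟨ cong (_xor_ a) (conv-last (f ∘ suc) f n) ⟩
  a xor (conv (f ∘ suc) (f ∘ suc) n xor f (2 + n) ∧ f 0) ≡⟨ cong (λ b → a xor (conv (f ∘ suc) (f ∘ suc) n xor b)) (∧-comm (f (2 + n)) (f 0)) ⟩
  a xor (conv (f ∘ suc) (f ∘ suc) n xor a) ≡⟨ cong (_xor_ a) (xor-comm _ a) ⟩
  a xor (a xor conv (f ∘ suc) (f ∘ suc) n) ≡⟨ xor-assoc a a _ ⟨
  (a xor a) xor conv (f ∘ suc) (f ∘ suc) n ≡⟨ cong (_xor conv (f ∘ suc) (f ∘ suc) n) (xor-same a) ⟩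
  conv (f ∘ suc) (f ∘ suc) n ≡⟨ conv-square (f ∘ suc) n ⟩
  dilate₂ (f ∘ suc) n ∎
  where
  open ≡-Reasoning
  a = f 0 ∧ f (2 + n)

-- f(q²) has only even exponents, so the even part of f(q²) g is f times the even part of g.
conv-dilate₂ : ∀ f g n → conv (dilate₂ f) g (n + n) ≡ conv f (λ i → g (i + i)) n
conv-dilate₂ f g zero = refl
conv-dilate₂ f g (suc n) rewrite +-suc n n = cong (_xor_ (f 0 ∧ g (2 + (n + n)))) (conv-dilate₂ (f ∘ suc) g n)

conv-injective : ∀ f g g′ → f 0 ≡ true → (∀ n → conv f g n ≡ conv f g′ n) → ∀ n → g n ≡ g′ n
conv-injective f g g′ f0 e n = below n n ≤-refl
  where
  xor-cancel : ∀ {a b c d} → a xor c ≡ b xor d → c ≡ d → a ≡ b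
  xor-cancel {a} {b} {c} e refl = trans (sym (double a c)) (trans (cong (_xor c) e) (double b c))
    where
    double : ∀ a c → (a xor c) xor c ≡ a
    double a c = trans (xor-assoc a c c) (trans (cong (_xor_ a) (xor-same c)) (xor-identityʳ a))
  below : ∀ n i → i ≤ n → g i ≡ g′ i
  below n zero _ = subst (λ t → t ∧ g 0 ≡ t ∧ g′ 0) f0 (e 0)
  below (suc n) (suc i) (s≤s i≤n) = subst (λ t → t ∧ g (suc i) ≡ t ∧ g′ (suc i)) f0
    (xor-cancel (e (suc i)) (conv-cong≤ i (λ _ _ → refl) (λ j j≤i → below n j (≤-trans j≤i i≤n))))

-- The pentagonal number theorem modulo 2, after Shanks

τ : ℕ → ℕ → Bool
τ D x = ∑ (suc x) (λ v → D * (v * v) ≡ᵇ x)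

-- Defined as a theta series through 24 · s (3 s ± 1) / 2 + 1 = (6 s ± 1)²; `euler` identifies it
-- with ∏ (1 + qʲ).
f₁ : Series
f₁ n = τ 1 (24 * n + 1)

tri : ℕ → ℕ
tri zero = 0
tri (suc s) = suc s + tri s

-- The quotient P_(s+m) / P_s, that is ∏ (1 + qⁱ) over s < i ≤ s + m, written without dividing
-- series.
segment : ℕ → ℕ → Series
segment s zero = one
segment s (suc m) = mul (suc (s + m)) (segment s m)

segment-front : ∀ s m x → segment s (suc m) x ≡ mul (suc s) (segment (suc s) m) x
segment-front s zero x = cong (λ k → mul (suc k) one x) (+-identityʳ s)
segment-front s (suc m) x = begin
  mul (suc (s + suc m)) (segment s (suc m)) x ≡⟨ mul-cong (suc (s + suc m)) (segment-front s m) x ⟩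
  mul (suc (s + suc m)) (mul (suc s) (segment (suc s) m)) x ≡⟨ mul-comm (suc (s + suc m)) (suc s) (segment (suc s) m) x ⟩
  mul (suc s) (mul (suc (s + suc m)) (segment (suc s) m)) x ≡⟨ cong (λ k → mul (suc s) (mul (suc k) (segment (suc s) m)) x) (+-suc s m) ⟩
  mul (suc s) (segment (suc s) (suc m)) x ∎
  where open ≡-Reasoning

product-upTo : ℕ → Series
product-upTo n = segment 0 n

-- Shanks' identity:  ∑_{s ≤ n} (P_n / P_s) q^(s n + s(s+1)/2) = ∑_{|s| ≤ n} q^(s(3s+1)/2)  with P_s = ∏_{i ≤ s} (1 + qⁱ);
-- the term s = 0 is P_n and the others are O(qⁿ⁺¹).
shanks : ℕ → Series
shanks n x = ∑ (suc n) (λ s → shift (s * n + tri s) (segment s (n ∸ s)) x)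

private
  -- From q^s (1 + q^(n+1)) = 1 + (1 + q^s) + q^(s+n+1), passing from n to n + 1 changes the s-th
  -- term by U + V. The factor 1 + q^(s+1) in U at s + 1 extends the segment downwards and gives V
  -- at s, so the changes telescope to V n n.
  U V : ℕ → ℕ → Series
  U n s = shift (s * n + tri s) (mul s (segment s (n ∸ s)))
  V n s = shift (suc s * n + tri (suc s)) (segment s (n ∸ s))

  term-step : ∀ n s x → s ≤ n →
    shift (s * suc n + tri s) (segment s (suc n ∸ s)) x ≡ shift (s * n + tri s) (segment s (n ∸ s)) x xor (U n s x xor V n s x)
  term-step n s x s≤n = begin
    shift (s * suc n + tri s) (segment s (suc n ∸ s)) x
      ≡⟨ cong₂ (λ k m → shift k (segment s m) x) (e₁ s n (tri s)) (+-∸-assoc 1 s≤n) ⟩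
    shift (a + s) (mul (suc (s + (n ∸ s))) S) x
      ≡⟨ cong (λ k → shift (a + s) (mul (suc k) S) x) (m+[n∸m]≡n s≤n) ⟩
    shift (a + s) (mul (suc n) S) x
      ≡⟨ shift-⊕ (a + s) S (shift (suc n) S) x ⟩
    shift (a + s) S x xor shift (a + s) (shift (suc n) S) x
      ≡⟨ cong (_xor_ (shift (a + s) S x)) (trans (shift-+ (a + s) (suc n) S x) (cong (λ k → shift k S x) (e₂ s n (tri s)))) ⟩
    shift (a + s) S x xor V n s x
      ≡⟨ cong (_xor V n s x) (sym (xor-cancel (shift a S x) (shift (a + s) S x))) ⟩
    (shift a S x xor (shift a S x xor shift (a + s) S x)) xor V n s x
      ≡⟨ xor-assoc (shift a S x) _ _ ⟩
    shift a S x xor ((shift a S x xor shift (a + s) S x) xor V n s x)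
      ≡⟨ cong (λ b → shift a S x xor (b xor V n s x)) (trans (shift-⊕ a S (shift s S) x) (cong (_xor_ (shift a S x)) (shift-+ a s S x))) ⟨
    shift a S x xor (U n s x xor V n s x) ∎
    where
    open ≡-Reasoning
    a = s * n + tri s
    S = segment s (n ∸ s)
    e₁ : ∀ s n t → s * suc n + t ≡ s * n + t + s
    e₁ = solve-∀
    e₂ : ∀ s n t → s * n + t + s + suc n ≡ suc s * n + (suc s + t)
    e₂ = solve-∀
    xor-cancel : ∀ b c → b xor (b xor c) ≡ c
    xor-cancel b c = trans (sym (xor-assoc b b c)) (cong (_xor c) (xor-same b))

  U-zero : ∀ n x → U n 0 x ≡ false
  U-zero n x = xor-same (segment 0 n x)

  U-suc : ∀ n s x → s < n → U n (suc s) x ≡ V n s x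
  U-suc n s x s<n = shift-cong (suc s * n + tri (suc s)) (λ y → begin
    mul (suc s) (segment (suc s) (n ∸ suc s)) y ≡⟨ segment-front s (n ∸ suc s) y ⟨
    segment s (suc (n ∸ suc s)) y ≡⟨ cong (λ m → segment s m y) (+-∸-assoc 1 s<n) ⟨
    segment s (n ∸ s) y ∎) x
    where open ≡-Reasoning

  telescope : ∀ n x → ∑ (suc n) (λ s → U n s x xor V n s x) ≡ V n n x
  telescope n x = begin
    ∑ (suc n) (λ s → U n s x xor V n s x) ≡⟨ ∑-xor (suc n) (λ s → U n s x) (λ s → V n s x) ⟩
    (U n 0 x xor ∑ n (λ s → U n (suc s) x)) xor ∑ (suc n) (λ s → V n s x) ≡⟨ cong₂ (λ a b → (a xor ∑ n (λ s → U n (suc s) x)) xor b) (U-zero n x) (∑-last n (λ s → V n s x)) ⟩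
    ∑ n (λ s → U n (suc s) x) xor (∑ n (λ s → V n s x) xor V n n x) ≡⟨ cong (_xor (∑ n (λ s → V n s x) xor V n n x)) (∑-cong n λ s s<n → U-suc n s x s<n) ⟩
    ∑ n (λ s → V n s x) xor (∑ n (λ s → V n s x) xor V n n x) ≡⟨ xor-assoc (∑ n (λ s → V n s x)) _ _ ⟨
    (∑ n (λ s → V n s x) xor ∑ n (λ s → V n s x)) xor V n n x ≡⟨ cong (_xor V n n x) (xor-same (∑ n (λ s → V n s x))) ⟩
    V n n x ∎
    where open ≡-Reasoning

-- n (3 n + 1) / 2 and n (3 n - 1) / 2.
pentagonal⁺ pentagonal⁻ : ℕ → ℕ
pentagonal⁺ n = n * n + tri n
pentagonal⁻ n = n * n + tri (pred n)

shanks-step : ∀ n x → shanks (suc n) x ≡ (shanks n x xor (x ≡ᵇ pentagonal⁻ (suc n))) xor (x ≡ᵇ pentagonal⁺ (suc n))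
shanks-step n x = begin
  shanks (suc n) x
    ≡⟨ ∑-last (suc n) (λ s → shift (s * suc n + tri s) (segment s (suc n ∸ s)) x) ⟩
  ∑ (suc n) (λ s → shift (s * suc n + tri s) (segment s (suc n ∸ s)) x) xor shift (suc n * suc n + tri (suc n)) (segment (suc n) (n ∸ n)) x
    ≡⟨ cong₂ _xor_ (∑-cong (suc n) λ s s≤n → term-step n s x (≤-pred s≤n))
        (trans (cong (λ m → shift (pentagonal⁺ (suc n)) (segment (suc n) m) x) (n∸n≡0 n)) (shift-one (pentagonal⁺ (suc n)) x)) ⟩
  ∑ (suc n) (λ s → shift (s * n + tri s) (segment s (n ∸ s)) x xor (U n s x xor V n s x)) xor (x ≡ᵇ pentagonal⁺ (suc n))
    ≡⟨ cong (_xor (x ≡ᵇ pentagonal⁺ (suc n))) (trans (∑-xor (suc n) (λ s → shift (s * n + tri s) (segment s (n ∸ s)) x) (λ s → U n s x xor V n s x))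
        (cong (_xor_ (shanks n x)) (trans (telescope n x) V-last))) ⟩
  (shanks n x xor (x ≡ᵇ pentagonal⁻ (suc n))) xor (x ≡ᵇ pentagonal⁺ (suc n)) ∎
  where
  open ≡-Reasoning
  e : ∀ n t → suc n * n + (suc n + t) ≡ suc n * suc n + t
  e = solve-∀
  V-last : V n n x ≡ (x ≡ᵇ pentagonal⁻ (suc n))
  V-last = trans (cong₂ (λ m k → shift k (segment n m) x) (n∸n≡0 n) (e n (tri n))) (shift-one (pentagonal⁻ (suc n)) x)

-- `pentagonal⁺ s` goes with `pentagonal⁻ (suc s)` because they are (u² - 1) / 24 at u = 6 s + 1 and
-- u = 6 s + 5, in one block of six.
pentagonalSum : ℕ → Series
pentagonalSum n x = ∑ n (λ s → (x ≡ᵇ pentagonal⁺ s) xor (x ≡ᵇ pentagonal⁻ (suc s)))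

shanks≡pentagonalSum : ∀ n x → shanks n x ≡ pentagonalSum n x xor (x ≡ᵇ pentagonal⁺ n)
shanks≡pentagonalSum zero x = xor-identityʳ (x ≡ᵇ 0)
shanks≡pentagonalSum (suc n) x = begin
  shanks (suc n) x ≡⟨ shanks-step n x ⟩
  (shanks n x xor (x ≡ᵇ pentagonal⁻ (suc n))) xor (x ≡ᵇ pentagonal⁺ (suc n))
    ≡⟨ cong (λ b → (b xor (x ≡ᵇ pentagonal⁻ (suc n))) xor (x ≡ᵇ pentagonal⁺ (suc n))) (shanks≡pentagonalSum n x) ⟩
  ((pentagonalSum n x xor (x ≡ᵇ pentagonal⁺ n)) xor (x ≡ᵇ pentagonal⁻ (suc n))) xor (x ≡ᵇ pentagonal⁺ (suc n))
    ≡⟨ cong (_xor (x ≡ᵇ pentagonal⁺ (suc n))) (trans (xor-assoc (pentagonalSum n x) _ _) (sym (∑-last n _))) ⟩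
  pentagonalSum (suc n) x xor (x ≡ᵇ pentagonal⁺ (suc n)) ∎
  where open ≡-Reasoning

product≡shanks : ∀ n x → x ≤ n → product-upTo n x ≡ shanks n x
product≡shanks n x x≤n = sym (trans (cong (_xor_ (product-upTo n x)) (∑-false n λ s _ → shift-< (suc s * n + tri (suc s)) _ x (bound s)))
   (xor-identityʳ _))
  where
  open ≤-Reasoning
  bound : ∀ s → x < suc s * n + tri (suc s)
  bound s = begin-strict
    x ≤⟨ x≤n ⟩
    n ≤⟨ m≤m+n n (s * n) ⟩
    n + s * n <⟨ m<m+n (n + s * n) z<s ⟩
    n + s * n + (suc s + tri s) ∎

-- u is cut into blocks of six. A square 24 x + 1 is 1 modulo 6, which leaves the residues 1 and 5.
f₁≡pentagonalSum : ∀ x → f₁ x ≡ pentagonalSum (suc x) x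
f₁≡pentagonalSum x = begin
  f₁ x ≡⟨ ∑-bound (suc N) (suc x * 6) large₁ large₂ ⟩
  ∑ (suc x * 6) g ≡⟨ ∑-blocks 6 (suc x) g ⟩
  ∑ (suc x) (λ s → ∑ 6 (λ r → g (s * 6 + r))) ≡⟨ ∑-cong (suc x) (λ s _ → block s) ⟩
  pentagonalSum (suc x) x ∎
  where
  open ≡-Reasoning
  N = 24 * x + 1
  g : ℕ → Bool
  g u = 1 * (u * u) ≡ᵇ N
  large₁ : ∀ u → suc N ≤ u → g u ≡ false
  large₁ u N<u = ≡ᵇ-false λ e → <⇒≢ (<-≤-trans N<u (n≤n² u)) (sym (trans (sym (*-identityˡ (u * u))) e))
  large₂ : ∀ u → suc x * 6 ≤ u → g u ≡ false
  large₂ u l = ≡ᵇ-false λ e → <⇒≢ (<-≤-trans (≤-<-trans (≤-reflexive refl) (big x)) (*-mono-≤ l l)) (sym (trans (sym (*-identityˡ (u * u))) e))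
    where
    id : ∀ x → suc x * 6 * (suc x * 6) ≡ suc (24 * x + 1) + (34 + 48 * x + 36 * x * x)
    id = solve-∀
    big : ∀ x → 24 * x + 1 < suc x * 6 * (suc x * 6)
    big x = subst (24 * x + 1 <_) (sym (id x)) (m≤m+n (suc (24 * x + 1)) _)
  2tri : ∀ s → 2 * tri s ≡ s * suc s
  2tri zero = refl
  2tri (suc s) = trans (*-distribˡ-+ 2 (suc s) (tri s)) (trans (cong (_+_ (2 * suc s)) (2tri s)) (id s))
    where
    id : ∀ s → 2 * suc s + s * suc s ≡ suc s * suc (suc s)
    id = solve-∀
  not-unit : ∀ s r → (r * r) % 6 ≢ 1 → g (s * 6 + r) ≡ false
  not-unit s r ne = ≡ᵇ-false λ e → ne (trans (sym ([m+kn]%n≡m%n (r * r) (6 * s * s + 2 * s * r) 6))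
    (trans (cong (_% 6) (trans (sym (id s r)) (trans e (id′ x)))) ([m+kn]%n≡m%n 1 (4 * x) 6)))
    where
    id : ∀ s r → 1 * ((s * 6 + r) * (s * 6 + r)) ≡ r * r + (6 * s * s + 2 * s * r) * 6
    id = solve-∀
    id′ : ∀ x → 24 * x + 1 ≡ 1 + (4 * x) * 6
    id′ = solve-∀
  exact : ∀ u p → 1 * (u * u) ≡ 24 * p + 1 → g u ≡ (x ≡ᵇ p)
  exact u p e = ≡ᵇ-cong (λ f → *-cancelˡ-≡ x p 24 (+-cancelʳ-≡ 1 _ _ (trans (sym f) e))) (λ f → trans e (cong (λ z → 24 * z + 1) (sym f)))
  g₁ : ∀ s → g (s * 6 + 1) ≡ (x ≡ᵇ pentagonal⁺ s)
  g₁ s = exact (s * 6 + 1) (pentagonal⁺ s) (trans (id s) (trans (cong (λ t → 24 * (s * s) + 12 * t + 1) (sym (2tri s))) (id′ s (tri s))))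
    where
    id : ∀ s → 1 * ((s * 6 + 1) * (s * 6 + 1)) ≡ 24 * (s * s) + 12 * (s * suc s) + 1
    id = solve-∀
    id′ : ∀ s t → 24 * (s * s) + 12 * (2 * t) + 1 ≡ 24 * (s * s + t) + 1
    id′ = solve-∀
  g₅ : ∀ s → g (s * 6 + 5) ≡ (x ≡ᵇ pentagonal⁻ (suc s))
  g₅ s = exact (s * 6 + 5) (pentagonal⁻ (suc s)) (trans (id s) (trans (cong (λ t → 24 * (suc s * suc s) + 12 * t + 1) (sym (2tri s))) (id′ s (tri s))))
    where
    id : ∀ s → 1 * ((s * 6 + 5) * (s * 6 + 5)) ≡ 24 * (suc s * suc s) + 12 * (s * suc s) + 1
    id = solve-∀
    id′ : ∀ s t → 24 * (suc s * suc s) + 12 * (2 * t) + 1 ≡ 24 * (suc s * suc s + t) + 1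
    id′ = solve-∀
  block : ∀ s → ∑ 6 (λ r → g (s * 6 + r)) ≡ (x ≡ᵇ pentagonal⁺ s) xor (x ≡ᵇ pentagonal⁻ (suc s))
  block s = trans (cong₂ _xor_ (not-unit s 0 (λ ())) (cong₂ _xor_ (g₁ s) (cong₂ _xor_ (not-unit s 2 (λ ())) (cong₂ _xor_ (not-unit s 3 (λ ()))
    (cong₂ _xor_ (not-unit s 4 (λ ())) (cong₂ _xor_ (g₅ s) refl))))))
    (cong (_xor_ (x ≡ᵇ pentagonal⁺ s)) (xor-identityʳ _))

euler : ∀ n x → x ≤ n → product-upTo n x ≡ f₁ x
euler n x x≤n = begin
  product-upTo n x ≡⟨ product≡shanks n x x≤n ⟩
  shanks n x ≡⟨ shanks≡pentagonalSum n x ⟩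
  pentagonalSum n x xor (x ≡ᵇ pentagonal⁺ n) ≡⟨ cong (_xor_ (pentagonalSum n x)) (sym (trans (cong (_xor_ (x ≡ᵇ pentagonal⁺ n)) (≡ᵇ-false (<⇒≢ (beyond n x≤n)))) (xor-identityʳ _))) ⟩
  pentagonalSum n x xor ((x ≡ᵇ pentagonal⁺ n) xor (x ≡ᵇ pentagonal⁻ (suc n))) ≡⟨ ∑-last n _ ⟨
  pentagonalSum (suc n) x ≡⟨ ∑-extend (s≤s x≤n) (λ s x<s → cong₂ _xor_ (≡ᵇ-false (<⇒≢ (<-≤-trans x<s (≤-trans (n≤n² s) (m≤m+n (s * s) (tri s))))))
                                                                                          (≡ᵇ-false (<⇒≢ (beyond s (<⇒≤ x<s))))) ⟩
  pentagonalSum (suc x) x ≡⟨ f₁≡pentagonalSum x ⟨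
  f₁ x ∎
  where
  open ≡-Reasoning
  beyond : ∀ s → x ≤ s → x < pentagonal⁻ (suc s)
  beyond s x≤s = ≤-trans (s≤s x≤s) (≤-trans (n≤n² (suc s)) (m≤m+n (suc s * suc s) (tri s)))

-- The generating function of regular partitions

odd-+ : ∀ m n → odd (m + n) ≡ odd m xor odd n
odd-+ zero n = refl
odd-+ (suc m) n = trans (cong not (odd-+ m n)) (not-xor (odd m) (odd n))
  where
  not-xor : ∀ a b → not (a xor b) ≡ not a xor b
  not-xor false b = refl
  not-xor true false = refl
  not-xor true true = refl

module _ {A : Set} {P : A → Set} (P? : Decidable P) where

  count₂ : List A → Bool
  count₂ xs = odd (length (filter P? xs))

  count₂-++ : ∀ xs ys → count₂ (xs ++ ys) ≡ count₂ xs xor count₂ ys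
  count₂-++ xs ys = trans (cong (odd ∘ length) (filter-++ P? xs ys)) (trans (cong odd (length-++ (filter P? xs))) (odd-+ (length (filter P? xs)) _))

  count₂-∷ : ∀ x xs → count₂ (x ∷ xs) ≡ does (P? x) xor count₂ xs
  count₂-∷ x xs with does (P? x)
  ... | true = refl
  ... | false = refl

  count₂-map : ∀ {B : Set} {Q : B → Set} (Q? : Decidable Q) (g : B → A) → (∀ x → does (P? (g x)) ≡ does (Q? x)) →
    ∀ xs → count₂ (map g xs) ≡ odd (length (filter Q? xs))
  count₂-map Q? g e [] = refl
  count₂-map Q? g e (x ∷ xs) with does (P? (g x)) | does (Q? x) | e x
  ... | true | .true | refl = cong not (count₂-map Q? g e xs)
  ... | false | .false | refl = count₂-map Q? g e xs

  count₂-none : ∀ {B : Set} (g : B → A) → (∀ x → ¬ P (g x)) → ∀ xs → count₂ (map g xs) ≡ false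
  count₂-none g e [] = refl
  count₂-none g e (x ∷ xs) = trans (count₂-∷ (g x) (map g xs)) (cong₂ _xor_ (dec-false (P? (g x)) (e x)) (count₂-none g e xs))

  count₂-concatMap-filter : ∀ {Q : ℕ → Set} (Q? : Decidable Q) (f : ℕ → List A) (g : ℕ → ℕ) n →
    count₂ (concatMap f (filter Q? (applyUpTo g n))) ≡ ∑ n (λ j → does (Q? (g j)) ∧ count₂ (f (g j)))
  count₂-concatMap-filter Q? f g zero = refl
  count₂-concatMap-filter Q? f g (suc n) with does (Q? (g 0))
  ... | false = count₂-concatMap-filter Q? f (g ∘ suc) n
  ... | true = trans (count₂-++ (f (g 0)) _) (cong (_xor_ (count₂ (f (g 0)))) (count₂-concatMap-filter Q? f (g ∘ suc) n))

regular? : ∀ t → Decidable (All (λ p → ¬ t ∣ p))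
regular? t λs = all? (λ p → ¬? (t ∣? p)) λs

regularParity : ℕ → ℕ → Series
regularParity t k n = count₂ (regular? t) (partitionsUpTo k n)

private
  does-⇔ : ∀ {A B : Set} (a? : Dec A) (b? : Dec B) → (A → B) → (B → A) → does a? ≡ does b?
  does-⇔ (yes _) (yes _) _ _ = refl
  does-⇔ (no _) (no _) _ _ = refl
  does-⇔ (yes a) (no ¬b) f _ = ⊥-elim (¬b (f a))
  does-⇔ (no ¬a) (yes b) _ g = ⊥-elim (¬a (g b))

  shift-≤ : ∀ a f n → does (a ≤? n) ∧ f (n ∸ a) ≡ shift a f n
  shift-≤ zero f n = refl
  shift-≤ (suc a) f zero = refl
  shift-≤ (suc a) f (suc n) = trans (cong (λ b → b ∧ f (n ∸ a)) (does-⇔ (suc a ≤? suc n) (a ≤? n) ≤-pred s≤s)) (shift-≤ a f n)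

module _ (t k : ℕ) where

  private
    c = regularParity t

    expand : ∀ n → c (suc k) n ≡ ∑ (suc n) (λ j → does (j * suc k ≤? n) ∧ count₂ (regular? t) (map (replicate j (suc k) ++_) (partitionsUpTo k (n ∸ j * suc k))))
    expand n = count₂-concatMap-filter (regular? t) (λ j → j * suc k ≤? n) (λ j → map (replicate j (suc k) ++_) (partitionsUpTo k (n ∸ j * suc k))) (λ j → j) (suc n)

  -- Only the multiplicity j = 0 of the part k + 1 contributes.
  regularParity-∣ : t ∣ suc k → ∀ n → c (suc k) n ≡ c k n
  regularParity-∣ t∣k n = begin
    c (suc k) n ≡⟨ expand n ⟩
    count₂ (regular? t) (map (λ λs → λs) (partitionsUpTo k n)) xor ∑ n (λ j → does (suc j * suc k ≤? n) ∧ count₂ (regular? t) (map (replicate (suc j) (suc k) ++_) (partitionsUpTo k (n ∸ suc j * suc k))))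
      ≡⟨ cong₂ _xor_ (count₂-map (regular? t) (regular? t) (λ λs → λs) (λ _ → refl) (partitionsUpTo k n))
         (∑-false n λ j _ → trans (cong (does (suc j * suc k ≤? n) ∧_) (count₂-none (regular? t) _ (λ { λs (t∤ ∷ _) → t∤ t∣k }) (partitionsUpTo k (n ∸ suc j * suc k)))) (∧-zeroʳ _)) ⟩
    c k n xor false ≡⟨ xor-identityʳ _ ⟩
    c k n ∎
    where open ≡-Reasoning

  -- c (k + 1) is the geometric series of q^(j (k+1)) c k over the multiplicity j; the factor 1 +
  -- q^(k+1) leaves only j = 0.
  regularParity-∤ : ¬ t ∣ suc k → ∀ n → mul (suc k) (c (suc k)) n ≡ c k n
  regularParity-∤ t∤k n = begin
    c (suc k) n xor shift (suc k) (c (suc k)) n ≡⟨ cong₂ _xor_ (geometric n) (shifted n (suc k ≤? n)) ⟩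
    (c k n xor ∑ n (λ j → term n (suc j))) xor ∑ n (λ j → term n (suc j)) ≡⟨ xor-assoc (c k n) _ _ ⟩
    c k n xor (∑ n (λ j → term n (suc j)) xor ∑ n (λ j → term n (suc j))) ≡⟨ cong (_xor_ (c k n)) (xor-same (∑ n (λ j → term n (suc j)))) ⟩
    c k n xor false ≡⟨ xor-identityʳ _ ⟩
    c k n ∎
    where
    open ≡-Reasoning
    term : ℕ → ℕ → Bool
    term n j = shift (j * suc k) (c k) n
    regular-replicate : ∀ j λs → does (regular? t (replicate j (suc k) ++ λs)) ≡ does (regular? t λs)
    regular-replicate j λs = does-⇔ (regular? t (replicate j (suc k) ++ λs)) (regular? t λs) (All.++⁻ʳ (replicate j (suc k))) (All.++⁺ (All.replicate⁺ j t∤k))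
    geometric : ∀ n → c (suc k) n ≡ ∑ (suc n) (term n)
    geometric n = trans (expand n) (∑-cong (suc n) λ j _ → trans
      (cong (does (j * suc k ≤? n) ∧_) (count₂-map (regular? t) (regular? t) (replicate j (suc k) ++_) (regular-replicate j) (partitionsUpTo k (n ∸ j * suc k))))
      (shift-≤ (j * suc k) (c k) n))
    term-large : ∀ n j → n < j → term n j ≡ false
    term-large n j n<j = shift-< (j * suc k) (c k) n (<-≤-trans n<j (m≤m*n j (suc k)))
    shifted : ∀ n → Dec (suc k ≤ n) → shift (suc k) (c (suc k)) n ≡ ∑ n (λ j → term n (suc j))
    shifted n (no k≰n) = trans (shift-< (suc k) (c (suc k)) n (≰⇒> k≰n)) (sym (∑-false n λ j _ →
      shift-< (suc j * suc k) (c k) n (<-≤-trans (≰⇒> k≰n) (m≤m+n (suc k) (j * suc k)))))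
    shifted n (yes k≤n) with m≤n⇒∃[o]m+o≡n k≤n
    ... | m , refl = begin
      shift (suc k) (c (suc k)) (suc k + m) ≡⟨ shift-at (suc k) (c (suc k)) m ⟩
      c (suc k) m ≡⟨ geometric m ⟩
      ∑ (suc m) (term m) ≡⟨ ∑-cong (suc m) (λ j _ → trans (sym (shift-at (suc k) (shift (j * suc k) (c k)) m)) (shift-+ (suc k) (j * suc k) (c k) (suc k + m))) ⟩
      ∑ (suc m) (λ j → term (suc k + m) (suc j)) ≡⟨ ∑-bound (suc m) (suc k + m)
          (λ j m<j → shift-< (suc j * suc k) (c k) (suc k + m) (+-monoʳ-< (suc k) (<-≤-trans m<j (m≤m*n j (suc k)))))
          (λ j n≤j → term-large (suc k + m) (suc j) (s≤s n≤j)) ⟩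
      ∑ (suc k + m) (λ j → term (suc k + m) (suc j)) ∎

conv-shiftʳ : ∀ k f g n → conv f (shift k g) n ≡ shift k (conv f g) n
conv-shiftʳ zero f g n = refl
conv-shiftʳ (suc k) f g zero = ∧-zeroʳ (f 0)
conv-shiftʳ (suc k) f g (suc n) = trans (conv-last f (shift (suc k) g) n) (trans (cong₂ _xor_ (conv-shiftʳ k f g n) (∧-zeroʳ (f (suc n)))) (xor-identityʳ _))

conv-mulʳ : ∀ k f g n → conv f (mul k g) n ≡ mul k (conv f g) n
conv-mulʳ k f g n = trans (conv-⊕ʳ f g (shift k g) n) (cong (_xor_ (conv f g n)) (conv-shiftʳ k f g n))

dilate : ∀ t .{{_ : NonZero t}} → Series → Series
dilate t f n = does (t ∣? n) ∧ f (n / t)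

module _ (t : ℕ) .{{_ : NonZero t}} where

  shift-dilate : ∀ f n → shift t (dilate t f) n ≡ dilate t (shift 1 f) n
  shift-dilate f n with t ≤? n
  ... | no t≰n = trans (shift-< t (dilate t f) n (≰⇒> t≰n)) (sym (trans (cong (λ q → does (t ∣? n) ∧ shift 1 f q) (m<n⇒m/n≡0 (≰⇒> t≰n))) (∧-zeroʳ _)))
  ... | yes t≤n with m≤n⇒∃[o]m+o≡n t≤n
  ... | m , refl = trans (shift-at t (dilate t f) m) (cong₂ _∧_
        (does-⇔ (t ∣? m) (t ∣? (t + m)) (∣m∣n⇒∣m+n ∣-refl) (λ d → ∣m+n∣m⇒∣n d ∣-refl))
        (sym (cong (shift 1 f) (trans (+-distrib-/-∣ˡ m (∣-refl {t})) (cong (_+ m / t) (n/n≡1 t))))))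

  shift-*-dilate : ∀ i f n → shift (i * t) (dilate t f) n ≡ dilate t (shift i f) n
  shift-*-dilate zero f n = refl
  shift-*-dilate (suc i) f n = begin
    shift (t + i * t) (dilate t f) n ≡⟨ shift-+ t (i * t) (dilate t f) n ⟨
    shift t (shift (i * t) (dilate t f)) n ≡⟨ shift-cong t (shift-*-dilate i f) n ⟩
    shift t (dilate t (shift i f)) n ≡⟨ shift-dilate (shift i f) n ⟩
    dilate t (shift 1 (shift i f)) n ≡⟨ cong (does (t ∣? n) ∧_) (shift-+ 1 i f (n / t)) ⟩
    dilate t (shift (suc i) f) n ∎
    where open ≡-Reasoning

  mul-dilate : ∀ i f n → mul (i * t) (dilate t f) n ≡ dilate t (mul i f) n
  mul-dilate i f n = trans (cong (_xor_ (dilate t f n)) (shift-*-dilate i f n)) (sym (∧-distribˡ-xor (does (t ∣? n)) (f (n / t)) (shift i f (n / t))))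

  private
    c = regularParity t

    /-step-∣ : ∀ k → t ∣ suc k → suc k ≡ suc (k / t) * t × suc k / t ≡ suc (k / t)
    /-step-∣ k (divides (suc q) e) = trans e (cong (λ z → suc z * t) (sym k/t)) , trans (cong (_/ t) e) (trans (m*n/n≡m (suc q) t) (cong suc (sym k/t)))
      where
      k/t : k / t ≡ q
      k/t = trans (cong (_/ t) k≡) (trans (+-distrib-/-∣ʳ (pred t) (n∣m*n q)) (cong₂ _+_ (m<n⇒m/n≡0 pred<t) (m*n/n≡m q t)))
        where
        pred<t : pred t < t
        pred<t = ≤-reflexive (suc-pred t)
        k≡ : k ≡ pred t + q * t
        k≡ = suc-injective (trans e (cong (_+ q * t) (sym (suc-pred t))))

    /-step-∤ : ∀ k → ¬ t ∣ suc k → suc k / t ≡ k / t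
    /-step-∤ k t∤ = trans (cong (_/ t) (cong suc (m≡m%n+[m/n]*n k t))) (trans (+-distrib-/-∣ʳ (suc (k % t)) (n∣m*n (k / t)))
      (cong₂ _+_ (m<n⇒m/n≡0 (≤∧≢⇒< (m%n<n k t) λ e → t∤ (subst (t ∣_) (sym (cong suc (m≡m%n+[m/n]*n k t))) (∣m∣n⇒∣m+n (subst (t ∣_) (sym e) ∣-refl) (n∣m*n (k / t)))))) (m*n/n≡m (k / t) t)))

  -- The truncation to parts ≤ k of f₁ ∑ b_t(n) qⁿ = f₁(q^t). A new factor 1 + q^(k+1) is absorbed
  -- by c if t ∤ k + 1; otherwise it passes to the right side as a factor in q^t.
  conv-product-regular : ∀ k n → conv (product-upTo k) (c k) n ≡ dilate t (product-upTo (k / t)) n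
  conv-product-regular zero n = trans (conv-one (c 0) n) (base n)
    where
    base : ∀ n → c 0 n ≡ dilate t (product-upTo (0 / t)) n
    base zero = sym (trans (cong₂ (λ b q → b ∧ product-upTo q q) (dec-true (t ∣? 0) (t ∣0)) (0/n≡0 t)) refl)
    base (suc n) = sym (trans (cong (λ q → does (t ∣? suc n) ∧ product-upTo q (suc n / t)) (0/n≡0 t)) (go (t ∣? suc n)))
      where
      go : (d : Dec (t ∣ suc n)) → does d ∧ one (suc n / t) ≡ false
      go (no _) = refl
      go (yes d) = cong (λ q → q ≡ᵇ 0) (proj₂ (/-step-∣ n d))
  conv-product-regular (suc k) n with t ∣? suc k
  ... | yes t∣ = begin
    conv (mul (suc k) (product-upTo k)) (c (suc k)) n ≡⟨ conv-mulˡ (suc k) (product-upTo k) (c (suc k)) n ⟩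
    mul (suc k) (conv (product-upTo k) (c (suc k))) n ≡⟨ mul-cong (suc k) (λ m → trans (conv-cong (λ _ → refl) (regularParity-∣ t k t∣) m) (conv-product-regular k m)) n ⟩
    mul (suc k) (dilate t (product-upTo (k / t))) n ≡⟨ cong (λ i → mul i (dilate t (product-upTo (k / t))) n) (proj₁ (/-step-∣ k t∣)) ⟩
    mul (suc (k / t) * t) (dilate t (product-upTo (k / t))) n ≡⟨ mul-dilate (suc (k / t)) (product-upTo (k / t)) n ⟩
    dilate t (product-upTo (suc (k / t))) n ≡⟨ cong (λ q → dilate t (product-upTo q) n) (proj₂ (/-step-∣ k t∣)) ⟨
    dilate t (product-upTo (suc k / t)) n ∎
    where open ≡-Reasoning
  ... | no t∤ = begin
    conv (mul (suc k) (product-upTo k)) (c (suc k)) n ≡⟨ conv-mulˡ (suc k) (product-upTo k) (c (suc k)) n ⟩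
    mul (suc k) (conv (product-upTo k) (c (suc k))) n ≡⟨ conv-mulʳ (suc k) (product-upTo k) (c (suc k)) n ⟨
    conv (product-upTo k) (mul (suc k) (c (suc k))) n ≡⟨ conv-cong (λ _ → refl) (regularParity-∤ t k t∤) n ⟩
    conv (product-upTo k) (c k) n ≡⟨ conv-product-regular k n ⟩
    dilate t (product-upTo (k / t)) n ≡⟨ cong (λ q → dilate t (product-upTo q) n) (/-step-∤ k t∤) ⟨
    dilate t (product-upTo (suc k / t)) n ∎
    where open ≡-Reasoning

  regularParity-stable : ∀ i k → i ≤ k → c k i ≡ odd (b t i)
  regularParity-stable i k i≤k with m≤n⇒∃[o]m+o≡n i≤k
  ... | o , refl = go o
    where
    step : ∀ k → i ≤ k → c (suc k) i ≡ c k i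
    step k i≤k with t ∣? suc k
    ... | yes t∣ = regularParity-∣ t k t∣ i
    ... | no t∤ = trans (sym (trans (cong (_xor_ (c (suc k) i)) (shift-< (suc k) (c (suc k)) i (s≤s i≤k))) (xor-identityʳ _))) (regularParity-∤ t k t∤ i)
    go : ∀ o → c (i + o) i ≡ odd (b t i)
    go zero = cong (λ k → c k i) (+-identityʳ i)
    go (suc o) = trans (cong (λ k → c k i) (+-suc i o)) (trans (step (i + o) (m≤m+n i o)) (go o))

  regular-generating-function : ∀ n → conv f₁ (λ i → odd (b t i)) n ≡ dilate t f₁ n
  regular-generating-function n = begin
    conv f₁ (λ i → odd (b t i)) n ≡⟨ conv-cong≤ n (λ i i≤n → sym (euler n i i≤n)) (λ i i≤n → sym (regularParity-stable i n i≤n)) ⟩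
    conv (product-upTo n) (c n) n ≡⟨ conv-product-regular n n ⟩
    dilate t (product-upTo (n / t)) n ≡⟨ cong (does (t ∣? n) ∧_) (euler (n / t) (n / t) ≤-refl) ⟩
    dilate t f₁ n ∎
    where open ≡-Reasoning

-- Products of theta series

-- The cut-off K is explicit so that different counts can be compared over one box; c is a condition
-- on u.
theta₂ : ℕ → ℕ → ℕ → (ℕ → Bool) → ℕ → Bool
theta₂ K D D′ c x = ∑ K (λ u → ∑ K (λ v → c u ∧ (D * (u * u) + D′ * (v * v) ≡ᵇ x)))

private

  n≤Dn² : ∀ D .{{_ : NonZero D}} n → n ≤ D * (n * n)
  n≤Dn² D n = ≤-trans (n≤n² n) (m≤n*m (n * n) D)

  false-if : ∀ {b} → (b ≡ true → ⊥) → b ≡ false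
  false-if {false} _ = refl
  false-if {true} f = ⊥-elim (f refl)

τ-bound : ∀ D .{{_ : NonZero D}} x K → x < K → τ D x ≡ ∑ K (λ v → D * (v * v) ≡ᵇ x)
τ-bound D x K x<K = sym (∑-extend x<K λ v x<v → ≡ᵇ-false (λ e → <⇒≢ (<-≤-trans x<v (n≤Dn² D v)) (sym e)))

τ-scale : ∀ c D .{{_ : NonZero c}} .{{_ : NonZero D}} x → τ (c * D) (c * x) ≡ τ D x
τ-scale c D x = trans (∑-cong (suc (c * x)) λ v _ → ≡ᵇ-cong {n′ = x}
    (λ e → *-cancelˡ-≡ (D * (v * v)) x c (trans (sym (*-assoc c D (v * v))) e)) (λ e → trans (*-assoc c D (v * v)) (cong (c *_) e)))
  (sym (τ-bound D x (suc (c * x)) (s≤s (m≤n*m x c))))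

module _ (D D′ r r′ : ℕ) .{{_ : NonZero D}} .{{_ : NonZero D′}} (c : ℕ → Bool) where

  -- A condition modulo 24 under which D u² + D′ v² = 24 n + r + r′ splits into D u² = 24 i + r and
  -- D′ v² = 24 j + r′ with i + j = n. The filter c removes the u for which the residues of the two
  -- terms could differ from r and r′.
  Separates : Set
  Separates = ∀ {a} → a < 24 → ∀ {b} → b < 24 →
    (c a ≡ true → (D * (a * a) + D′ * (b * b)) % 24 ≡ (r + r′) % 24 → ((D * (a * a)) % 24 ≡ r) × ((D′ * (b * b)) % 24 ≡ r′))
    × ((D * (a * a)) % 24 ≡ r % 24 → c a ≡ true)

  separates? : Dec Separates
  separates? = allUpTo? (λ a → allUpTo? (λ b →
    ((c a Data.Bool.≟ true) →-dec (((D * (a * a) + D′ * (b * b)) % 24 ≟ (r + r′) % 24) →-dec (((D * (a * a)) % 24 ≟ r) ×-dec ((D′ * (b * b)) % 24 ≟ r′))))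
    ×-dec (((D * (a * a)) % 24 ≟ r % 24) →-dec (c a Data.Bool.≟ true))) 24) 24

  private
    square-mod : ∀ D u → (D * (u * u)) % 24 ≡ (D * ((u % 24) * (u % 24))) % 24
    square-mod D u = trans (cong (λ z → (D * (z * z)) % 24) (m≡m%n+[m/n]*n u 24)) (trans (cong (_% 24) (id D (u % 24) (u / 24)))
      ([m+kn]%n≡m%n (D * ((u % 24) * (u % 24))) (D * (2 * (u % 24) * (u / 24) + 24 * ((u / 24) * (u / 24)))) 24))
      where
      id : ∀ D r q → D * ((r + q * 24) * (r + q * 24)) ≡ D * (r * r) + (D * (2 * r * q + 24 * (q * q))) * 24
      id = solve-∀

    sum-mod : ∀ u v → (D * (u * u) + D′ * (v * v)) % 24 ≡ (D * ((u % 24) * (u % 24)) + D′ * ((v % 24) * (v % 24))) % 24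
    sum-mod u v = trans (%-distribˡ-+ (D * (u * u)) (D′ * (v * v)) 24) (trans (cong₂ (λ a b → (a + b) % 24) (square-mod D u) (square-mod D′ v))
      (sym (%-distribˡ-+ (D * ((u % 24) * (u % 24))) (D′ * ((v % 24) * (v % 24))) 24)))

    progression-mod : ∀ i r → (24 * i + r) % 24 ≡ r % 24
    progression-mod i r = trans (cong (_% 24) (trans (+-comm (24 * i) r) (cong (_+_ r) (*-comm 24 i)))) ([m+kn]%n≡m%n r i 24)

  conv-theta : Separates → ∀ K n → 24 * n + (r + r′) < K →
    conv (λ i → τ D (24 * i + r)) (λ j → τ D′ (24 * j + r′)) n ≡ theta₂ K D D′ (λ u → c (u % 24)) (24 * n + (r + r′))
  conv-theta sep K n N<K = begin
    conv (λ i → τ D (24 * i + r)) (λ j → τ D′ (24 * j + r′)) n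
      ≡⟨ conv-∑ (λ i → τ D (24 * i + r)) (λ j → τ D′ (24 * j + r′)) n ⟩
    ∑ (suc n) (λ i → τ D (24 * i + r) ∧ τ D′ (24 * (n ∸ i) + r′))
      ≡⟨ ∑-cong (suc n) (λ i i≤n → trans (cong₂ _∧_ (τ-bound D (24 * i + r) K (small₁ i (≤-pred i≤n))) (τ-bound D′ (24 * (n ∸ i) + r′) K (small₂ i)))
           (trans (∑-∧ʳ K (∑ K (λ v → D′ * (v * v) ≡ᵇ 24 * (n ∸ i) + r′)) (λ u → D * (u * u) ≡ᵇ 24 * i + r))
             (∑-cong K (λ u _ → ∑-∧ˡ K (D * (u * u) ≡ᵇ 24 * i + r) (λ v → D′ * (v * v) ≡ᵇ 24 * (n ∸ i) + r′))))) ⟩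
    ∑ (suc n) (λ i → ∑ K (λ u → ∑ K (λ v → term u v i)))
      ≡⟨ ∑-swap (suc n) K (λ i u → ∑ K (λ v → term u v i)) ⟩
    ∑ K (λ u → ∑ (suc n) (λ i → ∑ K (λ v → term u v i)))
      ≡⟨ ∑-cong K (λ u _ → ∑-swap (suc n) K (λ i v → term u v i)) ⟩
    ∑ K (λ u → ∑ K (λ v → ∑ (suc n) (term u v)))
      ≡⟨ ∑-cong K (λ u _ → ∑-cong K (λ v _ → collapse u v)) ⟩
    theta₂ K D D′ (λ u → c (u % 24)) N ∎
    where
    open ≡-Reasoning
    N = 24 * n + (r + r′)
    term : ℕ → ℕ → ℕ → Bool
    term u v i = (D * (u * u) ≡ᵇ 24 * i + r) ∧ (D′ * (v * v) ≡ᵇ 24 * (n ∸ i) + r′)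
    small₁ : ∀ i → i ≤ n → 24 * i + r < K
    small₁ i i≤n = ≤-<-trans (+-mono-≤ (*-monoʳ-≤ 24 i≤n) (m≤m+n r r′)) N<K
    small₂ : ∀ i → 24 * (n ∸ i) + r′ < K
    small₂ i = ≤-<-trans (+-mono-≤ (*-monoʳ-≤ 24 (m∸n≤m n i)) (m≤n+m r′ r)) N<K
    add : ∀ i j r r′ → (24 * i + r) + (24 * j + r′) ≡ 24 * (i + j) + (r + r′)
    add = solve-∀
    -- For given u and v at most one degree contributes, namely i = ⌊D u² / 24⌋.
    collapse : ∀ u v → ∑ (suc n) (term u v) ≡ c (u % 24) ∧ (D * (u * u) + D′ * (v * v) ≡ᵇ N)
    collapse u v = go _ refl
      where
      sep-uv = sep (m%n<n u 24) (m%n<n v 24)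
      go : ∀ b → c (u % 24) ∧ (D * (u * u) + D′ * (v * v) ≡ᵇ N) ≡ b → ∑ (suc n) (term u v) ≡ b
      go false e = ∑-false (suc n) (λ i i≤n → false-if (λ t → contra i (≤-pred i≤n) (∧-true t)))
        where
        contra : ∀ i → i ≤ n → ((D * (u * u) ≡ᵇ 24 * i + r) ≡ true) × ((D′ * (v * v) ≡ᵇ 24 * (n ∸ i) + r′) ≡ true) → ⊥
        contra i i≤n (p , q) = absurd (trans (sym (cong₂ _∧_ cu (≡ᵇ-true (trans (cong₂ _+_ p′ q′) (trans (add i (n ∸ i) r r′) (cong (λ k → 24 * k + (r + r′)) (m+[n∸m]≡n i≤n))))))) e)
          where
          absurd : true ≡ false → ⊥
          absurd ()
          p′ = true-≡ᵇ (D * (u * u)) (24 * i + r) p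
          q′ = true-≡ᵇ (D′ * (v * v)) (24 * (n ∸ i) + r′) q
          cu : c (u % 24) ≡ true
          cu = proj₂ sep-uv (trans (sym (square-mod D u)) (trans (cong (_% 24) p′) (progression-mod i r)))
      go true e = trans (∑-single (suc n) i (term u v) (s≤s i≤n) others) (cong₂ _∧_ (≡ᵇ-true u≡) (≡ᵇ-true v≡′))
        where
        N≡ = true-≡ᵇ (D * (u * u) + D′ * (v * v)) N (proj₂ (∧-true {c (u % 24)} e))
        residues = proj₁ sep-uv (proj₁ (∧-true {c (u % 24)} e)) (trans (sym (sum-mod u v)) (trans (cong (_% 24) N≡) (progression-mod n (r + r′))))
        i = D * (u * u) / 24
        j = D′ * (v * v) / 24
        division : ∀ x q → x % 24 ≡ q → x ≡ 24 * (x / 24) + q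
        division x q e = trans (m≡m%n+[m/n]*n x 24) (trans (+-comm (x % 24) _) (cong₂ _+_ (*-comm (x / 24) 24) e))
        u≡ = division (D * (u * u)) r (trans (square-mod D u) (proj₁ residues))
        v≡ = division (D′ * (v * v)) r′ (trans (square-mod D′ v) (proj₂ residues))
        i+j≡n : i + j ≡ n
        i+j≡n = *-cancelˡ-≡ (i + j) n 24 (+-cancelʳ-≡ (r + r′) _ _ (trans (sym (add i j r r′)) (trans (sym (cong₂ _+_ u≡ v≡)) N≡)))
        i≤n : i ≤ n
        i≤n = subst (i ≤_) i+j≡n (m≤m+n i j)
        v≡′ : D′ * (v * v) ≡ 24 * (n ∸ i) + r′
        v≡′ = trans v≡ (cong (λ k → 24 * k + r′) (trans (sym (m+n∸m≡n i j)) (cong (_∸ i) i+j≡n)))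
        others : ∀ k → k ≢ i → term u v k ≡ false
        others k k≢i = cong (_∧ (D′ * (v * v) ≡ᵇ 24 * (n ∸ k) + r′)) (≡ᵇ-false λ f → k≢i (*-cancelˡ-≡ k i 24 (+-cancelʳ-≡ r _ _ (trans (sym f) u≡))))

f₁₉ : Series
f₁₉ n = τ 19 (24 * n + 19)

dilate-f₁ : ∀ n → dilate 19 f₁ n ≡ f₁₉ n
dilate-f₁ n = go (19 ∣? n)
  where
  go : (d : Dec (19 ∣ n)) → does d ∧ f₁ (n / 19) ≡ f₁₉ n
  -- 4 · 24 = 19 · 5 + 1, so 19 ∣ 24 n implies 19 ∣ n.
  go (no 19∤n) = sym (∑-false (suc (24 * n + 19)) λ v _ → ≡ᵇ-false λ e → 19∤n (∣m+n∣m⇒∣n {m = 19 * (5 * n)}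
    (subst (19 ∣_) (id n) (∣n⇒∣m*n 4 (∣m+n∣m⇒∣n (subst (19 ∣_) (trans e (+-comm (24 * n) 19)) (m∣m*n (v * v))) ∣-refl))) (m∣m*n (5 * n))))
    where
    id : ∀ n → 4 * (24 * n) ≡ 19 * (5 * n) + n
    id = solve-∀
  go (yes (divides q refl)) = trans (cong f₁ (m*n/n≡m q 19)) (trans (sym (τ-scale 19 1 (24 * q + 1))) (cong (τ 19) (id q)))
    where
    id : ∀ q → 19 * (24 * q + 1) ≡ 24 * (q * 19) + 19
    id = solve-∀

dilate₂-f₁ : ∀ n → dilate₂ f₁ n ≡ τ 2 (24 * n + 2)
dilate₂-f₁ n = go n (n % 2) (m%n<n n 2) (m≡m%n+[m/n]*n n 2)
  where
  dilate₂-even : ∀ (f : Series) q → dilate₂ f (q * 2) ≡ f q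
  dilate₂-even f zero = refl
  dilate₂-even f (suc q) = dilate₂-even (f ∘ suc) q
  dilate₂-odd : ∀ (f : Series) q → dilate₂ f (1 + q * 2) ≡ false
  dilate₂-odd f zero = refl
  dilate₂-odd f (suc q) = dilate₂-odd (f ∘ suc) q
  go : ∀ n r → r < 2 → n ≡ r + n / 2 * 2 → dilate₂ f₁ n ≡ τ 2 (24 * n + 2)
  go n 0 _ e = subst (λ n → dilate₂ f₁ n ≡ τ 2 (24 * n + 2)) (sym e) (even (n / 2))
    where
    even : ∀ q → dilate₂ f₁ (q * 2) ≡ τ 2 (24 * (q * 2) + 2)
    even q = trans (dilate₂-even f₁ q) (trans (sym (τ-scale 2 1 (24 * q + 1))) (cong (τ 2) (id q)))
      where
      id : ∀ q → 2 * (24 * q + 1) ≡ 24 * (q * 2) + 2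
      id = solve-∀
  go n 1 _ e = subst (λ n → dilate₂ f₁ n ≡ τ 2 (24 * n + 2)) (sym e) (trans (dilate₂-odd f₁ (n / 2)) (sym (∑-false (suc (24 * (1 + n / 2 * 2) + 2)) λ v _ → ≡ᵇ-false (no-square (n / 2) v))))
    where
    -- v² = 13 + 24 q is impossible modulo 8
    no-square : ∀ q v → 2 * (v * v) ≢ 24 * (1 + q * 2) + 2
    no-square q v e = residue-table 8 {P = λ r _ → (r * r) % 8 ≢ 5} (toWitness {a? = allUpTo? (λ r → allUpTo? (λ _ → ¬? ((r * r) % 8 ≟ 5)) 8) 8} _) v v
      (trans (sym (%-distribˡ-* v v 8)) (trans (cong (_% 8) (trans (*-cancelˡ-≡ (v * v) (5 + (1 + q * 3) * 8) 2 (trans e (id q))) refl)) ([m+kn]%n≡m%n 5 (1 + q * 3) 8)))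
      where
      id : ∀ q → 24 * (1 + q * 2) + 2 ≡ 2 * (5 + (1 + q * 3) * 8)
      id = solve-∀
  go n (suc (suc r)) (s<s (s<s ())) e

count₂-applyUpTo : ∀ {A : Set} {P : A → Set} (P? : Decidable P) (g : ℕ → A) n → count₂ P? (applyUpTo g n) ≡ ∑ n (λ i → does (P? (g i)))
count₂-applyUpTo P? g zero = refl
count₂-applyUpTo P? g (suc n) = trans (count₂-∷ P? (g 0) _) (cong (_xor_ (does (P? (g 0)))) (count₂-applyUpTo P? (g ∘ suc) n))

map-applyUpTo : ∀ {A B : Set} (f : A → B) (g : ℕ → A) n → map f (applyUpTo g n) ≡ applyUpTo (f ∘ g) n
map-applyUpTo f g zero = refl
map-applyUpTo f g (suc n) = cong (f (g 0) ∷_) (map-applyUpTo f (g ∘ suc) n)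

count₂-square : ∀ {P : ℕ × ℕ → Set} (P? : Decidable P) (g : ℕ → ℕ) m n →
  count₂ P? (cartesianProduct (applyUpTo g m) (upTo n)) ≡ ∑ m (λ u → ∑ n (λ v → does (P? (g u , v))))
count₂-square P? g zero n = refl
count₂-square P? g (suc m) n = trans (count₂-++ P? (map (g 0 ,_) (upTo n)) _) (cong₂ _xor_
  (trans (cong (count₂ P?) (map-applyUpTo (g 0 ,_) (λ i → i) n)) (count₂-applyUpTo P? (g 0 ,_) n)) (count₂-square P? (g ∘ suc) m n))

family-sum : ℕ → ℕ → Family → Bool
family-sum M K δ = ∑ K (λ u → ∑ K (λ v → u * u + disc δ * (v * v) ≡ᵇ scale δ * M))

families-cancel : ∀ {M} → M % 12 ≡ 5 → ∀ K → 4 * M < K → family-sum M K d9 xor (family-sum M K d19 xor family-sum M K d57) ≡ false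
families-cancel {M} M%12 K 4M<K = trans (sym expand) (points-even {M} M%12 K 4M<K)
  where
  P? = onNorm? {M} M%12
  plane = cartesianProduct (upTo K) (upTo K)
  slice : ∀ δ → count₂ P? (map (δ ,_) plane) ≡ family-sum M K δ
  slice δ = trans (count₂-map P? (λ y → P? (δ , y)) (δ ,_) (λ _ → refl) plane) (count₂-square (λ y → P? (δ , y)) (λ i → i) K K)
  expand : count₂ P? (box {M} M%12 K) ≡ family-sum M K d9 xor (family-sum M K d19 xor family-sum M K d57)
  expand = trans (count₂-++ P? (map (d9 ,_) plane) _) (cong₂ _xor_ (slice d9) (trans (count₂-++ P? (map (d19 ,_) plane) _)
    (cong₂ _xor_ (slice d19) (trans (count₂-++ P? (map (d57 ,_) plane) []) (trans (xor-identityʳ _) (slice d57))))))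

-- The even part as a theta series

always unit₃ odd₂ : ℕ → Bool
always _ = true
unit₃ a = not (a % 3 ≡ᵇ 0)
odd₂ a = a % 2 ≡ᵇ 1

module _ (N : ℕ) where

  private
    M = 12 * N + 5
    -- L already bounds all solutions; K is a multiple of 4 so that u can be split modulo 2 and v
    -- modulo 4 into whole blocks.
    L = suc (4 * M)
    K = L * 4

    M%12 : M % 12 ≡ 5
    M%12 = trans (cong (_% 12) (trans (+-comm (12 * N) 5) (cong (_+_ 5) (*-comm 12 N)))) ([m+kn]%n≡m%n 5 N 12)

    4M<K : 4 * M < K
    4M<K = m≤m*n L 4

    2M≤4M : 2 * M ≤ 4 * M
    2M≤4M = *-monoˡ-≤ M (m≤m+n 2 2)

    10-form : 24 * N + 10 ≡ 2 * M
    10-form = id N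
      where
      id : ∀ N → 24 * N + 10 ≡ 2 * (12 * N + 5)
      id = solve-∀

    20-form : 24 * (N + N) + 20 ≡ 4 * M
    20-form = id N
      where
      id : ∀ N → 24 * (N + N) + 20 ≡ 4 * (12 * N + 5)
      id = solve-∀

    10<K : 24 * N + 10 < K
    10<K = ≤-<-trans (≤-trans (≤-reflexive 10-form) 2M≤4M) 4M<K

    20<K : 24 * (N + N) + 20 < K
    20<K = ≤-<-trans (≤-reflexive 20-form) 4M<K

  sum-9 : conv f₁ (λ n → τ 9 (24 * n + 9)) N ≡ family-sum M K d9
  sum-9 = trans (conv-theta 1 9 1 9 always (toWitness {a? = separates? 1 9 1 9 always} _) K N 10<K)
    (∑-cong K λ u _ → ∑-cong K λ v _ → cong₂ _≡ᵇ_ (cong (_+ 9 * (v * v)) (*-identityˡ (u * u))) 10-form)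

  sum-57 : conv f₁ (λ n → τ 57 (24 * n + 9)) N ≡ family-sum M K d57
  sum-57 = trans (conv-theta 1 57 1 9 always (toWitness {a? = separates? 1 57 1 9 always} _) K N 10<K)
    (∑-cong K λ u _ → ∑-cong K λ v _ → cong₂ _≡ᵇ_ (cong (_+ 57 * (v * v)) (*-identityˡ (u * u))) 10-form)

  private
    S S-odd : ℕ → Bool
    S u = ∑ K (λ v → u * u + 19 * (v * v) ≡ᵇ 4 * M)
    S-odd u = ∑ K (λ v → odd₂ (u % 24) ∧ (1 * (u * u) + 19 * (v * v) ≡ᵇ 24 * (N + N) + 20))

    halves : ∀ (f : ℕ → Bool) → ∑ K f ≡ ∑ (L * 2) (λ u → f (u * 2 + 0) xor (f (u * 2 + 1) xor false))
    halves f = trans (cong (λ k → ∑ k f) (sym (*-assoc L 2 2))) (∑-blocks 2 (L * 2) f)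

    parity-24 : ∀ u r → r < 2 → odd₂ ((u * 2 + r) % 24) ≡ (r ≡ᵇ 1)
    parity-24 u r r<2 = cong (_≡ᵇ 1) (trans (m∣n⇒o%n%m≡o%m 2 24 (u * 2 + r) (divides 12 refl))
      (trans (cong (_% 2) (+-comm (u * 2) r)) (trans ([m+kn]%n≡m%n r u 2) (m<n⇒m%n≡m r<2))))

    S-odd-even : ∀ u → S-odd (u * 2 + 0) ≡ false
    S-odd-even u = ∑-false K λ v _ → cong (_∧ (1 * ((u * 2 + 0) * (u * 2 + 0)) + 19 * (v * v) ≡ᵇ 24 * (N + N) + 20)) (parity-24 u 0 z<s)

    S-odd-odd : ∀ u → S-odd (u * 2 + 1) ≡ S (u * 2 + 1)
    S-odd-odd u = ∑-cong K λ v _ → cong₂ _∧_ (parity-24 u 1 ≤-refl)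
      (cong₂ _≡ᵇ_ (cong (_+ 19 * (v * v)) (*-identityˡ ((u * 2 + 1) * (u * 2 + 1)))) 20-form)

    -- Even u forces 4 ∣ v: odd v fails modulo 4, and v ≡ 2 (mod 4) contradicts M ≡ 1 (mod 4).
    -- Dividing by 4 leaves u² + 76 w² = M.
    S-even : ∀ u → S (u * 2 + 0) ≡ ∑ L (λ w → u * u + 76 * (w * w) ≡ᵇ M)
    S-even u = trans (∑-blocks 4 L F) (∑-cong L λ w _ → block w)
      where
      F : ℕ → Bool
      F v = (u * 2 + 0) * (u * 2 + 0) + 19 * (v * v) ≡ᵇ 4 * M
      id₀ : ∀ u w → (u * 2 + 0) * (u * 2 + 0) + 19 * ((w * 4 + 0) * (w * 4 + 0)) ≡ 4 * (u * u + 76 * (w * w))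
      id₀ = solve-∀
      r₀ : ∀ w → ((u * 2 + 0) * (u * 2 + 0) + 19 * ((w * 4 + 0) * (w * 4 + 0)) ≡ᵇ 4 * M) ≡ (u * u + 76 * (w * w) ≡ᵇ M)
      r₀ w = ≡ᵇ-cong {n′ = M} (λ e → *-cancelˡ-≡ (u * u + 76 * (w * w)) M 4 (trans (sym (id₀ u w)) e)) (λ e → trans (id₀ u w) (cong (4 *_) e))
      no-odd : ∀ w s → (3 * (s * s)) % 4 ≢ 0 → ((u * 2 + 0) * (u * 2 + 0) + 19 * ((w * 4 + s) * (w * 4 + s)) ≡ᵇ 4 * M) ≡ false
      no-odd w s ne = ≡ᵇ-false λ e → ne (trans (sym ([m+kn]%n≡m%n (3 * (s * s)) (u * u + 19 * (4 * (w * w) + 2 * w * s) + 4 * (s * s)) 4))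
        (trans (cong (_% 4) (trans (sym (id u w s)) (trans e (*-comm 4 M)))) (m*n%n≡0 M 4)))
        where
        id : ∀ u w s → (u * 2 + 0) * (u * 2 + 0) + 19 * ((w * 4 + s) * (w * 4 + s)) ≡ 3 * (s * s) + (u * u + 19 * (4 * (w * w) + 2 * w * s) + 4 * (s * s)) * 4
        id = solve-∀
      -- with u = 2 u′ and v = 2 v′, v′ odd, u′² = M − 19 v′² ≡ 2 (mod 4)
      r₂ : ∀ w → ((u * 2 + 0) * (u * 2 + 0) + 19 * ((w * 4 + 2) * (w * 4 + 2)) ≡ᵇ 4 * M) ≡ false
      r₂ w = ≡ᵇ-false λ e → residue-table 4 {P = λ r _ → ((r * r) % 4 + 3) % 4 ≢ 1}
          (toWitness {a? = allUpTo? (λ r → allUpTo? (λ _ → ¬? (((r * r) % 4 + 3) % 4 ≟ 1)) 4) 4} _) u u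
          (trans (cong (λ z → (z + 3) % 4) (sym (%-distribˡ-* u u 4))) (trans (sym (%-distribˡ-+ (u * u) 3 4))
            (trans (sym ([m+kn]%n≡m%n (u * u + 3) (19 * (w * w + w) + 4) 4)) (trans (cong (_% 4) (trans (sym (id′ u w)) (*-cancelˡ-≡ (u * u + 19 * (4 * (w * w + w) + 1)) M 4 (trans (sym (id u w)) e))))
              (trans (cong (_% 4) (id″ N)) ([m+kn]%n≡m%n 1 (3 * N + 1) 4))))))
        where
        id : ∀ u w → (u * 2 + 0) * (u * 2 + 0) + 19 * ((w * 4 + 2) * (w * 4 + 2)) ≡ 4 * (u * u + 19 * (4 * (w * w + w) + 1))
        id = solve-∀
        id′ : ∀ u w → u * u + 19 * (4 * (w * w + w) + 1) ≡ u * u + 3 + (19 * (w * w + w) + 4) * 4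
        id′ = solve-∀
        id″ : ∀ N → 12 * N + 5 ≡ 1 + (3 * N + 1) * 4
        id″ = solve-∀
      block : ∀ w → ∑ 4 (λ r → F (w * 4 + r)) ≡ (u * u + 76 * (w * w) ≡ᵇ M)
      block w = trans (cong₂ _xor_ (r₀ w) (cong₂ _xor_ (no-odd w 1 (λ ())) (cong₂ _xor_ (r₂ w) (cong₂ _xor_ (no-odd w 3 (λ ())) refl)))) (xor-identityʳ _)

  sum-152 : conv (dilate₂ f₁) (λ n → τ 152 (24 * n + 8)) N ≡ ∑ (L * 2) (λ u → ∑ L (λ w → u * u + 76 * (w * w) ≡ᵇ M))
  sum-152 = begin
    conv (dilate₂ f₁) (λ n → τ 152 (24 * n + 8)) N
      ≡⟨ conv-cong dilate₂-f₁ (λ _ → refl) N ⟩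
    conv (λ n → τ 2 (24 * n + 2)) (λ n → τ 152 (24 * n + 8)) N
      ≡⟨ conv-theta 2 152 2 8 always (toWitness {a? = separates? 2 152 2 8 always} _) K N 10<K ⟩
    ∑ K (λ u → ∑ K (λ w → 2 * (u * u) + 152 * (w * w) ≡ᵇ 24 * N + 10))
      ≡⟨ ∑-cong K (λ u _ → ∑-cong K λ w _ → ≡ᵇ-cong {n′ = M} (λ e → *-cancelˡ-≡ (u * u + 76 * (w * w)) M 2 (trans (id u w) (trans e 10-form))) (λ e → trans (sym (id u w)) (trans (cong (2 *_) e) (sym 10-form)))) ⟩
    ∑ K (λ u → ∑ K (Q u))
      ≡⟨ ∑-cong K (λ u _ → ∑-extend (m≤m*n L 4) (λ w L≤w → Q-large₂ u w L≤w)) ⟩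
    ∑ K (λ u → ∑ L (Q u))
      ≡⟨ ∑-bound K (L * 2) (λ u K≤u → ∑-false L λ w _ → Q-large₁ u w (≤-trans (m≤m*n L 4) K≤u)) (λ u l → ∑-false L λ w _ → Q-large₁ u w (≤-trans (m≤m*n L 2) l)) ⟩
    ∑ (L * 2) (λ u → ∑ L (Q u)) ∎
    where
    open ≡-Reasoning
    Q : ℕ → ℕ → Bool
    Q u w = u * u + 76 * (w * w) ≡ᵇ M
    id : ∀ u w → 2 * (u * u + 76 * (w * w)) ≡ 2 * (u * u) + 152 * (w * w)
    id = solve-∀
    M<L : M < L
    M<L = s≤s (m≤n*m M 4)
    Q-large₁ : ∀ u w → L ≤ u → Q u w ≡ false
    Q-large₁ u w l = ≡ᵇ-false λ e → <⇒≢ (<-≤-trans M<L (≤-trans l (≤-trans (n≤n² u) (m≤m+n (u * u) (76 * (w * w)))))) (sym e)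
    Q-large₂ : ∀ u w → L ≤ w → Q u w ≡ false
    Q-large₂ u w l = ≡ᵇ-false λ e → <⇒≢ (<-≤-trans M<L (≤-trans l (≤-trans (n≤n² w) (≤-trans (m≤n*m (w * w) 76) (m≤n+m (76 * (w * w)) (u * u)))))) (sym e)

  -- The product f₁ f₁₉ sees only odd u. Adding the solutions with even u, evaluated by `sum-152`,
  -- completes the family; modulo 2 the correction moves to the other side.
  sum-19 : conv f₁ f₁₉ (N + N) ≡ family-sum M K d19 xor conv (dilate₂ f₁) (λ n → τ 152 (24 * n + 8)) N
  sum-19 = begin
    conv f₁ f₁₉ (N + N)
      ≡⟨ conv-theta 1 19 1 19 odd₂ (toWitness {a? = separates? 1 19 1 19 odd₂} _) K (N + N) 20<K ⟩
    ∑ K S-odd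
      ≡⟨ halves S-odd ⟩
    ∑ (L * 2) (λ u → S-odd (u * 2 + 0) xor (S-odd (u * 2 + 1) xor false))
      ≡⟨ ∑-cong (L * 2) (λ u _ → cong₂ (λ a b → a xor (b xor false)) (S-odd-even u) (S-odd-odd u)) ⟩
    ∑ (L * 2) (λ u → S (u * 2 + 1) xor false)
      ≡⟨ ∑-cong (L * 2) (λ u _ → sym (trans (xor-comm (e u xor (S (u * 2 + 1) xor false)) (e u)) (trans (sym (xor-assoc (e u) (e u) _)) (cong (_xor (S (u * 2 + 1) xor false)) (xor-same (e u)))))) ⟩
    ∑ (L * 2) (λ u → (e u xor (S (u * 2 + 1) xor false)) xor e u)
      ≡⟨ ∑-xor (L * 2) (λ u → e u xor (S (u * 2 + 1) xor false)) e ⟩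
    ∑ (L * 2) (λ u → e u xor (S (u * 2 + 1) xor false)) xor ∑ (L * 2) e
      ≡⟨ cong₂ _xor_ (trans (∑-cong (L * 2) (λ u _ → cong (_xor (S (u * 2 + 1) xor false)) (sym (S-even u)))) (sym (halves S))) (sym sum-152) ⟩
    family-sum M K d19 xor conv (dilate₂ f₁) (λ n → τ 152 (24 * n + 8)) N ∎
    where
    open ≡-Reasoning
    e : ℕ → Bool
    e u = ∑ L (λ w → u * u + 76 * (w * w) ≡ᵇ M)

  sums-cancel : family-sum M K d9 xor (family-sum M K d19 xor family-sum M K d57) ≡ false
  sums-cancel = families-cancel {M} M%12 K 4M<K

-- The last summand carries a factor f₁ so that in f₁ · Θ it becomes f₁(q²) times a theta series, as
-- required by `sum-19`.
Θ : Series
Θ = ((λ n → τ 9 (24 * n + 9)) ⊕ (λ n → τ 57 (24 * n + 9))) ⊕ conv f₁ (λ n → τ 152 (24 * n + 8))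

conv-f₁-Θ : ∀ n → conv f₁ Θ n ≡ conv f₁ f₁₉ (n + n)
conv-f₁-Θ n = begin
  conv f₁ Θ n
    ≡⟨ conv-⊕ʳ f₁ ((λ n → τ 9 (24 * n + 9)) ⊕ (λ n → τ 57 (24 * n + 9))) (conv f₁ Y) n ⟩
  conv f₁ ((λ n → τ 9 (24 * n + 9)) ⊕ (λ n → τ 57 (24 * n + 9))) n xor conv f₁ (conv f₁ Y) n
    ≡⟨ cong₂ _xor_ (trans (conv-⊕ʳ f₁ (λ n → τ 9 (24 * n + 9)) (λ n → τ 57 (24 * n + 9)) n) (cong₂ _xor_ (sum-9 n) (sum-57 n)))
        (trans (sym (conv-assoc f₁ f₁ Y n)) (conv-cong (conv-square f₁) (λ _ → refl) n)) ⟩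
  (s₉ xor s₅₇) xor s₁₅₂
    ≡⟨ cong (_xor s₁₅₂) (solve s₉ s₁₉ s₅₇ (sums-cancel n)) ⟩
  s₁₉ xor s₁₅₂
    ≡⟨ sum-19 n ⟨
  conv f₁ f₁₉ (n + n) ∎
  where
  open ≡-Reasoning
  Y : Series
  Y n = τ 152 (24 * n + 8)
  s₉ = family-sum (12 * n + 5) (suc (4 * (12 * n + 5)) * 4) d9
  s₁₉ = family-sum (12 * n + 5) (suc (4 * (12 * n + 5)) * 4) d19
  s₅₇ = family-sum (12 * n + 5) (suc (4 * (12 * n + 5)) * 4) d57
  s₁₅₂ = conv (dilate₂ f₁) Y n
  solve : ∀ x y z → x xor (y xor z) ≡ false → x xor z ≡ y
  solve false false false _ = refl
  solve false true true _ = refl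
  solve true false true _ = refl
  solve true true false _ = refl

regular-even-part : ∀ n → odd (b 19 (n + n)) ≡ Θ n
regular-even-part = conv-injective f₁ (λ i → odd (b 19 (i + i))) Θ refl λ n → begin
  conv f₁ (λ i → A (i + i)) n ≡⟨ conv-dilate₂ f₁ A n ⟨
  conv (dilate₂ f₁) A (n + n) ≡⟨ conv-cong (conv-square f₁) (λ _ → refl) (n + n) ⟨
  conv (conv f₁ f₁) A (n + n) ≡⟨ conv-assoc f₁ f₁ A (n + n) ⟩
  conv f₁ (conv f₁ A) (n + n) ≡⟨ conv-cong (λ _ → refl) (λ i → trans (regular-generating-function 19 i) (dilate-f₁ i)) (n + n) ⟩
  conv f₁ f₁₉ (n + n) ≡⟨ conv-f₁-Θ n ⟨
  conv f₁ Θ n ∎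
  where
  open ≡-Reasoning
  A : Series
  A i = odd (b 19 i)

-- Representations of multiples of 11

-- Both fields express that a representation of a multiple of 11 is divisible by 11: its value is
-- then a multiple of 121, and division by 11 is a bijection.
record Inert (R : ℕ → Bool) : Set where
  field
    vanish : ∀ y → ¬ 11 ∣ y → R (11 * y) ≡ false
    descend : ∀ x → R (121 * x) ≡ R x
open Inert

inert-xor : ∀ {R S} → Inert R → Inert S → Inert (λ x → R x xor S x)
inert-xor r s = record
  { vanish = λ y ∤ → cong₂ _xor_ (vanish r y ∤) (vanish s y ∤)
  ; descend = λ x → cong₂ _xor_ (descend r x) (descend s x) }

∑-sieve : ∀ K g → (∀ u → ¬ 11 ∣ u → g u ≡ false) → ∑ (K * 11) g ≡ ∑ K (λ w → g (w * 11))
∑-sieve K g e = trans (∑-blocks 11 K g) (∑-cong K λ w _ → trans (cong₂ _xor_ (cong g (+-identityʳ (w * 11)))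
    (∑-false 10 λ i i<10 → e (w * 11 + suc i) (not-multiple w i i<10))) (xor-identityʳ _))
  where
  not-multiple : ∀ w i → i < 10 → ¬ 11 ∣ w * 11 + suc i
  not-multiple w i i<10 d = <⇒≱ (s<s i<10) (∣⇒≤ (∣m+n∣m⇒∣n d (n∣m*n w)))

module _ (D : ℕ) .{{_ : NonZero D}} (prime-to : ∀ u → 11 ∣ D * (u * u) → 11 ∣ u) where

  private
    square-11 : ∀ q → D * (q * 11 * (q * 11)) ≡ 11 * (11 * (D * (q * q)))
    square-11 q = id D q
      where
      id : ∀ D q → D * (q * 11 * (q * 11)) ≡ 11 * (11 * (D * (q * q)))
      id = solve-∀

  τ-inert : Inert (τ D)
  τ-inert .vanish y 11∤y = ∑-false (suc (11 * y)) λ u _ → ≡ᵇ-false λ e → contra u e (prime-to u (subst (11 ∣_) (sym e) (m∣m*n y)))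
    where
    contra : ∀ u → D * (u * u) ≡ 11 * y → ¬ 11 ∣ u
    contra _ e (divides q refl) = 11∤y (divides (D * (q * q)) (trans (sym (*-cancelˡ-≡ (11 * (D * (q * q))) y 11 (trans (sym (square-11 q)) e))) (*-comm 11 (D * (q * q)))))
  τ-inert .descend x = begin
    τ D (121 * x) ≡⟨ τ-bound D (121 * x) (K * 11) (≤-<-trans ≤-refl (m≤m*n K 11)) ⟩
    ∑ (K * 11) (λ v → D * (v * v) ≡ᵇ 121 * x) ≡⟨ ∑-sieve K _ (λ u 11∤u → ≡ᵇ-false λ e → 11∤u (prime-to u (subst (11 ∣_) (sym (trans e (*-assoc 11 11 x))) (m∣m*n (11 * x))))) ⟩
    ∑ K (λ w → D * (w * 11 * (w * 11)) ≡ᵇ 121 * x) ≡⟨ ∑-cong K (λ w _ → ≡ᵇ-cong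
        (λ e → *-cancelˡ-≡ (D * (w * w)) x 121 (trans (*-assoc 11 11 (D * (w * w))) (trans (sym (square-11 w)) e)))
        (λ e → trans (square-11 w) (trans (sym (*-assoc 11 11 (D * (w * w)))) (cong (121 *_) e)))) ⟩
    ∑ K (λ w → D * (w * w) ≡ᵇ x) ≡⟨ τ-bound D x K (s≤s (m≤n*m x 121)) ⟨
    τ D x ∎
    where
    open ≡-Reasoning
    K = suc (121 * x)

theta₁₅₂ : ℕ → Bool
theta₁₅₂ x = theta₂ (suc x) 1 152 (λ u → unit₃ (u % 24)) x

private
  c : ℕ → Bool
  c u = unit₃ (u % 24)

  -- The condition 3 ∤ u must survive the descent from 121 x to x.
  c-11 : ∀ w → c (w * 11) ≡ c w
  c-11 w = trans (cong (λ a → unit₃ a) (%-distribˡ-* w 11 24)) (residue-table 24 {P = λ r _ → unit₃ ((r * 11) % 24) ≡ unit₃ r}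
    (toWitness {a? = allUpTo? (λ r → allUpTo? (λ _ → unit₃ ((r * 11) % 24) Data.Bool.≟ unit₃ r) 24) 24} _) w w)

  theta-bound : ∀ x K → x < K → theta₁₅₂ x ≡ theta₂ K 1 152 c x
  theta-bound x K x<K = trans (∑-cong (suc x) λ u _ → ∑-bound (suc x) K (large₂ u x<1+x) (large₂ u x<K))
      (∑-bound (suc x) K (λ u l → ∑-false K λ v _ → large₁ v x<1+x u l) (λ u l → ∑-false K λ v _ → large₁ v x<K u l))
    where
    x<1+x = n<1+n x
    large₁ : ∀ {K} v → x < K → ∀ u → K ≤ u → c u ∧ (1 * (u * u) + 152 * (v * v) ≡ᵇ x) ≡ false
    large₁ v x<K u l = ∧-falseʳ (c u) (≡ᵇ-false λ e → <⇒≢ (<-≤-trans x<K (≤-trans l (≤-trans (n≤n² u) (≤-trans (m≤n*m (u * u) 1) (m≤m+n (1 * (u * u)) (152 * (v * v))))))) (sym e))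
    large₂ : ∀ {K} u → x < K → ∀ v → K ≤ v → c u ∧ (1 * (u * u) + 152 * (v * v) ≡ᵇ x) ≡ false
    large₂ u x<K v l = ∧-falseʳ (c u) (≡ᵇ-false λ e → <⇒≢ (<-≤-trans x<K (≤-trans l (≤-trans (n≤n² v) (≤-trans (m≤n*m (v * v) 152) (m≤n+m (152 * (v * v)) (1 * (u * u))))))) (sym e))

  -- −152 ≡ 2 is not a square modulo 11.
  anisotropic : ∀ u v → 11 ∣ 1 * (u * u) + 152 * (v * v) → (11 ∣ u) × (11 ∣ v)
  anisotropic u v d = m%n≡0⇒n∣m u 11 (proj₁ zeros) , m%n≡0⇒n∣m v 11 (proj₂ zeros)
    where
    residues : (1 * (u * u) + 152 * (v * v)) % 11 ≡ ((u % 11) * (u % 11) + 152 * ((v % 11) * (v % 11))) % 11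
    residues = trans (cong (λ z → (z + 152 * (v * v)) % 11) (*-identityˡ (u * u))) (quad-mod 11 152 u v)
    zeros : (u % 11 ≡ 0) × (v % 11 ≡ 0)
    zeros = residue-table 11 {P = λ r s → (r * r + 152 * (s * s)) % 11 ≡ 0 → (r ≡ 0) × (s ≡ 0)}
      (toWitness {a? = allUpTo? (λ r → allUpTo? (λ s → ((r * r + 152 * (s * s)) % 11 ≟ 0) →-dec ((r ≟ 0) ×-dec (s ≟ 0))) 11) 11} _) u v
      (trans (sym residues) (n∣m⇒m%n≡0 _ 11 d))

  norm-11 : ∀ q r → 1 * (q * 11 * (q * 11)) + 152 * (r * 11 * (r * 11)) ≡ 11 * (11 * (1 * (q * q) + 152 * (r * r)))
  norm-11 = solve-∀

theta₁₅₂-inert : Inert theta₁₅₂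
theta₁₅₂-inert .vanish y 11∤y = ∑-false (suc (11 * y)) λ u _ → ∑-false (suc (11 * y)) λ v _ → ∧-falseʳ (c u) (≡ᵇ-false λ e →
    contra u v e (anisotropic u v (subst (11 ∣_) (sym e) (m∣m*n y))))
  where
  contra : ∀ u v → 1 * (u * u) + 152 * (v * v) ≡ 11 * y → ¬ ((11 ∣ u) × (11 ∣ v))
  contra _ _ e (divides q refl , divides r refl) = 11∤y (divides (1 * (q * q) + 152 * (r * r))
    (trans (sym (*-cancelˡ-≡ (11 * (1 * (q * q) + 152 * (r * r))) y 11 (trans (sym (norm-11 q r)) e))) (*-comm 11 (1 * (q * q) + 152 * (r * r)))))
theta₁₅₂-inert .descend x = begin
  theta₁₅₂ (121 * x) ≡⟨ theta-bound (121 * x) (K * 11) (m≤m*n K 11) ⟩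
  ∑ (K * 11) (λ u → ∑ (K * 11) (F u)) ≡⟨ ∑-sieve K (λ u → ∑ (K * 11) (F u)) (λ u 11∤u → ∑-false (K * 11) λ v _ → F-false u v (11∤u ∘ proj₁)) ⟩
  ∑ K (λ u → ∑ (K * 11) (F (u * 11))) ≡⟨ ∑-cong K (λ u _ → trans (∑-sieve K (F (u * 11)) (λ v 11∤v → F-false (u * 11) v (11∤v ∘ proj₂)))
                                                                (∑-cong K λ v _ → F-11 u v)) ⟩
  theta₂ K 1 152 c x ≡⟨ theta-bound x K (s≤s (m≤n*m x 121)) ⟨
  theta₁₅₂ x ∎
  where
  open ≡-Reasoning
  K = suc (121 * x)
  F : ℕ → ℕ → Bool
  F u v = c u ∧ (1 * (u * u) + 152 * (v * v) ≡ᵇ 121 * x)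
  F-false : ∀ u v → ¬ ((11 ∣ u) × (11 ∣ v)) → F u v ≡ false
  F-false u v ne = ∧-falseʳ (c u) (≡ᵇ-false λ e → ne (anisotropic u v (subst (11 ∣_) (sym (trans e (*-assoc 11 11 x))) (m∣m*n (11 * x)))))
  F-11 : ∀ u v → F (u * 11) (v * 11) ≡ c u ∧ (1 * (u * u) + 152 * (v * v) ≡ᵇ x)
  F-11 u v = cong₂ _∧_ (c-11 u) (≡ᵇ-cong {n′ = x}
    (λ e → *-cancelˡ-≡ (1 * (u * u) + 152 * (v * v)) x 121 (trans (*-assoc 11 11 (1 * (u * u) + 152 * (v * v))) (trans (sym (norm-11 u v)) e)))
    (λ e → trans (norm-11 u v) (trans (sym (*-assoc 11 11 (1 * (u * u) + 152 * (v * v)))) (cong (121 *_) e))))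

representations : ℕ → Bool
representations x = (τ 9 x xor τ 57 x) xor theta₁₅₂ x

Θ≡representations : ∀ n → Θ n ≡ representations (24 * n + 9)
Θ≡representations n = cong (_xor_ (τ 9 (24 * n + 9) xor τ 57 (24 * n + 9)))
  (conv-theta 1 152 1 8 unit₃ (toWitness {a? = separates? 1 152 1 8 unit₃} _) (suc (24 * n + 9)) n ≤-refl)

representations-inert : Inert representations
representations-inert = inert-xor (inert-xor (τ-inert 9 (λ u d → prime-to 9 (toWitness {a? = table? 9} _) u d)) (τ-inert 57 (λ u d → prime-to 57 (toWitness {a? = table? 57} _) u d))) theta₁₅₂-inert
  where
  Table : ℕ → Set
  Table D = ∀ {r} → r < 11 → ∀ {s} → s < 11 → (D % 11) * ((r * r) % 11) % 11 ≡ 0 → r ≡ 0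
  table? : ∀ D → Dec (Table D)
  table? D = allUpTo? (λ r → allUpTo? (λ _ → ((D % 11) * ((r * r) % 11) % 11 ≟ 0) →-dec (r ≟ 0)) 11) 11
  prime-to : ∀ D → Table D → ∀ u → 11 ∣ D * (u * u) → 11 ∣ u
  prime-to D t u d = m%n≡0⇒n∣m u 11 (residue-table 11 {P = λ r _ → (D % 11) * ((r * r) % 11) % 11 ≡ 0 → r ≡ 0} t u u
    (trans (trans (cong (λ z → (D % 11) * z % 11) (sym (%-distribˡ-* u u 11))) (sym (%-distribˡ-* D (u * u) 11))) (n∣m⇒m%n≡0 _ 11 d)))

-- The three congruences

odd⇒%2 : ∀ m n → odd m ≡ odd n → m % 2 ≡ n % 2
odd⇒%2 m n e = trans (bit m) (trans (cong (if_then 1 else 0) e) (sym (bit n)))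
  where
  bit : ∀ n → n % 2 ≡ (if odd n then 1 else 0)
  bit zero = refl
  bit (suc zero) = refl
  bit (suc (suc n)) = trans (trans (cong (_% 2) (+-comm 2 n)) ([m+n]%n≡m%n n 2)) (trans (bit n) (cong (if_then 1 else 0) (sym (odd-2+ n))))

-- 24 (11 m + 1) + 9 = 11 (24 m + 3), and 24 m + 3 ≡ 2 m + 3 vanishes modulo 11 only for m ≡ 4; this
-- is where the 4 comes from.
Θ-vanish : ∀ m → m % 11 ≢ 4 → Θ (11 * m + 1) ≡ false
Θ-vanish m m≢4 = trans (Θ≡representations (11 * m + 1)) (trans (cong representations (id m)) (vanish representations-inert (24 * m + 3) 11∤))
  where
  id : ∀ m → 24 * (11 * m + 1) + 9 ≡ 11 * (24 * m + 3)
  id = solve-∀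
  id′ : ∀ r q → 24 * (r + q * 11) + 3 ≡ 24 * r + 3 + (24 * q) * 11
  id′ = solve-∀
  11∤ : ¬ 11 ∣ 24 * m + 3
  11∤ d = m≢4 (residue-table 11 {P = λ r _ → (24 * r + 3) % 11 ≡ 0 → r ≡ 4}
    (toWitness {a? = allUpTo? (λ r → allUpTo? (λ _ → ((24 * r + 3) % 11 ≟ 0) →-dec (r ≟ 4)) 11) 11} _) m m
    (trans (sym (trans (cong (λ z → (24 * z + 3) % 11) (m≡m%n+[m/n]*n m 11)) (trans (cong (_% 11) (id′ (m % 11) (m / 11))) ([m+kn]%n≡m%n (24 * (m % 11) + 3) (24 * (m / 11)) 11))))
      (n∣m⇒m%n≡0 _ 11 d)))

-- For m = 4 + 11 q the represented number is 121 (24 q + 9), and the factor 121 can be removed.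
Θ-descend : ∀ q → Θ (11 * (4 + q * 11) + 1) ≡ Θ q
Θ-descend q = trans (Θ≡representations (11 * (4 + q * 11) + 1)) (trans (cong representations (id q)) (trans (descend representations-inert (24 * q + 9)) (sym (Θ≡representations q))))
  where
  id : ∀ q → 24 * (11 * (4 + q * 11) + 1) + 9 ≡ 121 * (24 * q + 9)
  id = solve-∀

private
  b-even : ∀ n → odd (b 19 (2 * n)) ≡ Θ n
  b-even n = trans (cong (odd ∘ b 19) (cong (_+_ n) (+-identityʳ n))) (regular-even-part n)

  b-22m+2 : ∀ m → odd (b 19 (22 * m + 2)) ≡ Θ (11 * m + 1)
  b-22m+2 m = trans (cong (odd ∘ b 19) (id m)) (b-even (11 * m + 1))
    where
    id : ∀ m → 22 * m + 2 ≡ 2 * (11 * m + 1)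
    id = solve-∀

b-vanish : ∀ m → m % 11 ≢ 4 → b 19 (22 * m + 2) % 2 ≡ 0
b-vanish m m≢4 = odd⇒%2 (b 19 (22 * m + 2)) 0 (trans (b-22m+2 m) (Θ-vanish m m≢4))

b-descend : ∀ q → b 19 (22 * (4 + q * 11) + 2) % 2 ≡ b 19 (2 * q) % 2
b-descend q = odd⇒%2 (b 19 (22 * (4 + q * 11) + 2)) (b 19 (2 * q)) (trans (b-22m+2 (4 + q * 11)) (trans (Θ-descend q) (sym (b-even q))))

dissection : ∀ m → b 19 (22 * m + 2) % 2 ≡ rhsCoeff m % 2
dissection m with m % 11 ≟ 4
... | no m≢4 = b-vanish m m≢4
... | yes m≡4 = subst (λ m → b 19 (22 * m + 2) % 2 ≡ b 19 (2 * ((m ∸ 4) / 11)) % 2) (sym m≡)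
      (trans (b-descend (m / 11)) (cong (λ q → b 19 (2 * q) % 2) (sym (m*n/n≡m (m / 11) 11))))
  where
  m≡ : m ≡ 4 + m / 11 * 11
  m≡ = trans (m≡m%n+[m/n]*n m 11) (cong (_+ m / 11 * 11) m≡4)

progression : ∀ (k : ℤ) → ¬ ((+ 11) ∣ℤ (k -ℤ + 4)) → ∀ n → bℤ 19 (+ 242 *ℤ + n +ℤ + 22 *ℤ k +ℤ + 2) % 2 ≡ 0
progression k 11∤ n = trans (cong (λ z → bℤ 19 z % 2) (id (+ n) k)) (go (+ 11 *ℤ + n +ℤ k) refl)
  where
  id : ∀ n k → + 242 *ℤ n +ℤ + 22 *ℤ k +ℤ + 2 ≡ + 22 *ℤ (+ 11 *ℤ n +ℤ k) +ℤ + 2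
  id = ℤR.solve-∀
  go : ∀ z → + 11 *ℤ + n +ℤ k ≡ z → bℤ 19 (+ 22 *ℤ z +ℤ + 2) % 2 ≡ 0
  -- If 11 n + k is negative, the argument is at most -20 and `bℤ` takes its default value 0.
  go -[1+ j ] _ = cong (λ z → bℤ 19 z % 2) (negative j)
    where
    id₁ : ∀ z → + 22 *ℤ (-ℤ (+ 1 +ℤ z)) +ℤ + 2 ≡ -ℤ (+ 20 +ℤ + 22 *ℤ z)
    id₁ = ℤR.solve-∀
    negative : ∀ j → + 22 *ℤ -[1+ j ] +ℤ + 2 ≡ -[1+ 19 + 22 * j ]
    negative j = trans (id₁ (+ j)) (cong (λ z → -ℤ (+ 20 +ℤ z)) (sym (ℤ.pos-* 22 j)))
  go (+ m) e = trans (cong (λ z → bℤ 19 (z +ℤ + 2) % 2) (sym (ℤ.pos-* 22 m))) (b-vanish m m≢4)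
    where
    m≢4 : m % 11 ≢ 4
    m≢4 m≡4 = 11∤ (Signed.∣⇒∣ᵤ (Signed.divides (+ (m / 11) -ℤ + n) (id₂ (+ m) (+ n) k (+ (m / 11)) e
      (trans (cong +_ (trans (m≡m%n+[m/n]*n m 11) (cong (_+ m / 11 * 11) m≡4))) (cong (_+ℤ_ (+ 4)) (ℤ.pos-* (m / 11) 11))))))
      where
      id₂ : ∀ m n k q → + 11 *ℤ n +ℤ k ≡ m → m ≡ + 4 +ℤ q *ℤ + 11 → k -ℤ + 4 ≡ (q -ℤ n) *ℤ + 11
      id₂ m n k q refl f = trans (i₁ n k) (trans (cong (λ z → z -ℤ + 11 *ℤ n -ℤ + 4) f) (i₂ n q))
        where
        i₁ : ∀ n k → k -ℤ + 4 ≡ + 11 *ℤ n +ℤ k -ℤ + 11 *ℤ n -ℤ + 4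
        i₁ = ℤR.solve-∀
        i₂ : ∀ n q → + 4 +ℤ q *ℤ + 11 -ℤ + 11 *ℤ n -ℤ + 4 ≡ (q -ℤ n) *ℤ + 11
        i₂ = ℤR.solve-∀

-- Part one at m = 11q + 4 reads b₁₉(121 · 2q + 90) ≡ b₁₉(2q).
iterate : ℕ → ℕ → ℕ → ℕ
iterate zero k n = 22 * (11 * n + k) + 2
iterate (suc d) k n = 121 * iterate d k n + 90

-- All iterates are even, so `b-descend` carries the vanishing at d = 0 up to every d.
iterate-vanish : ∀ d k n → k % 11 ≢ 4 → b 19 (iterate d k n) % 2 ≡ 0
iterate-vanish d k n k≢4 = trans (cong (λ x → b 19 x % 2) (proj₂ (even d))) (vanish-at d)
  where
  even : ∀ d → ∃ λ q → iterate d k n ≡ 2 * q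
  even zero = 11 * (11 * n + k) + 1 , id (11 * n + k)
    where
    id : ∀ m → 22 * m + 2 ≡ 2 * (11 * m + 1)
    id = solve-∀
  even (suc d) = 121 * proj₁ (even d) + 45 , trans (cong (λ x → 121 * x + 90) (proj₂ (even d))) (id (proj₁ (even d)))
    where
    id : ∀ q → 121 * (2 * q) + 90 ≡ 2 * (121 * q + 45)
    id = solve-∀
  vanish-at : ∀ d → b 19 (2 * proj₁ (even d)) % 2 ≡ 0
  vanish-at zero = trans (cong (λ x → b 19 x % 2) (sym (proj₂ (even 0)))) (b-vanish (11 * n + k)
    λ e → k≢4 (trans (sym (trans (cong (_% 11) (trans (+-comm (11 * n) k) (cong (_+_ k) (*-comm 11 n)))) ([m+kn]%n≡m%n k n 11))) e))
  vanish-at (suc d) = trans (cong (λ x → b 19 x % 2) (id (proj₁ (even d)))) (trans (b-descend (proj₁ (even d))) (vanish-at d))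
    where
    id : ∀ q → 2 * (121 * q + 45) ≡ 22 * (4 + q * 11) + 2
    id = solve-∀

-- 1 + 121 + ... + 121^(d-1), which is (11^(2 d) - 1) / 120 without a division.
repunit : ℕ → ℕ
repunit zero = 0
repunit (suc d) = 121 * repunit d + 1

11^-step : ∀ e → 11 ^ (2 + e) ≡ 121 * 11 ^ e
11^-step e = sym (*-assoc 11 11 (11 ^ e))

11^[2*suc] : ∀ d → 11 ^ (2 * suc d) ≡ 121 * 11 ^ (2 * d)
11^[2*suc] d = trans (cong (11 ^_) (*-suc 2 d)) (11^-step (2 * d))

11^[2*] : ∀ d → 11 ^ (2 * d) ≡ 1 + repunit d * 120
11^[2*] zero = refl
11^[2*] (suc d) = trans (11^[2*suc] d) (trans (cong (121 *_) (11^[2*] d)) (id (repunit d)))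
  where
  id : ∀ r → 121 * (1 + r * 120) ≡ 1 + (121 * r + 1) * 120
  id = solve-∀

-- The exponents are those of d + 1, so d counts the applications of x ↦ 121 x + 90; the added
-- constants accumulate to 90 times a repunit in base 121.
iterate-closed : ∀ d k n →
  2 * 11 ^ (2 * suc d) * n + 2 * 11 ^ (2 * suc d ∸ 1) * k + 2 * 11 ^ (2 * suc d ∸ 2) + 90 * ((11 ^ (2 * suc d ∸ 2) ∸ 1) / 120)
  ≡ iterate d k n
iterate-closed d k n = trans (cong₂ (λ x y → x + 90 * y) powers quotient′) (closed d)
  where
  X = 11 ^ (2 * d)
  2*suc : 2 * suc d ≡ 2 + 2 * d
  2*suc = *-suc 2 d
  powers : 2 * 11 ^ (2 * suc d) * n + 2 * 11 ^ (2 * suc d ∸ 1) * k + 2 * 11 ^ (2 * suc d ∸ 2) ≡ 2 * (121 * X) * n + 2 * (11 * X) * k + 2 * X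
  powers = trans (cong (λ e → 2 * 11 ^ e * n + 2 * 11 ^ (e ∸ 1) * k + 2 * 11 ^ (e ∸ 2)) 2*suc)
    (cong (λ z → 2 * z * n + 2 * (11 * X) * k + 2 * X) (11^-step (2 * d)))
  quotient′ : (11 ^ (2 * suc d ∸ 2) ∸ 1) / 120 ≡ repunit d
  quotient′ = trans (cong (λ e → (11 ^ (e ∸ 2) ∸ 1) / 120) 2*suc) (trans (cong (λ z → (z ∸ 1) / 120) (11^[2*] d)) (m*n/n≡m (repunit d) 120))
  closed : ∀ d → 2 * (121 * 11 ^ (2 * d)) * n + 2 * (11 * 11 ^ (2 * d)) * k + 2 * 11 ^ (2 * d) + 90 * repunit d ≡ iterate d k n
  closed zero = id n k
    where
    id : ∀ n k → 2 * (121 * 1) * n + 2 * (11 * 1) * k + 2 * 1 + 90 * 0 ≡ 22 * (11 * n + k) + 2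
    id = solve-∀
  closed (suc d) = trans (cong (λ z → 2 * (121 * z) * n + 2 * (11 * z) * k + 2 * z + 90 * (121 * repunit d + 1)) (11^[2*suc] d))
    (trans (id (11 ^ (2 * d)) n k (repunit d)) (cong (λ z → 121 * z + 90) (closed d)))
    where
    id : ∀ X n k r → 2 * (121 * (121 * X)) * n + 2 * (11 * (121 * X)) * k + 2 * (121 * X) + 90 * (121 * r + 1)
      ≡ 121 * (2 * (121 * X) * n + 2 * (11 * X) * k + 2 * X + 90 * r) + 90
    id = solve-∀

theorem1p4 :
    ((m : ℕ) → b 19 (22 * m + 2) % 2 ≡ rhsCoeff m % 2)
    × ((k : ℤ) → ¬ ((+ 11) ∣ℤ (k -ℤ + 4)) → (n : ℕ) →
        bℤ 19 (+ 242 *ℤ + n +ℤ + 22 *ℤ k +ℤ + 2) % 2 ≡ 0)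
    × ((d k n : ℕ) → d ≥ 1 → k ≥ 1 → k % 11 ≢ 4 →
        b 19 (2 * 11 ^ (2 * d) * n + 2 * 11 ^ (2 * d ∸ 1) * k + 2 * 11 ^ (2 * d ∸ 2)
              + 90 * ((11 ^ (2 * d ∸ 2) ∸ 1) / 120)) % 2 ≡ 0)
theorem1p4 = dissection , progression , λ { (suc d) k n _ _ k≢4 → trans (cong (λ x → b 19 x % 2) (iterate-closed d k n)) (iterate-vanish d k n k≢4) }
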